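{- Let $\widetilde Q:\mathbb{Z}_{\ge1}\to\mathbb{Z}$ be defined by $\widetilde Q(1)=\widetilde Q(2)=1$ and, for $n\ge3$, \[ \widetilde Q(n)=\widetilde Q\bigl(n-\widetilde Q(n-1)\bigr)+\widetilde Q\bigl(n-\widetilde Q(n-2)\bigr)+(-1)^n . \] Then, as $n\to\infty$, \[ \left|\frac{\widetilde Q(n)}{n}-\frac12\right|=O\!\left(\frac{1}{\sqrt{\log n}}\right). \]
   Context: The recursion is well defined for every $n\ge1$: at each step the indices $n-\widetilde Q(n-1)$ and $n-\widetilde Q(n-2)$ lie in $\{1,\dots,n-1\}$. -}

module Defs where

open import Data.Nat using (ℕ; suc; _≤_; _∸_)
import Data.Integer as ℤ
open import Data.Integer using (ℤ; +_; -_)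
open import Data.Product using (_×_)
open import Relation.Binary.PropositionalEquality using (_≡_)

-- The recurrence of the paper, for a function f : ℕ → ℤ (value at 0 is irrelevant):
--   f 1 = f 2 = 1 and, for n ≥ 3, with i = n - f(n-1), j = n - f(n-2) (required to lie in
--   {1,…,n-1}, as the paper asserts they do, so the recursion makes sense),
--   f n = f i + f j + (-1)^n.
-- The set of such f is a singleton (strong induction on n); its element is Q̃.
IsQtilde : (ℕ → ℤ) → Set
IsQtilde f =
  (f 1 ≡ + 1) × (f 2 ≡ + 1) ×
  (∀ n → 3 ≤ n →
     ((ℤ.+ 1 ℤ.≤ (+ n) ℤ.- f (n ∸ 1)) × ((+ n) ℤ.- f (n ∸ 1) ℤ.≤ + (n ∸ 1)) ×
      (ℤ.+ 1 ℤ.≤ (+ n) ℤ.- f (n ∸ 2)) × ((+ n) ℤ.- f (n ∸ 2) ℤ.≤ + (n ∸ 1)) ×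
      (f n ≡ f (ℤ.∣ (+ n) ℤ.- f (n ∸ 1) ∣) ℤ.+ f (ℤ.∣ (+ n) ℤ.- f (n ∸ 2) ∣)
               ℤ.+ (- (+ 1)) ℤ.^ n)))

{-# OPTIONS --safe #-}
-- Every value of Q̃ is odd, so put a(k) = (Q̃(2k) + 1)/2 and b(k) = (Q̃(2k−1) + 1)/2.
--
-- Both sequences are slow (increments 0 or 1), and time splits into generations, roughly doubling
-- in length, on each of which the two are complementary: a(k) + b(k + s) − k is constant, with s
-- alternating between 0 and 1.  Consecutive generations overlap in a short block where one sequence
-- is constant and the other increases by 1 at every step; this block is what carries the induction.
--
-- On a generation the recursion is, up to bounded errors, Conway's: writing u, v for the two
-- sequences, u(k) ≈ v(u(k)) + v(v(k)) and u(k) + v(k) ≈ k.  Starting from k and following k ↦ u(k),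
-- k ↦ v(k) through r generations (the roles of u and v alternate), the 2^r resulting indices are
-- only r + 1 approximate values Φ(0) ≥ Φ(1) ≥ … ≥ Φ(r), the i-th occurring C(r, i) times, all of
-- size O(k/2^r).  Hence |u(k) − v(k)| ≲ Σ C(r−1, i) (Φ(i) − Φ(i+1)) ≤ max C(r−1, i) · O(k/2^r), which
-- is O(k/√r).  Taking r of order log k leaves the accumulated errors negligible.
module Submission where

open import Defs

-- A nested recursion reads earlier values at places that depend on its own values, so no estimate
-- can begin before the shape of both sequences is known exactly. That shape is carried by an exact
-- induction from block to block. The margins x, y ≥ 2 of a block absorb the off-by-one shifts, and
-- the induction never tightens: at each generation exactly one margin grows by 1. It starts from a
-- computed block of value 43. Complementarity is exact only within a generation; over all of them
-- the shifts add up, and what remains is a(k) + b(k) = k + O(log k). Each level of the descent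
-- therefore adds O(log k) to the error of every index, this happens at 2^r places, and the order of
-- the Φ(i) holds only up to such errors. The budget is closed by a depth near a quarter of log₂ n:
-- with M = 2^μ, r = 2μ and 8μ ≤ log₂ n, every error is O(M⁴), and after scaling by 2^r = M² it is
-- still O(n). The depth stays proportional to log n, which costs only a constant. An even r makes
-- the largest coefficient a central one, with (2μ + 1)β² ≤ 16^μ, so no square root is ever taken.

module Proof where

  open import Agda.Builtin.FromNat using (Number; fromNat)
  open import Data.Bool using (Bool; true; false; T; not; if_then_else_; _∧_; _∨_)
  open import Data.Empty using (⊥; ⊥-elim)
  open import Data.Fin using (Fin; zero; suc)
  open import Data.Integer hiding (suc; _/_)
  import Data.Integer.Literals as ℤLiterals
  open import Data.Integer.Properties
  open import Data.Integer.Tactic.RingSolver using (solve-∀)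
  open import Data.List using (List; []; _∷_; _++_; map; concatMap)
  open import Data.List.Relation.Unary.All using (All; []; _∷_)
  open import Data.List.Relation.Unary.All.Properties using (++⁺)
  open import Data.Nat as ℕ using (ℕ; zero; suc)
  open import Data.Nat.DivMod using (_/_; m/n*n≤m; m*n/n≡m; m≡m%n+[m/n]*n; m%n<n; /-monoˡ-≤)
  open import Data.Nat.Induction using (<-rec)
  import Data.Nat.Literals as ℕLiterals
  open import Data.Nat.Logarithm using (⌊log₂_⌋; ⌊log₂⌋-mono-≤; ⌊log₂⌊n/2⌋⌋≡⌊log₂n⌋∸1; ⌊log₂[2^n]⌋≡n)
  import Data.Nat.Properties as ℕₚ
  open import Data.Nat.Tactic.RingSolver using () renaming (solve-∀ to ℕsolve-∀)
  open import Data.Product using (Σ; ∃; ∃₂; _×_; _,_; proj₁; proj₂)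
  open import Data.Sum using (_⊎_; inj₁; inj₂)
  open import Data.Unit using (⊤; tt)
  open import Data.Vec using (Vec; []; _∷_)
  open import Function using (_∘_)
  open import Relation.Binary.PropositionalEquality using (_≡_; refl; sym; trans; cong; cong₂; subst; subst₂)
  open import Relation.Nullary using (Dec; yes; no; ¬_)
  open import Relation.Nullary.Decidable using (⌊_⌋; toWitness; _×-dec_)

  -- Linear integer arithmetic

  infixl 6 _:+_ _:-_
  infixl 7 _:*_
  infix 4 _:≤_ _:≡_

  data Expr (n : ℕ) : Set where
    var  : Fin n → Expr n
    con  : ℕ → Expr n
    _:+_ _:-_ : Expr n → Expr n → Expr n
    _:*_ : ℕ → Expr n → Expr n

  instance
    number-ℕ : Number ℕ
    number-ℕ = ℕLiterals.number
    number-ℤ : Number ℤ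
    number-ℤ = ℤLiterals.number
    number-Expr : ∀ {n} → Number (Expr n)
    number-Expr = record { Constraint = λ _ → ⊤ ; fromNat = λ k → con k }

  data Atom (n : ℕ) : Set where
    _:≤_ _:≡_ : Expr n → Expr n → Atom n
    falsum : Atom n

  Env : ℕ → Set
  Env = Vec ℤ

  look : ∀ {n} → Env n → Fin n → ℤ
  look (x ∷ _) zero = x
  look (_ ∷ ρ) (suc i) = look ρ i

  ⟦_⟧ : ∀ {n} → Expr n → Env n → ℤ
  ⟦ var i ⟧ ρ = look ρ i
  ⟦ con k ⟧ ρ = + k
  ⟦ e :+ f ⟧ ρ = ⟦ e ⟧ ρ + ⟦ f ⟧ ρ
  ⟦ e :- f ⟧ ρ = ⟦ e ⟧ ρ - ⟦ f ⟧ ρ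
  ⟦ k :* e ⟧ ρ = + k * ⟦ e ⟧ ρ

  ⟦_⟧ₐ : ∀ {n} → Atom n → Env n → Set
  ⟦ e :≤ f ⟧ₐ ρ = ⟦ e ⟧ ρ ≤ ⟦ f ⟧ ρ
  ⟦ e :≡ f ⟧ₐ ρ = ⟦ e ⟧ ρ ≡ ⟦ f ⟧ ρ
  ⟦ falsum ⟧ₐ ρ = ⊥

  Form : ℕ → Set
  Form n = ℤ × Vec ℤ n

  dot : ∀ {n} → Vec ℤ n → Env n → ℤ
  dot [] [] = 0ℤ
  dot (a ∷ as) (x ∷ ρ) = a * x + dot as ρ

  value : ∀ {n} → Form n → Env n → ℤ
  value (k , as) ρ = k + dot as ρ

  zeros : ∀ {n} → Vec ℤ n
  zeros {zero} = []
  zeros {suc n} = 0ℤ ∷ zeros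

  unit : ∀ {n} → Fin n → Vec ℤ n
  unit zero = 1ℤ ∷ zeros
  unit (suc i) = 0ℤ ∷ unit i

  combine : ∀ {n} → ℤ → Vec ℤ n → ℤ → Vec ℤ n → Vec ℤ n
  combine p [] q [] = []
  combine p (a ∷ as) q (b ∷ bs) = (p * a + q * b) ∷ combine p as q bs

  combineF : ∀ {n} → ℤ → Form n → ℤ → Form n → Form n
  combineF p (k , as) q (l , bs) = p * k + q * l , combine p as q bs

  dot-zeros : ∀ {n} (ρ : Env n) → dot zeros ρ ≡ 0ℤ
  dot-zeros [] = refl
  dot-zeros (x ∷ ρ) = trans (cong₂ _+_ (*-zeroˡ x) (dot-zeros ρ)) refl

  dot-unit : ∀ {n} (i : Fin n) (ρ : Env n) → dot (unit i) ρ ≡ look ρ i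
  dot-unit zero (x ∷ ρ) = trans (cong₂ _+_ (*-identityˡ x) (dot-zeros ρ)) (+-identityʳ x)
  dot-unit (suc i) (x ∷ ρ) = trans (cong₂ _+_ (*-zeroˡ x) (dot-unit i ρ)) (+-identityˡ _)

  dot-combine : ∀ {n} p (as : Vec ℤ n) q bs ρ → dot (combine p as q bs) ρ ≡ p * dot as ρ + q * dot bs ρ
  dot-combine p [] q [] [] = sym (cong₂ _+_ (*-zeroʳ p) (*-zeroʳ q))
  dot-combine p (a ∷ as) q (b ∷ bs) (x ∷ ρ) =
    trans (cong (λ z → (p * a + q * b) * x + z) (dot-combine p as q bs ρ)) (rearrange p a q b x _ _)
    where
    rearrange : ∀ p a q b x s t → (p * a + q * b) * x + (p * s + q * t) ≡ p * (a * x + s) + q * (b * x + t)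
    rearrange = solve-∀

  value-combine : ∀ {n} p (f : Form n) q g ρ → value (combineF p f q g) ρ ≡ p * value f ρ + q * value g ρ
  value-combine p (k , as) q (l , bs) ρ =
    trans (cong (λ z → (p * k + q * l) + z) (dot-combine p as q bs ρ)) (rearrange p k q l _ _)
    where
    rearrange : ∀ p a q b s t → (p * a + q * b) + (p * s + q * t) ≡ p * (a + s) + q * (b + t)
    rearrange = solve-∀

  form : ∀ {n} → Expr n → Form n
  form (var i) = 0ℤ , unit i
  form (con k) = + k , zeros
  form (e :+ f) = combineF 1ℤ (form e) 1ℤ (form f)
  form (e :- f) = combineF 1ℤ (form e) -1ℤ (form f)
  form (k :* e) = combineF (+ k) (form e) 0ℤ (form e)

  form-sound : ∀ {n} (e : Expr n) ρ → value (form e) ρ ≡ ⟦ e ⟧ ρ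
  form-sound (var i) ρ = trans (+-identityˡ _) (dot-unit i ρ)
  form-sound (con k) ρ = trans (cong (λ z → + k + z) (dot-zeros ρ)) (+-identityʳ _)
  form-sound (e :+ f) ρ = trans (value-combine 1ℤ (form e) 1ℤ (form f) ρ)
    (cong₂ _+_ (trans (*-identityˡ _) (form-sound e ρ)) (trans (*-identityˡ _) (form-sound f ρ)))
  form-sound (e :- f) ρ = trans (value-combine 1ℤ (form e) -1ℤ (form f) ρ)
    (cong₂ _+_ (trans (*-identityˡ _) (form-sound e ρ)) (trans (-1*i≡-i _) (cong -_ (form-sound f ρ))))
  form-sound (k :* e) ρ = trans (value-combine (+ k) (form e) 0ℤ (form e) ρ)
    (trans (cong₂ _+_ (cong (λ z → + k * z) (form-sound e ρ)) (*-zeroˡ (value (form e) ρ))) (+-identityʳ _))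

  data Kind : Set where
    eq≡0 geq0 : Kind

  Constraint : ℕ → Set
  Constraint n = Kind × Form n

  Holds : ∀ {n} → Env n → Constraint n → Set
  Holds ρ (eq≡0 , f) = value f ρ ≡ 0ℤ
  Holds ρ (geq0 , f) = 0ℤ ≤ value f ρ

  difference : ∀ {n} → Expr n → Expr n → Form n
  difference e f = form (f :- e)

  constraint : ∀ {n} → Atom n → Constraint n
  constraint (e :≤ f) = geq0 , difference e f
  constraint (e :≡ f) = eq≡0 , difference e f
  constraint falsum = geq0 , (-1ℤ , zeros)

  constraint-sound : ∀ {n} (a : Atom n) ρ → ⟦ a ⟧ₐ ρ → Holds ρ (constraint a)
  constraint-sound (e :≤ f) ρ h = subst (0ℤ ≤_) (sym (form-sound (f :- e) ρ)) (i≤j⇒0≤j-i h)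
  constraint-sound (e :≡ f) ρ h = trans (form-sound (f :- e) ρ) (i≡j⇒i-j≡0 (sym h))
  constraint-sound falsum ρ ()

  positive? : ℤ → Bool
  positive? +[1+ _ ] = true
  positive? _ = false

  negative? : ℤ → Bool
  negative? -[1+ _ ] = true
  negative? _ = false

  zero? : ℤ → Bool
  zero? +0 = true
  zero? _ = false

  -- Discarding a constraint that still mentions the variable is sound. Hence `substitute` and
  -- `resolve` need no proof that their leading coefficients cancel: it is tested here.
  tail : ∀ {n} → Constraint (suc n) → List (Constraint n)
  tail (κ , k , a ∷ as) = if zero? a then (κ , k , as) ∷ [] else []

  tail-sound : ∀ {n} x (ρ : Env n) (c : Constraint (suc n)) → Holds (x ∷ ρ) c → All (Holds ρ) (tail c)
  tail-sound x ρ (eq≡0 , k , +0 ∷ as) h = trans (cong (λ z → k + z) (sym (trans (cong (λ z → z + dot as ρ)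
      (*-zeroˡ x)) (+-identityˡ _)))) h ∷ []
  tail-sound x ρ (geq0 , k , +0 ∷ as) h = subst (λ z → 0ℤ ≤ k + z) (trans (cong (λ z → z + dot as ρ) (*-zeroˡ
      x)) (+-identityˡ _)) h ∷ []
  tail-sound x ρ (eq≡0 , k , +[1+ _ ] ∷ as) h = []
  tail-sound x ρ (geq0 , k , +[1+ _ ] ∷ as) h = []
  tail-sound x ρ (eq≡0 , k , -[1+ _ ] ∷ as) h = []
  tail-sound x ρ (geq0 , k , -[1+ _ ] ∷ as) h = []

  head : ∀ {n} → Form (suc n) → ℤ
  head (k , a ∷ as) = a

  substitute : ∀ {n} → Form (suc n) → Constraint (suc n) → List (Constraint n)
  substitute e (κ , f) = tail (κ , combineF (+ ∣ head e ∣) f (if negative? (head e) then head f else - head f)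
      e)

  0≤+ : ∀ k → 0ℤ ≤ + k
  0≤+ k = +≤+ ℕ.z≤n

  0≤-* : ∀ k {z} → 0ℤ ≤ z → 0ℤ ≤ + k * z
  0≤-* k {z} h = subst (_≤ + k * z) (*-zeroʳ (+ k)) (*-monoˡ-≤-nonNeg (+ k) h)

  0≤-+ : ∀ {y z} → 0ℤ ≤ y → 0ℤ ≤ z → 0ℤ ≤ y + z
  0≤-+ h h′ = +-mono-≤ h h′

  substitute-sound : ∀ {n} x (ρ : Env n) e → value e (x ∷ ρ) ≡ 0ℤ → ∀ c → Holds (x ∷ ρ) c → All (Holds ρ)
      (substitute e c)
  substitute-sound x ρ e he (κ , f) h = tail-sound x ρ (κ , combineF (+ ∣ head e ∣) f q e) (combined κ h)
    where
    q = if negative? (head e) then head f else - head f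
    reduce : value (combineF (+ ∣ head e ∣) f q e) (x ∷ ρ) ≡ + ∣ head e ∣ * value f (x ∷ ρ)
    reduce = trans (value-combine (+ ∣ head e ∣) f q e (x ∷ ρ))
      (trans (cong (λ z → + ∣ head e ∣ * value f (x ∷ ρ) + z) (trans (cong (λ z → q * z) he) (*-zeroʳ q)))
          (+-identityʳ _))
    combined : ∀ κ → Holds (x ∷ ρ) (κ , f) → Holds (x ∷ ρ) (κ , combineF (+ ∣ head e ∣) f q e)
    combined eq≡0 h = trans reduce (trans (cong (λ z → + ∣ head e ∣ * z) h) (*-zeroʳ (+ ∣ head e ∣)))
    combined geq0 h = subst (0ℤ ≤_) (sym reduce) (0≤-* ∣ head e ∣ h)

  resolve : ∀ {n} → Constraint (suc n) → Constraint (suc n) → List (Constraint n)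
  resolve (geq0 , f) (geq0 , g) =
    if positive? (head f) ∧ negative? (head g)
    then tail (geq0 , combineF (+ ∣ head g ∣) f (+ ∣ head f ∣) g)
    else []
  -- Pairs are resolved only when every equation has leading coefficient zero, and such equations
  -- are kept by `tail`.
  resolve _ _ = []

  resolve-sound : ∀ {n} x (ρ : Env n) c d → Holds (x ∷ ρ) c → Holds (x ∷ ρ) d → All (Holds ρ) (resolve c d)
  resolve-sound x ρ (eq≡0 , f) d hc hd = []
  resolve-sound x ρ (geq0 , f) (eq≡0 , g) hc hd = []
  resolve-sound x ρ (geq0 , f) (geq0 , g) hc hd with positive? (head f) ∧ negative? (head g)
  ... | false = []
  ... | true = tail-sound x ρ (geq0 , combineF (+ ∣ head g ∣) f (+ ∣ head f ∣) g) (subst (0ℤ ≤_) (sym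
      (value-combine (+ ∣ head g ∣) f (+ ∣ head f ∣) g (x ∷ ρ)))
                  (0≤-+ (0≤-* ∣ head g ∣ hc) (0≤-* ∣ head f ∣ hd)))

  findEq : ∀ {n} → List (Constraint (suc n)) → List (Form (suc n))
  findEq [] = []
  findEq ((eq≡0 , f) ∷ cs) = if zero? (head f) then findEq cs else f ∷ []
  findEq ((geq0 , f) ∷ cs) = findEq cs

  findEq-sound : ∀ {n} (ρ : Env (suc n)) cs → All (Holds ρ) cs → All (λ f → value f ρ ≡ 0ℤ) (findEq cs)
  findEq-sound ρ [] [] = []
  findEq-sound ρ ((eq≡0 , f) ∷ cs) (h ∷ hs) with zero? (head f)
  ... | true = findEq-sound ρ cs hs
  ... | false = h ∷ []
  findEq-sound ρ ((geq0 , f) ∷ cs) (h ∷ hs) = findEq-sound ρ cs hs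

  concatMap-sound : ∀ {A B : Set} {P : A → Set} {Q : B → Set} (f : A → List B) →
    (∀ a → P a → All Q (f a)) → ∀ as → All P as → All Q (concatMap f as)
  concatMap-sound f h [] [] = []
  concatMap-sound f h (a ∷ as) (p ∷ ps) = ++⁺ (h a p) (concatMap-sound f h as ps)

  -- An equation mentioning the variable, if there is one, is solved for it; otherwise Fourier–Motzkin.
  eliminateBy : ∀ {n} → List (Form (suc n)) → List (Constraint (suc n)) → List (Constraint n)
  eliminateBy (e ∷ _) cs = concatMap (substitute e) cs
  eliminateBy [] cs = concatMap tail cs ++ concatMap (λ c → concatMap (resolve c) cs) cs

  eliminate : ∀ {n} → List (Constraint (suc n)) → List (Constraint n)
  eliminate cs = eliminateBy (findEq cs) cs

  eliminate-sound : ∀ {n} x (ρ : Env n) cs → All (Holds (x ∷ ρ)) cs → All (Holds ρ) (eliminate cs)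
  eliminate-sound x ρ cs hs = by (findEq cs) (findEq-sound (x ∷ ρ) cs hs)
    where
    by : ∀ es → All (λ f → value f (x ∷ ρ) ≡ 0ℤ) es → All (Holds ρ) (eliminateBy es cs)
    by (e ∷ _) (he ∷ _) = concatMap-sound (substitute e) (substitute-sound x ρ e he) cs hs
    by [] [] = ++⁺ (concatMap-sound tail (tail-sound x ρ) cs hs)
      (concatMap-sound (λ c → concatMap (resolve c) cs)
        (λ c hc → concatMap-sound (resolve c) (λ d hd → resolve-sound x ρ c d hc hd) cs hs) cs hs)

  absurd? : Constraint 0 → Bool
  absurd? (eq≡0 , k , []) = negative? k ∨ positive? k
  absurd? (geq0 , k , []) = negative? k

  any-absurd? : List (Constraint 0) → Bool
  any-absurd? [] = false
  any-absurd? (c ∷ cs) = absurd? c ∨ any-absurd? cs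

  inconsistent? : ∀ {n} → List (Constraint n) → Bool
  inconsistent? {zero} cs = any-absurd? cs
  inconsistent? {suc n} cs = inconsistent? (eliminate cs)

  inconsistent-sound : ∀ {n} (cs : List (Constraint n)) ρ → T (inconsistent? cs) → ¬ All (Holds ρ) cs
  inconsistent-sound {suc n} cs (x ∷ ρ) t hs = inconsistent-sound (eliminate cs) ρ t (eliminate-sound x ρ cs hs)
  inconsistent-sound {zero} ((eq≡0 , +[1+ _ ] , []) ∷ cs) [] t (() ∷ hs)
  inconsistent-sound {zero} ((eq≡0 , -[1+ _ ] , []) ∷ cs) [] t (() ∷ hs)
  inconsistent-sound {zero} ((geq0 , -[1+ _ ] , []) ∷ cs) [] t (() ∷ hs)
  inconsistent-sound {zero} ((eq≡0 , +0 , []) ∷ cs) [] t (_ ∷ hs) = inconsistent-sound cs [] t hs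
  inconsistent-sound {zero} ((geq0 , + _ , []) ∷ cs) [] t (_ ∷ hs) = inconsistent-sound cs [] t hs

  -- The elimination is rational; integrality enters only here, where the negation of e ≤ f becomes
  -- f + 1 ≤ e. An equation is proved by refuting both strict orders, and for `falsum` the trivial 0
  -- ≤ 0 leaves the hypotheses alone to be refuted.
  negations : ∀ {n} → Atom n → List (Constraint n)
  negations (e :≤ f) = constraint (f :+ 1 :≤ e) ∷ []
  negations (e :≡ f) = constraint (f :+ 1 :≤ e) ∷ constraint (e :+ 1 :≤ f) ∷ []
  negations falsum = constraint (0 :≤ 0) ∷ []

  all-inconsistent? : ∀ {n} → List (Constraint n) → List (Constraint n) → Bool
  all-inconsistent? [] cs = true
  all-inconsistent? (c ∷ ns) cs = inconsistent? (c ∷ cs) ∧ all-inconsistent? ns cs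

  data Problem (n : ℕ) : Set where
    _⊨_ : List (Atom n) → Atom n → Problem n

  infixr 3 _⇒_
  infix 3 ⊢_

  ⊢_ : ∀ {n} → Atom n → Problem n
  ⊢ g = [] ⊨ g

  _⇒_ : ∀ {n} → Atom n → Problem n → Problem n
  h ⇒ (hs ⊨ g) = (h ∷ hs) ⊨ g

  valid? : ∀ {n} → Problem n → Bool
  valid? (hs ⊨ g) = all-inconsistent? (negations g) (map constraint hs)

  Implies : ∀ {n} → List (Atom n) → Env n → Set → Set
  Implies [] ρ G = G
  Implies (h ∷ hs) ρ G = ⟦ h ⟧ₐ ρ → Implies hs ρ G

  Meaning : ∀ {n} → Problem n → Env n → Set
  Meaning (hs ⊨ g) ρ = Implies hs ρ (⟦ g ⟧ₐ ρ)

  T-∧ : ∀ a b → T (a ∧ b) → T a × T b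
  T-∧ true b t = tt , t

  ≰⇒+1≤ : ∀ {i j} → ¬ (i ≤ j) → j + 1ℤ ≤ i
  ≰⇒+1≤ {i} {j} h = subst (_≤ i) (+-comm 1ℤ j) (i<j⇒suc[i]≤j (≰⇒> h))

  valid-sound : ∀ {n} (p : Problem n) → T (valid? p) → ∀ ρ → Meaning p ρ
  valid-sound (hs ⊨ g) t ρ = collect hs (λ all → decide g t all)
    where
    collect : ∀ hs {G : Set} → (All (Holds ρ) (map constraint hs) → G) → Implies hs ρ G
    collect [] k = k []
    collect (h ∷ hs) k p = collect hs (λ all → k (constraint-sound h ρ p ∷ all))
    decide : ∀ g → T (valid? (hs ⊨ g)) → All (Holds ρ) (map constraint hs) → ⟦ g ⟧ₐ ρ
    decide (e :≤ f) t all with ⟦ e ⟧ ρ ≤? ⟦ f ⟧ ρ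
    ... | yes p = p
    ... | no ¬p = ⊥-elim (inconsistent-sound _ ρ (proj₁ (T-∧ _ _ t)) (constraint-sound (f :+ 1 :≤ e) ρ (≰⇒+1≤
        ¬p) ∷ all))
    decide (e :≡ f) t all with ⟦ e ⟧ ρ ≤? ⟦ f ⟧ ρ | ⟦ f ⟧ ρ ≤? ⟦ e ⟧ ρ
    ... | yes p | yes q = ≤-antisym p q
    ... | no ¬p | _ = ⊥-elim (inconsistent-sound _ ρ (proj₁ (T-∧ _ _ t)) (constraint-sound (f :+ 1 :≤ e) ρ
        (≰⇒+1≤ ¬p) ∷ all))
    ... | yes _ | no ¬p = ⊥-elim (inconsistent-sound _ ρ (proj₁ (T-∧ _ _ (proj₂ (T-∧ (inconsistent? (constraint
        (f :+ 1 :≤ e) ∷ map constraint hs)) _ t)))) (constraint-sound (e :+ 1 :≤ f) ρ (≰⇒+1≤ ¬p) ∷ all))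
    decide falsum t all = inconsistent-sound _ ρ (proj₁ (T-∧ _ _ t)) (constraint-sound (0 :≤ 0) ρ ≤-refl ∷ all)

  -- A problem is written as a function of named variables, in the same order in which `∀Env` later
  -- takes the integers.
  Curried : ℕ → (A B : Set) → Set
  Curried zero A B = B
  Curried (suc n) A B = A → Curried n A B

  applyVars : ∀ n {m} {B : Set} → (Fin n → Fin m) → Curried n (Expr m) B → B
  applyVars zero ι b = b
  applyVars (suc n) ι f = applyVars n (ι ∘ suc) (f (var (ι zero)))

  ∀Env : ∀ n → (Env n → Set) → Set
  ∀Env zero P = P []
  ∀Env (suc n) P = ∀ x → ∀Env n (λ ρ → P (x ∷ ρ))

  curryEnv : ∀ n {P : Env n → Set} → (∀ ρ → P ρ) → ∀Env n P
  curryEnv zero h = h []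
  curryEnv (suc n) h x = curryEnv n (λ ρ → h (x ∷ ρ))

  -- The variables are explicit because unification does not recover summands from a sum; validity is
  -- decided by evaluation during type checking.
  linear : ∀ n (p : Curried n (Expr n) (Problem n)) {_ : T (valid? (applyVars n (λ i → i) p))} →
           ∀Env n (Meaning (applyVars n (λ i → i) p))
  linear n p {t} = curryEnv n (valid-sound (applyVars n (λ i → i) p) t)

  -- Generations

  ≤-or-> : ∀ i j → i ≤ j ⊎ j + 1 ≤ i
  ≤-or-> i j with i ≤? j
  ... | yes p = inj₁ p
  ... | no ¬p = inj₂ (≰⇒+1≤ ¬p)

  interval-induction : (P : ℤ → Set) (lo hi : ℤ) → P lo → (∀ t → lo ≤ t → t + 1 ≤ hi → P t → P (t + 1)) →
    ∀ t → lo ≤ t → t ≤ hi → P t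
  interval-induction P lo hi base step t lo≤t t≤hi = subst P end≡t (go ∣ t - lo ∣ (subst (_≤ hi) (sym end≡t)
      t≤hi))
    where
    end≡t : lo + + ∣ t - lo ∣ ≡ t
    end≡t = trans (cong (λ z → lo + z) (0≤i⇒+∣i∣≡i (i≤j⇒0≤j-i lo≤t))) (linear 2 (λ lo t →
        ⊢ lo :+ (t :- lo) :≡ t) lo t)
    go : ∀ n → lo + + n ≤ hi → P (lo + + n)
    go zero _ = subst P (linear 1 (λ lo → ⊢ lo :≡ lo :+ 0) lo) base
    go (suc n) h = subst P (next n) (step (lo + + n) (lower n) (subst (_≤ hi) (sym (next n)) h) (go n (shrink n
        h)))
      where
      next : ∀ n → lo + + n + 1 ≡ lo + + suc n
      next n = trans (+-assoc lo (+ n) 1) (cong (λ z → lo + + z) (ℕₚ.+-comm n 1))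
      lower : ∀ n → lo ≤ lo + + n
      lower n = i≤i+j lo (+ n)
      shrink : ∀ n → lo + + suc n ≤ hi → lo + + n ≤ hi
      shrink n h = ≤-trans (subst (lo + + n ≤_) (next n) (i≤i+j (lo + + n) 1)) h

  monotone : (f : ℤ → ℤ) (lo hi : ℤ) → (∀ t → lo ≤ t → t + 1 ≤ hi → f t ≤ f (t + 1)) →
    ∀ i j → lo ≤ i → i ≤ j → j ≤ hi → f i ≤ f j
  monotone f lo hi step i j lo≤i i≤j j≤hi =
    interval-induction (λ t → f i ≤ f t) i hi ≤-refl
      (λ t i≤t t+1≤hi h → ≤-trans h (step t (≤-trans lo≤i i≤t) t+1≤hi)) j i≤j j≤hi

  -- One generation, in coordinates where its complementarity reads u t + v t = t + 1; the next one
  -- has coordinates (v , u (· − 1)).  Complementarity of the preceding generation is `lock`, and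
  -- [2c − 1 − x , 2c − 1 + y] is the block where the two overlap.  From l and m on, u and v are
  -- known to be slow; d is the drift accumulated through the changes of coordinates.
  record Generation (u v : ℤ → ℤ) (ε c x y l m d : ℤ) : Set where
    field
      0≤ε : 0 ≤ ε
      ε≤1 : ε ≤ 1
      2≤x : 2 ≤ x
      2≤y : 2 ≤ y
      0≤d : 0 ≤ d
      large : x + y + 3 ≤ c
      l≤c : l + 3 ≤ c
      m≤c : m + 3 ≤ c
      rec-u : ∀ t → c ≤ t → u t ≡ v (t + 1 - v t) + v (t + 1 - u (t - 1)) - ε
      rec-v : ∀ t → c ≤ t → v t ≡ u (t - u (t - 1)) + u (t - v (t - 1)) - (1 - ε)
      block-u : ∀ t → 2 * c - 1 - x ≤ t → t ≤ 2 * c - 1 + y → u t ≡ t + 1 - c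
      block-v : ∀ t → 2 * c - 1 - x ≤ t → t ≤ 2 * c - 1 + y → v t ≡ c
      lock : ∀ t → c - 2 ≤ t → t + 1 ≤ 2 * c - 1 + y → v (t + 1) + u t ≡ t + 1
      step-u : ∀ t → l ≤ t → t + 1 ≤ 2 * c - 1 + y → u t ≤ u (t + 1) × u (t + 1) ≤ u t + 1
      step-v : ∀ t → m ≤ t → t + 1 ≤ 2 * c - 1 + y → v t ≤ v (t + 1) × v (t + 1) ≤ v t + 1
      spread : ∀ t → l ≤ t → m ≤ t → t ≤ 2 * c - 1 + y → t ≤ u t + v t + d × u t + v t ≤ t + 2

  -- From one generation to the next

  module NextGeneration {u v : ℤ → ℤ} {ε c x y l m d : ℤ} (G : Generation u v ε c x y l m d) where
    open Generation G

    -- Complementarity at t turns the arguments t + 1 - u t and t + 1 - v t into v t and u t, so the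
    -- recursion takes Conway's form without error.
    rec-v-locked : ∀ t → c ≤ t + 1 → u t + v t ≡ t + 1 → v (t + 1) ≡ u (v t) + u (u t) - (1 - ε)
    rec-v-locked t c≤t+1 h = trans (rec-v (t + 1) c≤t+1)
      (cong₂ (λ i j → u i + u j - (1 - ε))
        (trans (cong (λ z → t + 1 - u z) back) (linear 3 (λ ut vt t → ut :+ vt :≡ t :+ 1 ⇒ ⊢ t :+ 1 :- ut :≡ vt)
            (u t) (v t) t h))
        (trans (cong (λ z → t + 1 - v z) back) (linear 3 (λ ut vt t → ut :+ vt :≡ t :+ 1 ⇒ ⊢ t :+ 1 :- vt :≡ ut)
            (u t) (v t) t h)))
      where
      back : t + 1 - 1 ≡ t
      back = linear 1 (λ t → ⊢ t :+ 1 :- 1 :≡ t) t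

    -- The first argument is kept as an unknown w, because u (t + 1) + v (t + 1) ≡ t + 2 is not yet
    -- available when this is used to prove it. Once it is, w = u (t + 1) gives a fixed-point
    -- equation for u (t + 1).
    rec-u-locked : ∀ t w → c ≤ t + 1 → u t + v t ≡ t + 1 → w + v (t + 1) ≡ t + 1 + 1 →
      u (t + 1) ≡ v w + v (v t + 1) - ε
    rec-u-locked t w c≤t+1 h h′ = trans (rec-u (t + 1) c≤t+1)
      (cong₂ (λ i j → v i + v j - ε)
        (linear 3 (λ w vt1 t → w :+ vt1 :≡ t :+ 1 :+ 1 ⇒ ⊢ t :+ 1 :+ 1 :- vt1 :≡ w) w (v (t + 1)) t h′)
        (trans (cong (λ z → t + 1 + 1 - u z) back) (linear 3 (λ ut vt t → ut :+ vt :≡ t :+ 1 ⇒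
            ⊢ t :+ 1 :+ 1 :- ut :≡ vt :+ 1) (u t) (v t) t h)))
      where
      back : t + 1 - 1 ≡ t
      back = linear 1 (λ t → ⊢ t :+ 1 :- 1 :≡ t) t

    v≤c : ∀ i → m ≤ i → i ≤ 2 * c - 1 - x → v i ≤ c
    v≤c i m≤i i≤b = ≤-trans
      (monotone v m (2 * c - 1 + y) (λ t m≤t t≤ → proj₁ (step-v t m≤t t≤)) i (2 * c - 1 - x) m≤i i≤b
        (linear 3 (λ x y c → 2 :≤ x ⇒ 2 :≤ y ⇒ ⊢ 2 :* c :- 1 :- x :≤ 2 :* c :- 1 :+ y) x y c 2≤x 2≤y))
      (≤-reflexive (block-v (2 * c - 1 - x) ≤-refl (linear 3 (λ x y c → 2 :≤ x ⇒ 2 :≤ y ⇒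
          ⊢ 2 :* c :- 1 :- x :≤ 2 :* c :- 1 :+ y) x y c 2≤x 2≤y)))

    -- The state between the block of this generation and that of the next: u climbs from c + y to
    -- 2c − ε while v climbs from c to the start of the block.
    record Moving (s : ℤ) : Set where
      field
        lock₀ : u s + v s ≡ s + 1
        lock₁ : u (s + 1) + v (s + 1) ≡ s + 1 + 1
        u₀≤u₁ : u s ≤ u (s + 1)
        v₀≤v₁ : v s ≤ v (s + 1)
        c+y≤u : c + y ≤ u (s + 1)
        c≤v : c ≤ v (s + 1)
        u≤ : u (s + 1) ≤ 2 * c - ε
        v≤ : v (s + 1) ≤ 2 * c - 1 - x

    module Step (s : ℤ) (s-large : 2 * c - 2 + y ≤ s) (M : Moving s) (v< : v (s + 1) + 1 ≤ 2 * c - 1 - x) where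
      open Moving M
      u₀ = u s
      v₀ = v s
      u₁ = u (s + 1)
      v₁ = v (s + 1)
      v₂ = v (s + 1 + 1)
      u₂ = u (s + 1 + 1)

      rec-v₁ : v₁ ≡ u v₀ + u u₀ - (1 - ε)
      rec-v₁ = rec-v-locked s (linear 4 (λ c y s x → 2 :* c :- 2 :+ y :≤ s ⇒ 2 :≤ y ⇒ 2 :≤ x ⇒ x :+ y :+ 3 :≤ c
          ⇒ ⊢ c :≤ s :+ 1) c y s x s-large 2≤y 2≤x large) lock₀

      c≤s+2 : c ≤ s + 1 + 1
      c≤s+2 = linear 4 (λ c y s x → 2 :* c :- 2 :+ y :≤ s ⇒ 2 :≤ y ⇒ 2 :≤ x ⇒ x :+ y :+ 3 :≤ c ⇒
          ⊢ c :≤ s :+ 1 :+ 1) c y s x s-large 2≤y 2≤x large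

      rec-v₂ : v₂ ≡ u v₁ + u u₁ - (1 - ε)
      rec-v₂ = rec-v-locked (s + 1) c≤s+2 lock₁

      c≤v₀ : c - 1 ≤ v₀
      c≤v₀ = linear 6 (λ us vs s us1 vs1 c → us :+ vs :≡ s :+ 1 ⇒ us1 :+ vs1 :≡ s :+ 1 :+ 1 ⇒ us :≤ us1 ⇒ c :≤
          vs1 ⇒ ⊢ c :- 1 :≤ vs) (u s) (v s) s (u (s + 1)) (v (s + 1)) c lock₀ lock₁ u₀≤u₁ c≤v

      c≤u₀ : c ≤ u₀
      c≤u₀ = linear 7 (λ us vs s us1 vs1 c y → us :+ vs :≡ s :+ 1 ⇒ us1 :+ vs1 :≡ s :+ 1 :+ 1 ⇒ vs :≤ vs1 ⇒ c :+
          y :≤ us1 ⇒ 2 :≤ y ⇒ ⊢ c :≤ us) (u s) (v s) s (u (s + 1)) (v (s + 1)) c y lock₀ lock₁ v₀≤v₁ c+y≤u 2≤y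

      lock-v₁ : v (v₁ + 1) + u v₁ ≡ v₁ + 1
      lock-v₁ = lock v₁ (linear 2 (λ c v₁ → c :≤ v₁ ⇒ ⊢ c :- 2 :≤ v₁) c v₁ c≤v)
          (linear 4 (λ v₁ c x y → v₁ :+ 1 :≤ 2 :* c :- 1 :- x ⇒ 2 :≤ x ⇒ 2 :≤ y ⇒ ⊢ v₁ :+ 1 :≤ 2 :* c :- 1 :+ y)
          v₁ c x y v< 2≤x 2≤y)

      lock-u₁ : v (u₁ + 1) + u u₁ ≡ u₁ + 1
      lock-u₁ = lock u₁ (linear 3 (λ c y u₁ → c :+ y :≤ u₁ ⇒ 2 :≤ y ⇒ ⊢ c :- 2 :≤ u₁) c y u₁ c+y≤u 2≤y)
          (linear 4 (λ u₁ c ε y → u₁ :≤ 2 :* c :- ε ⇒ 0 :≤ ε ⇒ 2 :≤ y ⇒ ⊢ u₁ :+ 1 :≤ 2 :* c :- 1 :+ y)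
          u₁ c ε y u≤ 0≤ε 2≤y)

      data Move : Set where
        v-moves : v₁ ≡ v₀ + 1 → u₁ ≡ u₀ → Move
        u-moves : v₁ ≡ v₀ → u₁ ≡ u₀ + 1 → Move

      move : Move
      move with ≤-or-> v₁ v₀
      ... | inj₁ h = u-moves (≤-antisym h v₀≤v₁)
        (linear 5 (λ us vs s us1 vs1 → us :+ vs :≡ s :+ 1 ⇒ us1 :+ vs1 :≡ s :+ 1 :+ 1 ⇒ vs1 :≤ vs ⇒ vs :≤ vs1 ⇒
            ⊢ us1 :≡ us :+ 1) (u s) (v s) s (u (s + 1)) (v (s + 1)) lock₀ lock₁ h v₀≤v₁)
      ... | inj₂ h = v-moves
        (linear 5 (λ us vs s us1 vs1 → us :+ vs :≡ s :+ 1 ⇒ us1 :+ vs1 :≡ s :+ 1 :+ 1 ⇒ vs :+ 1 :≤ vs1 ⇒ us :≤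
            us1 ⇒ ⊢ vs1 :≡ vs :+ 1) (u s) (v s) s (u (s + 1)) (v (s + 1)) lock₀ lock₁ h u₀≤u₁)
        (linear 5 (λ us vs s us1 vs1 → us :+ vs :≡ s :+ 1 ⇒ us1 :+ vs1 :≡ s :+ 1 :+ 1 ⇒ vs :+ 1 :≤ vs1 ⇒ us :≤
            us1 ⇒ ⊢ us1 :≡ us) (u s) (v s) s (u (s + 1)) (v (s + 1)) lock₀ lock₁ h u₀≤u₁)

      -- By complementarity at s and s + 1 exactly one of u, v moved, and by 1. In the difference of
      -- `rec-v₂` and `rec-v₁` one of the two terms thus cancels, and the other is a single
      -- increment of u at an index already covered.
      step-v₂ : v₁ ≤ v₂ × v₂ ≤ v₁ + 1
      step-v₂ with move
      ... | v-moves hv hu =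
        (linear 8 (λ v₂ uv₁ uu₁ ε v₁ uv₀ uu₀ uv₀1 → v₂ :≡ uv₁ :+ uu₁ :- (1 :- ε) ⇒ v₁ :≡ uv₀ :+ uu₀ :- (1 :- ε)
            ⇒ uv₁ :≡ uv₀1 ⇒ uu₁ :≡ uu₀ ⇒ uv₀ :≤ uv₀1 ⇒ ⊢ v₁ :≤ v₂)
            v₂ (u v₁) (u u₁) ε v₁ (u v₀) (u u₀) (u (v₀ + 1)) rec-v₂ rec-v₁ (cong u hv) (cong u hu) (proj₁ su)) ,
        (linear 8 (λ v₂ uv₁ uu₁ ε v₁ uv₀ uu₀ uv₀1 → v₂ :≡ uv₁ :+ uu₁ :- (1 :- ε) ⇒ v₁ :≡ uv₀ :+ uu₀ :- (1 :- ε)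
            ⇒ uv₁ :≡ uv₀1 ⇒ uu₁ :≡ uu₀ ⇒ uv₀1 :≤ uv₀ :+ 1 ⇒ ⊢ v₂ :≤ v₁ :+ 1)
            v₂ (u v₁) (u u₁) ε v₁ (u v₀) (u u₀) (u (v₀ + 1)) rec-v₂ rec-v₁ (cong u hv) (cong u hu) (proj₂ su))
        where
        su = step-u v₀ (linear 3 (λ c v₀ l → c :- 1 :≤ v₀ ⇒ l :+ 3 :≤ c ⇒ ⊢ l :≤ v₀) c v₀ l c≤v₀ l≤c)
            (linear 5 (λ v₁ v₀ c x y → v₁ :≡ v₀ :+ 1 ⇒ v₁ :+ 1 :≤ 2 :* c :- 1 :- x ⇒ 2 :≤ x ⇒ 2 :≤ y ⇒
            ⊢ v₀ :+ 1 :≤ 2 :* c :- 1 :+ y) v₁ v₀ c x y hv v< 2≤x 2≤y)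
      ... | u-moves hv hu =
        (linear 8 (λ v₂ uv₁ uu₁ ε v₁ uv₀ uu₀ uu₀1 → v₂ :≡ uv₁ :+ uu₁ :- (1 :- ε) ⇒ v₁ :≡ uv₀ :+ uu₀ :- (1 :- ε)
            ⇒ uu₁ :≡ uu₀1 ⇒ uv₁ :≡ uv₀ ⇒ uu₀ :≤ uu₀1 ⇒ ⊢ v₁ :≤ v₂)
            v₂ (u v₁) (u u₁) ε v₁ (u v₀) (u u₀) (u (u₀ + 1)) rec-v₂ rec-v₁ (cong u hu) (cong u hv) (proj₁ su)) ,
        (linear 8 (λ v₂ uv₁ uu₁ ε v₁ uv₀ uu₀ uu₀1 → v₂ :≡ uv₁ :+ uu₁ :- (1 :- ε) ⇒ v₁ :≡ uv₀ :+ uu₀ :- (1 :- ε)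
            ⇒ uu₁ :≡ uu₀1 ⇒ uv₁ :≡ uv₀ ⇒ uu₀1 :≤ uu₀ :+ 1 ⇒ ⊢ v₂ :≤ v₁ :+ 1)
            v₂ (u v₁) (u u₁) ε v₁ (u v₀) (u u₀) (u (u₀ + 1)) rec-v₂ rec-v₁ (cong u hu) (cong u hv) (proj₂ su))
        where
        su = step-u u₀ (linear 3 (λ c u₀ l → c :≤ u₀ ⇒ l :+ 3 :≤ c ⇒ ⊢ l :≤ u₀) c u₀ l c≤u₀ l≤c)
            (linear 5 (λ u₁ u₀ c ε y → u₁ :≡ u₀ :+ 1 ⇒ u₁ :≤ 2 :* c :- ε ⇒ 0 :≤ ε ⇒ 2 :≤ y ⇒
            ⊢ u₀ :+ 1 :≤ 2 :* c :- 1 :+ y) u₁ u₀ c ε y hu u≤ 0≤ε 2≤y)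

      rec-u₁ : u₁ ≡ v u₁ + v (v₀ + 1) - ε
      rec-u₁ = rec-u-locked s u₁
          (linear 4 (λ c y s x → 2 :* c :- 2 :+ y :≤ s ⇒ 2 :≤ y ⇒ 2 :≤ x ⇒ x :+ y :+ 3 :≤ c ⇒ ⊢ c :≤ s :+ 1)
          c y s x s-large 2≤y 2≤x large) lock₀ lock₁

      -- If v stays, adding the recursions for u₂ and v₂ pairs the four values by the preceding
      -- complementarity at u₁ and at v₁, and the constants ε and 1 - ε add up to 1. If v moves, the
      -- recursions for u₂ and u₁ agree up to `flat`, so u stays.
      lock₂ : u₂ + v₂ ≡ s + 1 + 1 + 1
      lock₂ with ≤-or-> v₂ v₁
      ... | inj₁ v₂≤v₁ =
        (linear 10 (λ u₂ vu₁1 vv₁1 ε uu₁ u₁ uv₁ v₁ v₂ s → u₂ :≡ vu₁1 :+ vv₁1 :- ε ⇒ vu₁1 :+ uu₁ :≡ u₁ :+ 1 ⇒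
            vv₁1 :+ uv₁ :≡ v₁ :+ 1 ⇒ v₂ :≡ uv₁ :+ uu₁ :- (1 :- ε) ⇒ u₁ :+ v₁ :≡ s :+ 1 :+ 1 ⇒ v₂ :≡ v₁ ⇒
            ⊢ u₂ :+ v₂ :≡ s :+ 1 :+ 1 :+ 1)
            u₂ (v (u₁ + 1)) (v (v₁ + 1)) ε (u u₁) u₁ (u v₁) v₁ v₂ s rec lock-u₁ lock-v₁ rec-v₂ lock₁ v₂≡v₁)
        where
        v₂≡v₁ : v₂ ≡ v₁
        v₂≡v₁ = ≤-antisym v₂≤v₁ (proj₁ step-v₂)
        rec : u₂ ≡ v (u₁ + 1) + v (v₁ + 1) - ε
        rec = rec-u-locked (s + 1) (u₁ + 1) c≤s+2 lock₁
            (linear 4 (λ v₂ v₁ u₁ s → v₂ :≡ v₁ ⇒ u₁ :+ v₁ :≡ s :+ 1 :+ 1 ⇒ ⊢ u₁ :+ 1 :+ v₂ :≡ s :+ 1 :+ 1 :+ 1)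
            v₂ v₁ u₁ s v₂≡v₁ lock₁)
      ... | inj₂ v₁<v₂ =
        (linear 9 (λ u₂ vu₁ vv₁1 ε u₁ vv₀1 v₁ s v₂ → u₂ :≡ vu₁ :+ vv₁1 :- ε ⇒ u₁ :≡ vu₁ :+ vv₀1 :- ε ⇒ vv₁1 :≡
            vv₀1 ⇒ u₁ :+ v₁ :≡ s :+ 1 :+ 1 ⇒ v₂ :≡ v₁ :+ 1 ⇒ ⊢ u₂ :+ v₂ :≡ s :+ 1 :+ 1 :+ 1)
            u₂ (v u₁) (v (v₁ + 1)) ε u₁ (v (v₀ + 1)) v₁ s v₂ rec rec-u₁ flat lock₁ v₂≡)
        where
        v₂≡ : v₂ ≡ v₁ + 1
        v₂≡ = ≤-antisym (proj₂ step-v₂) v₁<v₂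
        rec : u₂ ≡ v u₁ + v (v₁ + 1) - ε
        rec = rec-u-locked (s + 1) u₁ c≤s+2 lock₁
            (linear 4 (λ v₂ v₁ u₁ s → v₂ :≡ v₁ :+ 1 ⇒ u₁ :+ v₁ :≡ s :+ 1 :+ 1 ⇒ ⊢ u₁ :+ v₂ :≡ s :+ 1 :+ 1 :+ 1)
            v₂ v₁ u₁ s v₂≡ lock₁)
        -- Only the case where v moved at both steps has content: the last increment of v then
        -- equals u v₁ - u v₀, so u rises from v₀ to v₁, and the preceding complementarity makes v
        -- flat between v₀ + 1 and v₁ + 1.
        flat : v (v₁ + 1) ≡ v (v₀ + 1)
        flat with move
        ... | u-moves hv hu = cong (λ z → v (z + 1)) hv
        ... | v-moves hv hu =
          (linear 10 (λ vv₁1 uv₁ v₁ vv₀1 uv₀ v₀ v₂ uu₁ ε uu₀ → vv₁1 :+ uv₁ :≡ v₁ :+ 1 ⇒ vv₀1 :+ uv₀ :≡ v₀ :+ 1 ⇒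
              v₂ :≡ uv₁ :+ uu₁ :- (1 :- ε) ⇒ v₁ :≡ uv₀ :+ uu₀ :- (1 :- ε) ⇒ uu₁ :≡ uu₀ ⇒ v₁ :≡ v₀ :+ 1 ⇒ v₂ :≡
              v₁ :+ 1 ⇒ ⊢ vv₁1 :≡ vv₀1) (v (v₁ + 1)) (u v₁) v₁ (v (v₀ + 1)) (u v₀) v₀ v₂ (u u₁) ε (u u₀) lock-v₁
              lock-v₀ rec-v₂ rec-v₁ (cong u hu) hv v₂≡)
          where
          lock-v₀ : v (v₀ + 1) + u v₀ ≡ v₀ + 1
          lock-v₀ = lock v₀ (linear 2 (λ c v₀ → c :- 1 :≤ v₀ ⇒ ⊢ c :- 2 :≤ v₀) c v₀ c≤v₀)
              (linear 5 (λ v₁ v₀ c x y → v₁ :≡ v₀ :+ 1 ⇒ v₁ :+ 1 :≤ 2 :* c :- 1 :- x ⇒ 2 :≤ x ⇒ 2 :≤ y ⇒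
              ⊢ v₀ :+ 1 :≤ 2 :* c :- 1 :+ y) v₁ v₀ c x y hv v< 2≤x 2≤y)

      step-u₂ : u₁ ≤ u₂ × u₂ ≤ u₁ + 1
      step-u₂ = linear 5 (λ u₁ v₁ s u₂ v₂ → u₁ :+ v₁ :≡ s :+ 1 :+ 1 ⇒ u₂ :+ v₂ :≡ s :+ 1 :+ 1 :+ 1 ⇒ v₂ :≤ v₁ :+
          1 ⇒ ⊢ u₁ :≤ u₂) u₁ v₁ s u₂ v₂ lock₁ lock₂ (proj₂ step-v₂)
              , (linear 5 (λ u₁ v₁ s u₂ v₂ → u₁ :+ v₁ :≡ s :+ 1 :+ 1 ⇒ u₂ :+ v₂ :≡ s :+ 1 :+ 1 :+ 1 ⇒ v₁ :≤ v₂ ⇒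
                  ⊢ u₂ :≤ u₁ :+ 1) u₁ v₁ s u₂ v₂ lock₁ lock₂ (proj₁ step-v₂))

      rec-u₂ : u₂ ≡ v u₂ + v (v₁ + 1) - ε
      rec-u₂ = rec-u-locked (s + 1) u₂ c≤s+2 lock₁ lock₂

      -- An overshoot by 1 would put u₂ inside the old block, where v u₂ = c; the fixed-point
      -- equation `rec-u₂` then gives u₂ ≤ c + c - ε after all.
      u₂≤ : u₂ ≤ 2 * c - ε
      u₂≤ with ≤-or-> u₂ (2 * c - ε)
      ... | inj₁ h = h
      ... | inj₂ h = linear 5 (λ u₂ vu₂ vv₁1 ε c → u₂ :≡ vu₂ :+ vv₁1 :- ε ⇒ vu₂ :≡ c ⇒ vv₁1 :≤ c ⇒
          ⊢ u₂ :≤ 2 :* c :- ε) u₂ (v u₂) (v (v₁ + 1)) ε c rec-u₂ vu₂ (v≤c (v₁ + 1) m≤ v<)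
        where
        m≤ : m ≤ v₁ + 1
        m≤ = linear 3 (λ m c v₁ → m :+ 3 :≤ c ⇒ c :≤ v₁ ⇒ ⊢ m :≤ v₁ :+ 1) m c v₁ m≤c c≤v
        vu₂ : v u₂ ≡ c
        vu₂ = block-v u₂ (linear 4 (λ c ε u₂ x → 2 :* c :- ε :+ 1 :≤ u₂ ⇒ ε :≤ 1 ⇒ 2 :≤ x ⇒
            ⊢ 2 :* c :- 1 :- x :≤ u₂) c ε u₂ x h ε≤1 2≤x)
          (linear 5 (λ u₂ u₁ c ε y → u₂ :≤ u₁ :+ 1 ⇒ u₁ :≤ 2 :* c :- ε ⇒ 0 :≤ ε ⇒ 2 :≤ y ⇒
              ⊢ u₂ :≤ 2 :* c :- 1 :+ y) u₂ u₁ c ε y (proj₂ step-u₂) u≤ 0≤ε 2≤y)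

      -- v cannot reach the block before u has arrived at its final value, because u is
      -- strictly increasing around 2c − 1 − ε.
      v₂-below : s + 1 + 1 + 1 + 1 ≤ 2 * c - ε + (2 * c - 1 - x) → v₂ + 1 ≤ 2 * c - 1 - x
      v₂-below early with ≤-or-> (v₂ + 1) (2 * c - 1 - x)
      ... | inj₁ h = h
      ... | inj₂ h = ⊥-elim
        (linear 8 (λ u₂ vu₂ vv₁1 ε c vu₂11 uu₂1 u2c2ε → u₂ :≡ vu₂ :+ vv₁1 :- ε ⇒ vv₁1 :≡ c ⇒ vu₂11 :+ uu₂1 :≡ u₂
            :- 1 :+ 1 ⇒ vu₂11 :≡ vu₂ ⇒ uu₂1 :≤ u2c2ε ⇒ u2c2ε :≡ 2 :* c :- 2 :- ε :+ 1 :- c ⇒ ⊢ falsum)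
            u₂ (v u₂) (v (v₁ + 1)) ε c (v (u₂ - 1 + 1)) (u (u₂ - 1)) (u (2 * c - 2 - ε)) rec-u₂ vv₁ locked (cong
            v undo) small val)
        where
        undo : u₂ - 1 + 1 ≡ u₂
        undo = linear 1 (λ u₂ → ⊢ u₂ :- 1 :+ 1 :≡ u₂) u₂
        v₂≡ : v₂ ≡ 2 * c - 1 - x
        v₂≡ = linear 4 (λ c x v₂ v₁ → 2 :* c :- 1 :- x :+ 1 :≤ v₂ :+ 1 ⇒ v₂ :≤ v₁ :+ 1 ⇒ v₁ :+ 1 :≤ 2 :* c :- 1
            :- x ⇒ ⊢ v₂ :≡ 2 :* c :- 1 :- x) c x v₂ v₁ h (proj₂ step-v₂) v<
        vv₁ : v (v₁ + 1) ≡ c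
        vv₁ = trans (cong v (linear 4 (λ v₂ c x v₁ → v₂ :≡ 2 :* c :- 1 :- x ⇒ v₂ :≤ v₁ :+ 1 ⇒ v₁ :+ 1 :≤ 2 :* c
            :- 1 :- x ⇒ ⊢ v₁ :+ 1 :≡ 2 :* c :- 1 :- x) v₂ c x v₁ v₂≡ (proj₂ step-v₂) v<))
          (block-v (2 * c - 1 - x) ≤-refl (linear 3 (λ x y c → 2 :≤ x ⇒ 2 :≤ y ⇒
              ⊢ 2 :* c :- 1 :- x :≤ 2 :* c :- 1 :+ y) x y c 2≤x 2≤y))
        u₂-1≤ : u₂ - 1 ≤ 2 * c - 2 - ε
        u₂-1≤ = linear 6 (λ u₂ v₂ s c x ε → u₂ :+ v₂ :≡ s :+ 1 :+ 1 :+ 1 ⇒ v₂ :≡ 2 :* c :- 1 :- x ⇒ s :+ 1 :+ 1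
            :+ 1 :+ 1 :≤ 2 :* c :- ε :+ (2 :* c :- 1 :- x) ⇒ ⊢ u₂ :- 1 :≤ 2 :* c :- 2 :- ε)
            u₂ v₂ s c x ε lock₂ v₂≡ early
        c≤u₂-1 : c ≤ u₂ - 1
        c≤u₂-1 = linear 4 (λ u₁ u₂ c y → u₁ :≤ u₂ ⇒ c :+ y :≤ u₁ ⇒ 2 :≤ y ⇒ ⊢ c :≤ u₂ :- 1)
            u₁ u₂ c y (proj₁ step-u₂) c+y≤u 2≤y
        ≤T : 2 * c - 2 - ε ≤ 2 * c - 1 + y
        ≤T = linear 3 (λ ε y c → 0 :≤ ε ⇒ 2 :≤ y ⇒ ⊢ 2 :* c :- 2 :- ε :≤ 2 :* c :- 1 :+ y) ε y c 0≤ε 2≤y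
        small : u (u₂ - 1) ≤ u (2 * c - 2 - ε)
        small = monotone u l (2 * c - 1 + y) (λ t l≤t t≤ → proj₁ (step-u t l≤t t≤)) (u₂ - 1) (2 * c - 2 - ε)
          (linear 3 (λ l c u₂ → l :+ 3 :≤ c ⇒ c :≤ u₂ :- 1 ⇒ ⊢ l :≤ u₂ :- 1) l c u₂ l≤c c≤u₂-1) u₂-1≤ ≤T
        val : u (2 * c - 2 - ε) ≡ 2 * c - 2 - ε + 1 - c
        val = block-u (2 * c - 2 - ε) (linear 3 (λ ε x c → ε :≤ 1 ⇒ 2 :≤ x ⇒
            ⊢ 2 :* c :- 1 :- x :≤ 2 :* c :- 2 :- ε) ε x c ε≤1 2≤x) ≤T
        locked : v (u₂ - 1 + 1) + u (u₂ - 1) ≡ u₂ - 1 + 1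
        locked = lock (u₂ - 1) (linear 2 (λ c u₂ → c :≤ u₂ :- 1 ⇒ ⊢ c :- 2 :≤ u₂ :- 1) c u₂ c≤u₂-1)
          (linear 4 (λ u₂ c ε y → u₂ :- 1 :≤ 2 :* c :- 2 :- ε ⇒ 0 :≤ ε ⇒ 2 :≤ y ⇒
              ⊢ u₂ :- 1 :+ 1 :≤ 2 :* c :- 1 :+ y) u₂ c ε y u₂-1≤ 0≤ε 2≤y)

      moving : Moving (s + 1)
      moving = record
        { lock₀ = lock₁ ; lock₁ = lock₂ ; u₀≤u₁ = proj₁ step-u₂ ; v₀≤v₁ = proj₁ step-v₂
        ; c+y≤u = ≤-trans c+y≤u (proj₁ step-u₂) ; c≤v = ≤-trans c≤v (proj₁ step-v₂) ; u≤ = u₂≤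
        ; v≤ = ≤-trans (proj₂ step-v₂) v< }

    -- The start is the pair of last indices of the old block, where both values are explicit. The
    -- end is the last s to which `v₂-below` can carry the bound on v.
    reach : ∀ s → 2 * c - 2 + y ≤ s → s ≤ 4 * c - ε - x - 4 → Moving s × v (s + 1) + 1 ≤ 2 * c - 1 - x
    reach = interval-induction (λ s → Moving s × v (s + 1) + 1 ≤ 2 * c - 1 - x) s₀ (4 * c - ε - x - 4)
      ( record
        { lock₀ = linear 4 (λ us₀ s₀ c vs₀ → us₀ :≡ s₀ :+ 1 :- c ⇒ vs₀ :≡ c ⇒ ⊢ us₀ :+ vs₀ :≡ s₀ :+ 1)
            (u s₀) s₀ c (v s₀) u₀≡ v₀≡
        ; lock₁ = linear 4 (λ us₀1 s₀ c vs₀1 → us₀1 :≡ s₀ :+ 1 :+ 1 :- c ⇒ vs₀1 :≡ c ⇒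
            ⊢ us₀1 :+ vs₀1 :≡ s₀ :+ 1 :+ 1) (u (s₀ + 1)) s₀ c (v (s₀ + 1)) u₁≡ v₁≡
        ; u₀≤u₁ = linear 4 (λ us₀ s₀ c us₀1 → us₀ :≡ s₀ :+ 1 :- c ⇒ us₀1 :≡ s₀ :+ 1 :+ 1 :- c ⇒ ⊢ us₀ :≤ us₀1)
            (u s₀) s₀ c (u (s₀ + 1)) u₀≡ u₁≡
        ; v₀≤v₁ = ≤-reflexive (trans v₀≡ (sym v₁≡))
        ; c+y≤u = linear 4 (λ us₀1 s₀ c y → us₀1 :≡ s₀ :+ 1 :+ 1 :- c ⇒ s₀ :≡ 2 :* c :- 2 :+ y ⇒
            ⊢ c :+ y :≤ us₀1) (u (s₀ + 1)) s₀ c y u₁≡ s₀≡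
        ; c≤v = ≤-reflexive (sym v₁≡)
        ; u≤ = linear 6 (λ us₀1 s₀ c y x ε → us₀1 :≡ s₀ :+ 1 :+ 1 :- c ⇒ s₀ :≡ 2 :* c :- 2 :+ y ⇒ x :+ y :+ 3 :≤
            c ⇒ 2 :≤ x ⇒ ε :≤ 1 ⇒ ⊢ us₀1 :≤ 2 :* c :- ε) (u (s₀ + 1)) s₀ c y x ε u₁≡ s₀≡ large 2≤x ε≤1
        ; v≤ = (linear 4 (λ vs₀1 c x y → vs₀1 :≡ c ⇒ x :+ y :+ 3 :≤ c ⇒ 2 :≤ y ⇒ ⊢ vs₀1 :≤ 2 :* c :- 1 :- x)
            (v (s₀ + 1)) c x y v₁≡ large 2≤y) }
      , (linear 4 (λ vs₀1 c x y → vs₀1 :≡ c ⇒ x :+ y :+ 3 :≤ c ⇒ 2 :≤ y ⇒ ⊢ vs₀1 :+ 1 :≤ 2 :* c :- 1 :- x)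
          (v (s₀ + 1)) c x y v₁≡ large 2≤y) )
      (λ { s s₀≤s s+1≤ (M , v<) → Step.moving s s₀≤s M v< , Step.v₂-below s s₀≤s M v<
          (linear 4 (λ s c ε x → s :+ 1 :≤ 4 :* c :- ε :- x :- 4 ⇒
          ⊢ s :+ 1 :+ 1 :+ 1 :+ 1 :≤ 2 :* c :- ε :+ (2 :* c :- 1 :- x)) s c ε x s+1≤) })
      where
      s₀ = 2 * c - 2 + y
      s₀≡ : s₀ ≡ 2 * c - 2 + y
      s₀≡ = refl
      above : 2 * c - 1 - x ≤ s₀
      above = linear 4 (λ s₀ c y x → s₀ :≡ 2 :* c :- 2 :+ y ⇒ 2 :≤ x ⇒ 2 :≤ y ⇒ ⊢ 2 :* c :- 1 :- x :≤ s₀)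
          s₀ c y x s₀≡ 2≤x 2≤y
      above′ : 2 * c - 1 - x ≤ s₀ + 1
      above′ = linear 3 (λ c x s₀ → 2 :* c :- 1 :- x :≤ s₀ ⇒ ⊢ 2 :* c :- 1 :- x :≤ s₀ :+ 1) c x s₀ above
      below : s₀ + 1 ≤ 2 * c - 1 + y
      below = linear 3 (λ s₀ c y → s₀ :≡ 2 :* c :- 2 :+ y ⇒ ⊢ s₀ :+ 1 :≤ 2 :* c :- 1 :+ y) s₀ c y s₀≡
      below′ : s₀ ≤ 2 * c - 1 + y
      below′ = linear 3 (λ s₀ c y → s₀ :≡ 2 :* c :- 2 :+ y ⇒ ⊢ s₀ :≤ 2 :* c :- 1 :+ y) s₀ c y s₀≡
      u₀≡ = block-u s₀ above below′
      v₀≡ = block-v s₀ above below′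
      u₁≡ = block-u (s₀ + 1) above′ below
      v₁≡ = block-v (s₀ + 1) above′ below

    -- The next overlap block

    s₁ : ℤ
    s₁ = 4 * c - ε - x - 4

    s₁≡ : s₁ ≡ 4 * c - ε - x - 4
    s₁≡ = refl

    Settled : ℤ → Set
    Settled t = u t ≡ 2 * c - ε × v t ≡ t + 1 - (2 * c - ε)

    s₀≤s₁ : 2 * c - 2 + y ≤ s₁
    s₀≤s₁ = linear 5 (λ s₁ c ε x y → s₁ :≡ 4 :* c :- ε :- x :- 4 ⇒ x :+ y :+ 3 :≤ c ⇒ 2 :≤ x ⇒ 2 :≤ y ⇒ ε :≤ 1 ⇒
        ⊢ 2 :* c :- 2 :+ y :≤ s₁) s₁ c ε x y s₁≡ large 2≤x 2≤y ε≤1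

    at-s₁ : Moving s₁ × v (s₁ + 1) + 1 ≤ 2 * c - 1 - x
    at-s₁ = reach s₁ s₀≤s₁ ≤-refl

    -- The bounds u ≤ 2c - ε and v ≤ 2c - 2 - x add up to exactly s₁ + 2, the value of u + v at s₁ +
    -- 1; both are therefore equalities. The same happens one index later, with both sides larger by
    -- 1.
    settled₁ : Settled (s₁ + 1)
    settled₁ =
      (linear 6 (λ us₁1 vs₁1 s₁ c ε x → us₁1 :+ vs₁1 :≡ s₁ :+ 1 :+ 1 ⇒ us₁1 :≤ 2 :* c :- ε ⇒ vs₁1 :+ 1 :≤ 2 :* c
          :- 1 :- x ⇒ s₁ :≡ 4 :* c :- ε :- x :- 4 ⇒ ⊢ us₁1 :≡ 2 :* c :- ε)
          (u (s₁ + 1)) (v (s₁ + 1)) s₁ c ε x lock₁ u≤ (proj₂ at-s₁) s₁≡) ,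
      (linear 6 (λ us₁1 vs₁1 s₁ c ε x → us₁1 :+ vs₁1 :≡ s₁ :+ 1 :+ 1 ⇒ us₁1 :≤ 2 :* c :- ε ⇒ vs₁1 :+ 1 :≤ 2 :* c
          :- 1 :- x ⇒ s₁ :≡ 4 :* c :- ε :- x :- 4 ⇒ ⊢ vs₁1 :≡ s₁ :+ 1 :+ 1 :- (2 :* c :- ε))
          (u (s₁ + 1)) (v (s₁ + 1)) s₁ c ε x lock₁ u≤ (proj₂ at-s₁) s₁≡)
      where open Moving (proj₁ at-s₁)

    settled₂ : Settled (s₁ + 1 + 1)
    settled₂ =
      (linear 6 (λ us₁11 vs₁11 s₁ c ε x → us₁11 :+ vs₁11 :≡ s₁ :+ 1 :+ 1 :+ 1 ⇒ us₁11 :≤ 2 :* c :- ε ⇒ vs₁11 :≤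
          2 :* c :- 1 :- x ⇒ s₁ :≡ 4 :* c :- ε :- x :- 4 ⇒ ⊢ us₁11 :≡ 2 :* c :- ε)
          (u (s₁ + 1 + 1)) (v (s₁ + 1 + 1)) s₁ c ε x lock₁ u≤ v≤ s₁≡) ,
      (linear 6 (λ us₁11 vs₁11 s₁ c ε x → us₁11 :+ vs₁11 :≡ s₁ :+ 1 :+ 1 :+ 1 ⇒ us₁11 :≤ 2 :* c :- ε ⇒ vs₁11 :≤
          2 :* c :- 1 :- x ⇒ s₁ :≡ 4 :* c :- ε :- x :- 4 ⇒ ⊢ vs₁11 :≡ s₁ :+ 1 :+ 1 :+ 1 :- (2 :* c :- ε))
          (u (s₁ + 1 + 1)) (v (s₁ + 1 + 1)) s₁ c ε x lock₁ u≤ v≤ s₁≡)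
      where open Moving (Step.moving s₁ s₀≤s₁ (proj₁ at-s₁) (proj₂ at-s₁))

    c≤s₁ : c ≤ s₁
    c≤s₁ = linear 4 (λ c y s₁ x → 2 :* c :- 2 :+ y :≤ s₁ ⇒ 2 :≤ x ⇒ 2 :≤ y ⇒ x :+ y :+ 3 :≤ c ⇒ ⊢ c :≤ s₁)
        c y s₁ x s₀≤s₁ 2≤x 2≤y large

    module _ (t : ℤ) (s₁≤t : s₁ + 1 + 1 ≤ t) (t≤ : t ≤ 4 * c - ε - 2 + y) (S : Settled t) where
      private
        ut = proj₁ S
        vt = proj₂ S
        c≤t+1 : c ≤ t + 1
        c≤t+1 = linear 3 (λ s₁ t c → s₁ :+ 1 :+ 1 :≤ t ⇒ c :≤ s₁ ⇒ ⊢ c :≤ t :+ 1) s₁ t c s₁≤t c≤s₁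
        locked : u t + v t ≡ t + 1
        locked = linear 5 (λ ut c ε vt t → ut :≡ 2 :* c :- ε ⇒ vt :≡ t :+ 1 :- (2 :* c :- ε) ⇒
            ⊢ ut :+ vt :≡ t :+ 1) (u t) c ε (v t) t ut vt
        lo : 2 * c - 1 - x ≤ v t
        lo = linear 6 (λ vt t c ε s₁ x → vt :≡ t :+ 1 :- (2 :* c :- ε) ⇒ s₁ :+ 1 :+ 1 :≤ t ⇒ s₁ :≡ 4 :* c :- ε
            :- x :- 4 ⇒ ⊢ 2 :* c :- 1 :- x :≤ vt) (v t) t c ε s₁ x vt s₁≤t s₁≡
        hi : v t ≤ 2 * c - 1 + y
        hi = linear 5 (λ vt t c ε y → vt :≡ t :+ 1 :- (2 :* c :- ε) ⇒ t :≤ 4 :* c :- ε :- 2 :+ y ⇒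
            ⊢ vt :≤ 2 :* c :- 1 :+ y) (v t) t c ε y vt t≤
        c′-lo : 2 * c - 1 - x ≤ 2 * c - ε
        c′-lo = linear 3 (λ x ε c → 2 :≤ x ⇒ ε :≤ 1 ⇒ ⊢ 2 :* c :- 1 :- x :≤ 2 :* c :- ε) x ε c 2≤x ε≤1
        c′-hi : 2 * c - ε ≤ 2 * c - 1 + y
        c′-hi = linear 3 (λ ε y c → 0 :≤ ε ⇒ 2 :≤ y ⇒ ⊢ 2 :* c :- ε :≤ 2 :* c :- 1 :+ y) ε y c 0≤ε 2≤y

      -- Now u t = 2c - ε and v t both lie in the old block, so the recursion is evaluated there
      -- explicitly and reproduces the pattern one index further on.
      settle-v : v (t + 1) ≡ t + 1 + 1 - (2 * c - ε)
      settle-v = linear 8 (λ vt1 uvt uut ε vt c u2cε t → vt1 :≡ uvt :+ uut :- (1 :- ε) ⇒ uvt :≡ vt :+ 1 :- c ⇒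
          uut :≡ u2cε ⇒ u2cε :≡ 2 :* c :- ε :+ 1 :- c ⇒ vt :≡ t :+ 1 :- (2 :* c :- ε) ⇒
          ⊢ vt1 :≡ t :+ 1 :+ 1 :- (2 :* c :- ε))
          (v (t + 1)) (u (v t)) (u (u t)) ε (v t) c (u (2 * c - ε)) t (rec-v-locked t c≤t+1 locked) (block-u (v
          t) lo hi) (cong u ut) (block-u (2 * c - ε) c′-lo c′-hi) vt

      settle-u : t + 1 ≤ 4 * c - ε - 2 + y → u (t + 1) ≡ 2 * c - ε
      settle-u t+1≤ = linear 5 (λ ut1 v2cε vvt1 ε c → ut1 :≡ v2cε :+ vvt1 :- ε ⇒ v2cε :≡ c ⇒ vvt1 :≡ c ⇒
          ⊢ ut1 :≡ 2 :* c :- ε) (u (t + 1)) (v (2 * c - ε)) (v (v t + 1)) ε c (rec-u-locked t (2 * c - ε) c≤t+1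
          locked (linear 4 (λ vt1 t c ε → vt1 :≡ t :+ 1 :+ 1 :- (2 :* c :- ε) ⇒
          ⊢ 2 :* c :- ε :+ vt1 :≡ t :+ 1 :+ 1)
          (v (t + 1)) t c ε settle-v)) (block-v (2 * c - ε) c′-lo c′-hi) (block-v (v t + 1) (≤-trans lo (i≤i+j
          (v t) 1)) hi′)
        where
        hi′ : v t + 1 ≤ 2 * c - 1 + y
        hi′ = linear 5 (λ vt t c ε y → vt :≡ t :+ 1 :- (2 :* c :- ε) ⇒ t :+ 1 :≤ 4 :* c :- ε :- 2 :+ y ⇒
            ⊢ vt :+ 1 :≤ 2 :* c :- 1 :+ y) (v t) t c ε y vt t+1≤

    settled : ∀ t → s₁ + 1 ≤ t → t ≤ 4 * c - ε - 2 + y → Settled t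
    settled t s₁<t t≤ with ≤-or-> t (s₁ + 1)
    ... | inj₁ t≤s₁+1 = subst Settled (≤-antisym s₁<t t≤s₁+1) settled₁
    ... | inj₂ s₁+2≤t = interval-induction Settled (s₁ + 1 + 1) (4 * c - ε - 2 + y) settled₂
      (λ t lo hi S → let t≤ = ≤-trans (i≤i+j t 1) hi in settle-u t lo t≤ S hi , settle-v t lo t≤ S) t s₁+2≤t t≤

    -- The recursion for u (t + 1) also reads v at v t + 1, whereas v (t + 1) needs v t only to lie
    -- in the old block. Hence v is known one index beyond u, which matches the shift u (t - 1) of
    -- the next coordinates.
    settled-v : ∀ t → s₁ + 1 ≤ t → t ≤ 4 * c - ε - 1 + y → v t ≡ t + 1 - (2 * c - ε)
    settled-v t s₁<t t≤ with ≤-or-> t (4 * c - ε - 2 + y)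
    ... | inj₁ t≤′ = proj₂ (settled t s₁<t t≤′)
    ... | inj₂ t> = subst (λ t → v t ≡ t + 1 - (2 * c - ε)) t≡ (settle-v t₁ t₁≥ ≤-refl (settled t₁ t₁≥′ ≤-refl))
      where
      t₁ = 4 * c - ε - 2 + y
      t₁≡ : t₁ ≡ 4 * c - ε - 2 + y
      t₁≡ = refl
      t≡ : t₁ + 1 ≡ t
      t≡ = linear 5 (λ c ε y t t₁ → 4 :* c :- ε :- 2 :+ y :+ 1 :≤ t ⇒ t :≤ 4 :* c :- ε :- 1 :+ y ⇒ t₁ :≡ 4 :* c
          :- ε :- 2 :+ y ⇒ ⊢ t₁ :+ 1 :≡ t) c ε y t t₁ t> t≤ t₁≡
      t₁≥ : s₁ + 1 + 1 ≤ t₁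
      t₁≥ = linear 6 (λ t₁ c ε y s₁ x → t₁ :≡ 4 :* c :- ε :- 2 :+ y ⇒ s₁ :≡ 4 :* c :- ε :- x :- 4 ⇒ 2 :≤ x ⇒ 2
          :≤ y ⇒ ⊢ s₁ :+ 1 :+ 1 :≤ t₁) t₁ c ε y s₁ x t₁≡ s₁≡ 2≤x 2≤y
      t₁≥′ : s₁ + 1 ≤ t₁
      t₁≥′ = ≤-trans (i≤i+j (s₁ + 1) 1) t₁≥

    locked : ∀ t → 2 * c - 1 - x ≤ t → t ≤ 4 * c - ε - 2 + y → u t + v t ≡ t + 1
    locked t lo hi with ≤-or-> t (2 * c - 1 + y) | ≤-or-> t s₁
    ... | inj₁ t≤T | _ = linear 4 (λ ut t c vt → ut :≡ t :+ 1 :- c ⇒ vt :≡ c ⇒ ⊢ ut :+ vt :≡ t :+ 1)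
        (u t) t c (v t) (block-u t lo t≤T) (block-v t lo t≤T)
    ... | inj₂ T<t | inj₁ t≤s₁ = Moving.lock₀ (proj₁ (reach t (linear 3 (λ c y t → 2 :* c :- 1 :+ y :+ 1 :≤ t ⇒
        ⊢ 2 :* c :- 2 :+ y :≤ t) c y t T<t) t≤s₁))
    ... | inj₂ T<t | inj₂ s₁<t = linear 5 (λ ut c ε vt t → ut :≡ 2 :* c :- ε ⇒ vt :≡ t :+ 1 :- (2 :* c :- ε) ⇒
        ⊢ ut :+ vt :≡ t :+ 1) (u t) c ε (v t) t (proj₁ (settled t s₁<t hi)) (proj₂ (settled t s₁<t hi))

    grow-u : ∀ t → l ≤ t → t + 1 ≤ 4 * c - ε - 2 + y → u t ≤ u (t + 1) × u (t + 1) ≤ u t + 1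
    grow-u t lo hi with ≤-or-> (t + 1) (2 * c - 1 + y) | ≤-or-> t s₁
    ... | inj₁ t≤T | _ = step-u t lo t≤T
    ... | inj₂ T<t | inj₁ t≤s₁ = u₀≤u₁ ,
        (linear 5 (λ ut vt t ut1 vt1 → ut :+ vt :≡ t :+ 1 ⇒ ut1 :+ vt1 :≡ t :+ 1 :+ 1 ⇒ vt :≤ vt1 ⇒
        ⊢ ut1 :≤ ut :+ 1) (u t) (v t) t (u (t + 1)) (v (t + 1)) lock₀ lock₁ v₀≤v₁)
      where open Moving (proj₁ (reach t (linear 3 (λ c y t → 2 :* c :- 1 :+ y :+ 1 :≤ t :+ 1 ⇒
              ⊢ 2 :* c :- 2 :+ y :≤ t) c y t T<t) t≤s₁))
    ... | inj₂ T<t | inj₂ s₁<t = ≤-reflexive u≡ , ≤-trans (≤-reflexive (sym u≡)) (i≤i+j (u t) 1)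
      where
      u≡ : u t ≡ u (t + 1)
      u≡ = trans (proj₁ (settled t s₁<t (≤-trans (i≤i+j t 1) hi))) (sym (proj₁ (settled (t + 1) (≤-trans s₁<t
          (i≤i+j t 1)) hi)))

    grow-v : ∀ t → m ≤ t → t + 1 ≤ 4 * c - ε - 1 + y → v t ≤ v (t + 1) × v (t + 1) ≤ v t + 1
    grow-v t lo hi with ≤-or-> (t + 1) (2 * c - 1 + y) | ≤-or-> t s₁
    ... | inj₁ t≤T | _ = step-v t lo t≤T
    ... | inj₂ T<t | inj₁ t≤s₁ = v₀≤v₁ ,
        (linear 5 (λ ut vt t ut1 vt1 → ut :+ vt :≡ t :+ 1 ⇒ ut1 :+ vt1 :≡ t :+ 1 :+ 1 ⇒ ut :≤ ut1 ⇒
        ⊢ vt1 :≤ vt :+ 1) (u t) (v t) t (u (t + 1)) (v (t + 1)) lock₀ lock₁ u₀≤u₁)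
      where open Moving (proj₁ (reach t (linear 3 (λ c y t → 2 :* c :- 1 :+ y :+ 1 :≤ t :+ 1 ⇒
              ⊢ 2 :* c :- 2 :+ y :≤ t) c y t T<t) t≤s₁))
    ... | inj₂ T<t | inj₂ s₁<t =
        linear 5 (λ vt t c ε vt1 → vt :≡ t :+ 1 :- (2 :* c :- ε) ⇒ vt1 :≡ t :+ 1 :+ 1 :- (2 :* c :- ε) ⇒
        ⊢ vt :≤ vt1) (v t) t c ε (v (t + 1)) v₀ v₁
                               , (linear 5 (λ vt t c ε vt1 → vt :≡ t :+ 1 :- (2 :* c :- ε) ⇒ vt1 :≡ t :+ 1 :+ 1
                                   :- (2 :* c :- ε) ⇒ ⊢ vt1 :≤ vt :+ 1) (v t) t c ε (v (t + 1)) v₀ v₁)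
      where
      v₀ = settled-v t s₁<t (≤-trans (i≤i+j t 1) hi)
      v₁ = settled-v (t + 1) (≤-trans s₁<t (i≤i+j t 1)) hi

    -- With c′ = 2c - ε the new margins are solved from 2c′ - 1 - x′ = s₁ + 2 and 2c′ - 1 + y′ = 4c
    -- - ε - 1 + y, the ends of the settled range read in the new coordinates.
    next : Generation v (λ t → u (t - 1)) (1 - ε) (2 * c - ε) (x + 1 - ε) (y + ε) m (l + 1) (d + 1)
    next = record
      { 0≤ε = linear 1 (λ ε → ε :≤ 1 ⇒ ⊢ 0 :≤ 1 :- ε) ε ε≤1
      ; ε≤1 = linear 1 (λ ε → 0 :≤ ε ⇒ ⊢ 1 :- ε :≤ 1) ε 0≤ε
      ; 2≤x = linear 2 (λ x ε → 2 :≤ x ⇒ ε :≤ 1 ⇒ ⊢ 2 :≤ x :+ 1 :- ε) x ε 2≤x ε≤1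
      ; 2≤y = linear 2 (λ y ε → 2 :≤ y ⇒ 0 :≤ ε ⇒ ⊢ 2 :≤ y :+ ε) y ε 2≤y 0≤ε
      ; 0≤d = linear 1 (λ d → 0 :≤ d ⇒ ⊢ 0 :≤ d :+ 1) d 0≤d
      ; large = linear 4 (λ x y c ε → x :+ y :+ 3 :≤ c ⇒ 2 :≤ x ⇒ 2 :≤ y ⇒ ε :≤ 1 ⇒
          ⊢ x :+ 1 :- ε :+ (y :+ ε) :+ 3 :≤ 2 :* c :- ε) x y c ε large 2≤x 2≤y ε≤1
      ; l≤c = linear 5 (λ m c x y ε → m :+ 3 :≤ c ⇒ x :+ y :+ 3 :≤ c ⇒ 2 :≤ x ⇒ 2 :≤ y ⇒ ε :≤ 1 ⇒
          ⊢ m :+ 3 :≤ 2 :* c :- ε) m c x y ε m≤c large 2≤x 2≤y ε≤1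
      ; m≤c = linear 5 (λ l c x y ε → l :+ 3 :≤ c ⇒ x :+ y :+ 3 :≤ c ⇒ 2 :≤ x ⇒ 2 :≤ y ⇒ ε :≤ 1 ⇒
          ⊢ l :+ 1 :+ 3 :≤ 2 :* c :- ε) l c x y ε l≤c large 2≤x 2≤y ε≤1
      ; rec-u = λ t c′≤t → trans (rec-v t (c≤ t c′≤t)) (cong₂ (λ i j → u i + u j - (1 - ε))
          (linear 2 (λ t ut1 → ⊢ t :- ut1 :≡ t :+ 1 :- ut1 :- 1) t (u (t - 1))) (linear 2 (λ t vt1 →
              ⊢ t :- vt1 :≡ t :+ 1 :- vt1 :- 1) t (v (t - 1))))
      ; rec-v = λ t c′≤t → trans (rec-u (t - 1) (c≤-1 t c′≤t)) (trans (cong₂ (λ i j → v i + v j - ε)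
          (linear 2 (λ t vt1 → ⊢ t :- 1 :+ 1 :- vt1 :≡ t :- vt1) t (v (t - 1))) (linear 2 (λ t ut11 →
              ⊢ t :- 1 :+ 1 :- ut11 :≡ t :- ut11) t (u (t - 1 - 1))))
          (linear 3 (λ vtvt1 vtut11 ε → ⊢ vtvt1 :+ vtut11 :- ε :≡ vtvt1 :+ vtut11 :- (1 :- (1 :- ε)))
              (v (t - v (t - 1))) (v (t - u (t - 1 - 1))) ε))
      ; block-u = λ t lo hi → settled-v t (from-block t lo)
          (linear 4 (λ t c ε y → t :≤ 2 :* (2 :* c :- ε) :- 1 :+ (y :+ ε) ⇒ ⊢ t :≤ 4 :* c :- ε :- 1 :+ y)
          t c ε y hi)
      ; block-v = λ t lo hi → proj₁ (settled (t - 1) (from-block-1 t lo)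
          (linear 4 (λ t c ε y → t :≤ 2 :* (2 :* c :- ε) :- 1 :+ (y :+ ε) ⇒ ⊢ t :- 1 :≤ 4 :* c :- ε :- 2 :+ y)
          t c ε y hi))
      ; lock = λ t lo hi → trans (cong (λ z → u z + v t) (linear 1 (λ t → ⊢ t :+ 1 :- 1 :≡ t) t))
          (locked t (linear 4 (λ c ε t x → 2 :* c :- ε :- 2 :≤ t ⇒ 2 :≤ x ⇒ ε :≤ 1 ⇒ ⊢ 2 :* c :- 1 :- x :≤ t)
              c ε t x lo 2≤x ε≤1)
                    (linear 4 (λ t c ε y → t :+ 1 :≤ 2 :* (2 :* c :- ε) :- 1 :+ (y :+ ε) ⇒
                        ⊢ t :≤ 4 :* c :- ε :- 2 :+ y) t c ε y hi))
      ; step-u = λ t lo hi → grow-v t lo (linear 4 (λ t c ε y → t :+ 1 :≤ 2 :* (2 :* c :- ε) :- 1 :+ (y :+ ε) ⇒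
          ⊢ t :+ 1 :≤ 4 :* c :- ε :- 1 :+ y) t c ε y hi)
      ; step-v = λ t lo hi → subst (λ z → u (t - 1) ≤ u z × u z ≤ u (t - 1) + 1) (linear 1 (λ t →
          ⊢ t :- 1 :+ 1 :≡ t :+ 1 :- 1) t)
          (grow-u (t - 1) (linear 2 (λ l t → l :+ 1 :≤ t ⇒ ⊢ l :≤ t :- 1) l t lo)
              (linear 4 (λ t c ε y → t :+ 1 :≤ 2 :* (2 :* c :- ε) :- 1 :+ (y :+ ε) ⇒
              ⊢ t :- 1 :+ 1 :≤ 4 :* c :- ε :- 2 :+ y) t c ε y hi))
      ; spread = next-spread }
      where
      c≤ : ∀ t → 2 * c - ε ≤ t → c ≤ t
      c≤ t h = linear 5 (λ c ε t x y → 2 :* c :- ε :≤ t ⇒ ε :≤ 1 ⇒ x :+ y :+ 3 :≤ c ⇒ 2 :≤ x ⇒ 2 :≤ y ⇒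
          ⊢ c :≤ t) c ε t x y h ε≤1 large 2≤x 2≤y
      c≤-1 : ∀ t → 2 * c - ε ≤ t → c ≤ t - 1
      c≤-1 t h = linear 5 (λ c ε t x y → 2 :* c :- ε :≤ t ⇒ ε :≤ 1 ⇒ x :+ y :+ 3 :≤ c ⇒ 2 :≤ x ⇒ 2 :≤ y ⇒
          ⊢ c :≤ t :- 1) c ε t x y h ε≤1 large 2≤x 2≤y
      from-block : ∀ t → 2 * (2 * c - ε) - 1 - (x + 1 - ε) ≤ t → s₁ + 1 ≤ t
      from-block t h = linear 5 (λ c ε x t s₁ → 2 :* (2 :* c :- ε) :- 1 :- (x :+ 1 :- ε) :≤ t ⇒ s₁ :≡ 4 :* c :-
          ε :- x :- 4 ⇒ ⊢ s₁ :+ 1 :≤ t) c ε x t s₁ h s₁≡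
      from-block-1 : ∀ t → 2 * (2 * c - ε) - 1 - (x + 1 - ε) ≤ t → s₁ + 1 ≤ t - 1
      from-block-1 t h = linear 5 (λ c ε x t s₁ → 2 :* (2 :* c :- ε) :- 1 :- (x :+ 1 :- ε) :≤ t ⇒ s₁ :≡ 4 :* c
          :- ε :- x :- 4 ⇒ ⊢ s₁ :+ 1 :≤ t :- 1) c ε x t s₁ h s₁≡
      -- In the old range, replacing u t by u (t - 1) costs at most 1, whence d + 1. Beyond it,
      -- complementarity at t - 1 and one slow step of v give the bound afresh.
      next-spread : ∀ t → m ≤ t → l + 1 ≤ t → t ≤ 2 * (2 * c - ε) - 1 + (y + ε) →
        t ≤ v t + u (t - 1) + (d + 1) × v t + u (t - 1) ≤ t + 2
      next-spread t m≤t l<t t≤ with ≤-or-> t (2 * c - 1 + y)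
      ... | inj₁ t≤T =
        (linear 6 (λ t ut vt d ut11 ut1 → t :≤ ut :+ vt :+ d ⇒ ut11 :≤ ut1 :+ 1 ⇒ ut11 :≡ ut ⇒
            ⊢ t :≤ vt :+ ut1 :+ (d :+ 1))
            t (u t) (v t) d (u (t - 1 + 1)) (u (t - 1)) (proj₁ sp) (proj₂ su) (cong u back)) ,
        (linear 5 (λ ut vt t ut1 ut11 → ut :+ vt :≤ t :+ 2 ⇒ ut1 :≤ ut11 ⇒ ut11 :≡ ut ⇒ ⊢ vt :+ ut1 :≤ t :+ 2)
            (u t) (v t) t (u (t - 1)) (u (t - 1 + 1)) (proj₂ sp) (proj₁ su) (cong u back))
        where
        back : t - 1 + 1 ≡ t
        back = linear 1 (λ t → ⊢ t :- 1 :+ 1 :≡ t) t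
        sp = spread t (linear 2 (λ l t → l :+ 1 :≤ t ⇒ ⊢ l :≤ t) l t l<t) m≤t t≤T
        su = step-u (t - 1) (linear 2 (λ l t → l :+ 1 :≤ t ⇒ ⊢ l :≤ t :- 1) l t l<t)
            (linear 3 (λ t c y → t :≤ 2 :* c :- 1 :+ y ⇒ ⊢ t :- 1 :+ 1 :≤ 2 :* c :- 1 :+ y) t c y t≤T)
      ... | inj₂ T<t =
        (linear 6 (λ ut1 vt1 t vt11 vt d → ut1 :+ vt1 :≡ t :- 1 :+ 1 ⇒ vt1 :≤ vt11 ⇒ vt11 :≡ vt ⇒ 0 :≤ d ⇒
            ⊢ t :≤ vt :+ ut1 :+ (d :+ 1))
            (u (t - 1)) (v (t - 1)) t (v (t - 1 + 1)) (v t) d lk (proj₁ sv) (cong v back) 0≤d) ,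
        (linear 5 (λ ut1 vt1 t vt11 vt → ut1 :+ vt1 :≡ t :- 1 :+ 1 ⇒ vt11 :≤ vt1 :+ 1 ⇒ vt11 :≡ vt ⇒
            ⊢ vt :+ ut1 :≤ t :+ 2) (u (t - 1)) (v (t - 1)) t (v (t - 1 + 1)) (v t) lk (proj₂ sv) (cong v back))
        where
        back : t - 1 + 1 ≡ t
        back = linear 1 (λ t → ⊢ t :- 1 :+ 1 :≡ t) t
        lk = locked (t - 1) (linear 4 (λ c y t x → 2 :* c :- 1 :+ y :+ 1 :≤ t ⇒ 2 :≤ x ⇒ 2 :≤ y ⇒
            ⊢ 2 :* c :- 1 :- x :≤ t :- 1) c y t x T<t 2≤x 2≤y)
          (linear 4 (λ t c ε y → t :≤ 2 :* (2 :* c :- ε) :- 1 :+ (y :+ ε) ⇒ ⊢ t :- 1 :≤ 4 :* c :- ε :- 2 :+ y)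
              t c ε y t≤)
        sv = grow-v (t - 1) (linear 5 (λ c y t m x → 2 :* c :- 1 :+ y :+ 1 :≤ t ⇒ m :+ 3 :≤ c ⇒ x :+ y :+ 3 :≤ c
            ⇒ 2 :≤ x ⇒ 2 :≤ y ⇒ ⊢ m :≤ t :- 1) c y t m x T<t m≤c large 2≤x 2≤y)
          (linear 4 (λ t c ε y → t :≤ 2 :* (2 :* c :- ε) :- 1 :+ (y :+ ε) ⇒
              ⊢ t :- 1 :+ 1 :≤ 4 :* c :- ε :- 1 :+ y) t c ε y t≤)

  -- The halved sequences

  parity : ℕ → ℤ
  parity zero = 0
  parity (suc n) = 1 - parity n

  -1^n≡ : ∀ n → (- (+ 1)) ^ n ≡ 1 - 2 * parity n
  -1^n≡ zero = refl
  -1^n≡ (suc n) = trans (cong ((- (+ 1)) *_) (-1^n≡ n)) (flip (parity n))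
    where
    flip : ∀ z → (- (+ 1)) * (1 - 2 * z) ≡ 1 - 2 * (1 - z)
    flip = solve-∀

  parity-double : ∀ n → parity (n ℕ.+ n) ≡ 0
  parity-double zero = refl
  parity-double (suc n) = trans (cong (λ k → 1 - parity k) (ℕₚ.+-suc n n))
    (trans (cong (λ z → 1 - (1 - z)) (parity-double n)) refl)

  positive-suc : ∀ i → 1 ≤ i → ∃ λ j → i ≡ + suc j
  positive-suc +[1+ j ] _ = j , refl
  positive-suc +0 (+≤+ ())

  all-from : (ℤ → Bool) → ℤ → ℕ → Bool
  all-from p lo zero = true
  all-from p lo (suc n) = p lo ∧ all-from p (lo + 1) n

  all-from-sound : ∀ p lo n → T (all-from p lo n) → ∀ z → lo ≤ z → z + 1 ≤ lo + + n → T (p z)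
  all-from-sound p lo zero t z lo≤z z< = ⊥-elim (linear 2 (λ lo z → lo :≤ z ⇒ z :+ 1 :≤ lo :+ 0 ⇒ ⊢ falsum)
      lo z lo≤z z<)
  all-from-sound p lo (suc n) t z lo≤z z< with ≤-or-> z lo
  ... | inj₁ z≤lo = subst (λ w → T (p w)) (≤-antisym lo≤z z≤lo) (proj₁ (T-∧ _ _ t))
  ... | inj₂ lo<z = all-from-sound p (lo + 1) n (proj₂ (T-∧ (p lo) _ t)) z lo<z
    (subst (z + 1 ≤_) (sym (+-assoc lo 1 (+ n))) z<)

  check-interval : ∀ {P : ℤ → Set} (P? : ∀ z → Dec (P z)) lo n {_ : T (all-from (λ z → ⌊ P? z ⌋) lo n)} →
    ∀ z → lo ≤ z → z + 1 ≤ lo + + n → P z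
  check-interval P? lo n {t} z lo≤z z< = toWitness (all-from-sound (λ z → ⌊ P? z ⌋) lo n t z lo≤z z<)

  module Halves (f : ℕ → ℤ) (isQ : IsQtilde f) where

    f1 = proj₁ isQ
    f2 = proj₁ (proj₂ isQ)
    rec = proj₂ (proj₂ isQ)

    Odd : ℕ → Set
    Odd n = Σ ℤ λ z → f (suc n) ≡ 2 * z - 1

    odd-step : ∀ n → (∀ {m} → m ℕ.< n → Odd m) → Odd n
    odd-step 0 _ = 1 , f1
    odd-step 1 _ = 1 , f2
    odd-step (suc (suc k)) ih with rec (suc (suc (suc k))) (ℕ.s≤s (ℕ.s≤s (ℕ.s≤s ℕ.z≤n)))
    ... | p≥ , p≤ , q≥ , q≤ , eq with positive-suc _ p≥ | positive-suc _ q≥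
    ... | i , p≡ | j , q≡ = (z₁ + z₂ - parity (3 ℕ.+ k)) ,
      trans eq (trans (cong₂ _+_ (cong₂ _+_ (trans (cong (λ z → f ∣ z ∣) p≡) e₁) (trans (cong (λ z → f ∣ z ∣)
          q≡) e₂)) (-1^n≡ (3 ℕ.+ k)))
        (collect z₁ z₂ (parity (3 ℕ.+ k))))
      where
      small : ∀ {i p} → p ≡ + suc i → p ≤ + suc (suc k) → i ℕ.< suc (suc k)
      small refl (+≤+ h) = h
      r₁ = ih (small p≡ p≤)
      r₂ = ih (small q≡ q≤)
      z₁ = proj₁ r₁
      e₁ = proj₂ r₁
      z₂ = proj₁ r₂
      e₂ = proj₂ r₂
      collect : ∀ z₁ z₂ ε → 2 * z₁ - 1 + (2 * z₂ - 1) + (1 - 2 * ε) ≡ 2 * (z₁ + z₂ - ε) - 1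
      collect = solve-∀

    -- Abstract, so that `h` is reached only through `f≡2h-1` and the well-founded recursion is
    -- never unfolded.
    abstract
      odd : ∀ n → Odd n
      odd = <-rec Odd odd-step

    h : ℤ → ℤ
    h z = proj₁ (odd ∣ z - 1 ∣)

    f≡2h-1 : ∀ z → 1 ≤ z → f ∣ z ∣ ≡ 2 * h z - 1
    f≡2h-1 z 1≤z with positive-suc z 1≤z
    ... | n , refl = proj₂ (odd n)

    -- Adding two numbers of the form 2h - 1 leaves a constant -2, and (-1)ⁿ = 1 - 2·parity brings
    -- it back to -1; what survives the halving is the parity alone.
    h-rec : ∀ z → 3 ≤ z →
      h z ≡ h (z + 1 - 2 * h (z - 1)) + h (z + 1 - 2 * h (z - 2)) - parity ∣ z ∣
    h-rec +[1+ 0 ] (+≤+ (ℕ.s≤s ()))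
    h-rec +[1+ 1 ] (+≤+ (ℕ.s≤s (ℕ.s≤s ())))
    h-rec z@(+[1+ suc (suc k) ]) _ with rec (suc (suc (suc k))) (ℕ.s≤s (ℕ.s≤s (ℕ.s≤s ℕ.z≤n)))
    ... | p≥ , _ , q≥ , _ , eq = *-cancelˡ-≡ 2 _ _ doubled
      where
      p = z + 1 - 2 * h (z - 1)
      q = z + 1 - 2 * h (z - 2)
      p≡ : z - f (suc (suc k)) ≡ p
      p≡ = linear 3 (λ fsucsuck hz1 z → fsucsuck :≡ 2 :* hz1 :- 1 ⇒ ⊢ z :- fsucsuck :≡ z :+ 1 :- 2 :* hz1)
          (f (suc (suc k))) (h (z - 1)) z (f≡2h-1 (z - 1) (+≤+ (ℕ.s≤s ℕ.z≤n)))
      q≡ : z - f (suc k) ≡ q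
      q≡ = linear 3 (λ fsuck hz2 z → fsuck :≡ 2 :* hz2 :- 1 ⇒ ⊢ z :- fsuck :≡ z :+ 1 :- 2 :* hz2)
          (f (suc k)) (h (z - 2)) z (f≡2h-1 (z - 2) (+≤+ (ℕ.s≤s ℕ.z≤n)))
      1≤p : 1 ≤ p
      1≤p = subst (1 ≤_) p≡ p≥
      1≤q : 1 ≤ q
      1≤q = subst (1 ≤_) q≡ q≥
      doubled : 2 * h z ≡ 2 * (h p + h q - parity (suc (suc (suc k))))
      doubled = linear 7 (λ fsucsucsuck hz fp fq paritysucsucsuck hp hq → fsucsucsuck :≡ 2 :* hz :- 1 ⇒
          fsucsucsuck :≡ fp :+ fq :+ (1 :- 2 :* paritysucsucsuck) ⇒ fp :≡ 2 :* hp :- 1 ⇒ fq :≡ 2 :* hq :- 1 ⇒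
          ⊢ 2 :* hz :≡ 2 :* (hp :+ hq :- paritysucsucsuck))
          (f (suc (suc (suc k)))) (h z) (f ∣ p ∣) (f ∣ q ∣) (parity (suc (suc (suc k)))) (h p) (h q) (f≡2h-1 z
          (+≤+ (ℕ.s≤s ℕ.z≤n))) eq′ (f≡2h-1 p 1≤p) (f≡2h-1 q 1≤q)
        where
        eq′ = trans eq (cong₂ _+_ (cong₂ _+_ (cong (λ i → f ∣ i ∣) p≡) (cong (λ i → f ∣ i ∣) q≡)) (-1^n≡ (suc
            (suc (suc k)))))

    a b : ℤ → ℤ
    a k = h (2 * k)
    b k = h (2 * k - 1)

    parity-even : ∀ k → 1 ≤ k → parity ∣ 2 * k ∣ ≡ 0
    parity-even k 1≤k with positive-suc k 1≤k
    ... | n , refl = trans (cong parity (cong (suc n ℕ.+_) (ℕₚ.+-identityʳ (suc n)))) (parity-double (suc n))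

    parity-odd : ∀ k → 1 ≤ k → parity ∣ 2 * k - 1 ∣ ≡ 1
    parity-odd k 1≤k with positive-suc k 1≤k
    ... | n , refl = linear 1 (λ paritynsucn0 → 1 :- paritynsucn0 :≡ 0 ⇒ ⊢ paritynsucn0 :≡ 1)
        (parity (n ℕ.+ suc (n ℕ.+ 0))) (parity-even (+ suc n) 1≤k)

    -- The arguments z + 1 - 2h have the parity opposite to z. Thus an even place reads only odd
    -- ones and conversely, and the single recursion becomes a pair in which a calls b and b calls
    -- a.
    a-rec : ∀ k → 2 ≤ k → a k ≡ b (k + 1 - b k) + b (k + 1 - a (k - 1)) - 0
    a-rec k 2≤k = trans (h-rec (2 * k) (linear 1 (λ k → 2 :≤ k ⇒ ⊢ 3 :≤ 2 :* k) k 2≤k))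
      (cong₂ _-_ (cong₂ (λ i j → h i + h j) first second) (parity-even k (linear 1 (λ k → 2 :≤ k ⇒ ⊢ 1 :≤ k)
          k 2≤k)))
      where
      first : 2 * k + 1 - 2 * h (2 * k - 1) ≡ 2 * (k + 1 - b k) - 1
      first = linear 2 (λ k bk → ⊢ 2 :* k :+ 1 :- 2 :* bk :≡ 2 :* (k :+ 1 :- bk) :- 1) k (b k)
      second : 2 * k + 1 - 2 * h (2 * k - 2) ≡ 2 * (k + 1 - a (k - 1)) - 1
      second = trans (cong (λ z → 2 * k + 1 - 2 * h z) (linear 1 (λ k → ⊢ 2 :* k :- 2 :≡ 2 :* (k :- 1)) k))
          (linear 2 (λ k ak1 → ⊢ 2 :* k :+ 1 :- 2 :* ak1 :≡ 2 :* (k :+ 1 :- ak1) :- 1) k (a (k - 1)))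

    b-rec : ∀ k → 2 ≤ k → b k ≡ a (k - a (k - 1)) + a (k - b (k - 1)) - (1 - 0)
    b-rec k 2≤k = trans (h-rec (2 * k - 1) (linear 1 (λ k → 2 :≤ k ⇒ ⊢ 3 :≤ 2 :* k :- 1) k 2≤k))
      (cong₂ _-_ (cong₂ (λ i j → h i + h j) first second) (parity-odd k (linear 1 (λ k → 2 :≤ k ⇒ ⊢ 1 :≤ k)
          k 2≤k)))
      where
      first : 2 * k - 1 + 1 - 2 * h (2 * k - 1 - 1) ≡ 2 * (k - a (k - 1))
      first = trans (cong (λ z → 2 * k - 1 + 1 - 2 * h z) (linear 1 (λ k → ⊢ 2 :* k :- 1 :- 1 :≡ 2 :* (k :- 1))
          k)) (linear 2 (λ k ak1 → ⊢ 2 :* k :- 1 :+ 1 :- 2 :* ak1 :≡ 2 :* (k :- ak1)) k (a (k - 1)))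
      second : 2 * k - 1 + 1 - 2 * h (2 * k - 1 - 2) ≡ 2 * (k - b (k - 1))
      second = trans (cong (λ z → 2 * k - 1 + 1 - 2 * h z) (linear 1 (λ k →
          ⊢ 2 :* k :- 1 :- 2 :≡ 2 :* (k :- 1) :- 1) k)) (linear 2 (λ k bk1 →
          ⊢ 2 :* k :- 1 :+ 1 :- 2 :* bk1 :≡ 2 :* (k :- bk1)) k (b (k - 1)))

  -- The values (Q̃(n) + 1)/2 for n ≤ 172, with a dummy entry at n = 0.
  table : List ℕ
  table =
    0 ∷ 1 ∷ 1 ∷
    1 ∷ 2 ∷ 2 ∷ 2 ∷ 3 ∷ 3 ∷ 3 ∷ 4 ∷ 3 ∷ 5 ∷ 4 ∷ 5 ∷ 4 ∷ 6 ∷ 5 ∷ 6 ∷ 6 ∷ 6 ∷ 7 ∷ 6 ∷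
    8 ∷ 7 ∷ 8 ∷ 7 ∷ 9 ∷ 7 ∷ 10 ∷ 8 ∷ 10 ∷ 9 ∷ 10 ∷ 9 ∷ 11 ∷ 10 ∷ 11 ∷ 11 ∷ 11 ∷ 12 ∷ 11 ∷ 13 ∷
    11 ∷ 14 ∷ 12 ∷ 14 ∷ 12 ∷ 15 ∷ 12 ∷ 16 ∷ 12 ∷ 17 ∷ 13 ∷ 17 ∷ 13 ∷ 18 ∷ 14 ∷ 18 ∷ 15 ∷ 18 ∷ 15 ∷ 19 ∷
    15 ∷ 20 ∷ 16 ∷ 20 ∷ 16 ∷ 21 ∷ 17 ∷ 21 ∷ 18 ∷ 21 ∷ 19 ∷ 21 ∷ 19 ∷ 22 ∷ 20 ∷ 22 ∷ 21 ∷ 22 ∷ 22 ∷ 22 ∷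
    23 ∷ 22 ∷ 24 ∷ 22 ∷ 25 ∷ 23 ∷ 25 ∷ 23 ∷ 26 ∷ 23 ∷ 27 ∷ 23 ∷ 28 ∷ 23 ∷ 29 ∷ 24 ∷ 29 ∷ 24 ∷ 30 ∷ 24 ∷
    31 ∷ 25 ∷ 31 ∷ 26 ∷ 31 ∷ 26 ∷ 32 ∷ 27 ∷ 32 ∷ 27 ∷ 33 ∷ 27 ∷ 34 ∷ 27 ∷ 35 ∷ 28 ∷ 35 ∷ 28 ∷ 36 ∷ 28 ∷
    37 ∷ 29 ∷ 37 ∷ 30 ∷ 37 ∷ 30 ∷ 38 ∷ 31 ∷ 38 ∷ 32 ∷ 38 ∷ 33 ∷ 38 ∷ 33 ∷ 39 ∷ 34 ∷ 39 ∷ 34 ∷ 40 ∷ 34 ∷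
    41 ∷ 35 ∷ 41 ∷ 36 ∷ 41 ∷ 36 ∷ 42 ∷ 37 ∷ 42 ∷ 38 ∷ 42 ∷ 39 ∷ 42 ∷ 40 ∷ 42 ∷ 40 ∷ 43 ∷ 41 ∷ 43 ∷ 42 ∷
    43 ∷ 43 ∷ 43 ∷ 44 ∷ 43 ∷ 45 ∷ 43 ∷ 46 ∷ 43 ∷ 47 ∷ []

  -- Verification of the table and of the first generation on it

  nth : List ℕ → ℕ → ℕ
  nth [] _ = 0
  nth (x ∷ _) zero = x
  nth (_ ∷ xs) (suc n) = nth xs n

  entry : ℤ → ℤ
  entry z = + nth table ∣ z ∣

  -- Checking also that p and q lie below z lets the agreement of `h` with the table be proved by
  -- induction: it is known at p and q before z.
  Entry-rec : ℤ → Set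
  Entry-rec z = (1 ≤ p × p ≤ z - 1) × (1 ≤ q × q ≤ z - 1) × entry z ≡ entry p + entry q - parity ∣ z ∣
    where
    p = z + 1 - 2 * entry (z - 1)
    q = z + 1 - 2 * entry (z - 2)

  entry-rec : ∀ z → 3 ≤ z → z ≤ 172 → Entry-rec z
  entry-rec z lo hi = check-interval dec 3 170 z lo (linear 1 (λ z → z :≤ 172 ⇒ ⊢ z :+ 1 :≤ 3 :+ 170) z hi)
    where
    dec : ∀ z → Dec (Entry-rec z)
    dec z = ((1 ≤? p) ×-dec (p ≤? z - 1)) ×-dec ((1 ≤? q) ×-dec (q ≤? z - 1)) ×-dec (entry z ≟ entry p + entry q
        - parity ∣ z ∣)
      where
      p = z + 1 - 2 * entry (z - 1)
      q = z + 1 - 2 * entry (z - 2)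

  Base-lock Base-block Base-step Base-spread : ℤ → Set
  Base-lock t = entry (2 * (t + 1 - 3) - 1) + entry (2 * (t - 3)) ≡ t + 1
  Base-block t = entry (2 * (t - 3)) ≡ t + 1 - 43 × entry (2 * (t - 3) - 1) ≡ 43
  Base-step t = (entry (2 * (t - 3)) ≤ entry (2 * (t + 1 - 3)) × entry (2 * (t + 1 - 3)) ≤ entry (2 * (t - 3)) +
      1)
              × (entry (2 * (t - 3) - 1) ≤ entry (2 * (t + 1 - 3) - 1) × entry (2 * (t + 1 - 3) - 1) ≤ entry (2
                  * (t - 3) - 1) + 1)
  Base-spread t = t ≤ entry (2 * (t - 3)) + entry (2 * (t - 3) - 1) + 2 × entry (2 * (t - 3)) + entry (2 * (t -
      3) - 1) ≤ t + 2

  base-lock : ∀ t → 41 ≤ t → t + 1 ≤ 89 → Base-lock t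
  base-lock = check-interval (λ t → entry (2 * (t + 1 - 3) - 1) + entry (2 * (t - 3)) ≟ t + 1) 41 48

  base-block : ∀ t → 83 ≤ t → t ≤ 89 → Base-block t
  base-block t lo hi = check-interval (λ t → (entry (2 * (t - 3)) ≟ t + 1 - 43) ×-dec (entry (2 * (t - 3) - 1) ≟
      43)) 83 7 t lo
    (linear 1 (λ t → t :≤ 89 ⇒ ⊢ t :+ 1 :≤ 83 :+ 7) t hi)

  base-step : ∀ t → 4 ≤ t → t + 1 ≤ 89 → Base-step t
  base-step = check-interval (λ t → ((entry (2 * (t - 3)) ≤? entry (2 * (t + 1 - 3))) ×-dec (entry (2 * (t + 1 -
      3)) ≤? entry (2 * (t - 3)) + 1))
    ×-dec ((entry (2 * (t - 3) - 1) ≤? entry (2 * (t + 1 - 3) - 1)) ×-dec (entry (2 * (t + 1 - 3) - 1) ≤? entry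
        (2 * (t - 3) - 1) + 1))) 4 85

  base-spread : ∀ t → 4 ≤ t → t ≤ 89 → Base-spread t
  base-spread t lo hi = check-interval (λ t → (t ≤? entry (2 * (t - 3)) + entry (2 * (t - 3) - 1) + 2) ×-dec
      (entry (2 * (t - 3)) + entry (2 * (t - 3) - 1) ≤? t + 2)) 4 86 t lo
    (linear 1 (λ t → t :≤ 89 ⇒ ⊢ t :+ 1 :≤ 4 :+ 86) t hi)

  -- The chain of generations

  module Frames (f : ℕ → ℤ) (isQ : IsQtilde f) where
    open Halves f isQ

    h≡entry-upto : ∀ z → 2 ≤ z → z ≤ 172 → ∀ w → 1 ≤ w → w ≤ z → h w ≡ entry w
    h≡entry-upto = interval-induction (λ z → ∀ w → 1 ≤ w → w ≤ z → h w ≡ entry w) 2 172 base step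
      where
      h1 : h 1 ≡ 1
      h1 = *-cancelˡ-≡ 2 _ _ (linear 2 (λ f1 h1 → f1 :≡ 2 :* h1 :- 1 ⇒ f1 :≡ 1 ⇒ ⊢ 2 :* h1 :≡ 2 :* 1)
          (f 1) (h 1) (f≡2h-1 1 (+≤+ (ℕ.s≤s ℕ.z≤n))) f1)
      h2 : h 2 ≡ 1
      h2 = *-cancelˡ-≡ 2 _ _ (linear 2 (λ f2 h2 → f2 :≡ 2 :* h2 :- 1 ⇒ f2 :≡ 1 ⇒ ⊢ 2 :* h2 :≡ 2 :* 1)
          (f 2) (h 2) (f≡2h-1 2 (+≤+ (ℕ.s≤s ℕ.z≤n))) f2)
      base : ∀ z → 1 ≤ z → z ≤ 2 → h z ≡ entry z
      base +[1+ 0 ] _ _ = h1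
      base +[1+ 1 ] _ _ = h2
      base +[1+ suc (suc _) ] _ (+≤+ (ℕ.s≤s (ℕ.s≤s ())))
      base +0 (+≤+ ()) _
      step : ∀ t → 2 ≤ t → t + 1 ≤ 172 → (∀ w → 1 ≤ w → w ≤ t → h w ≡ entry w) → ∀ w → 1 ≤ w → w ≤ t + 1 → h w ≡
          entry w
      step t 2≤t t≤ ih w 1≤w w≤ with ≤-or-> w t
      ... | inj₁ w≤t = ih w 1≤w w≤t
      ... | inj₂ t<w = trans (h-rec w 3≤w)
          (trans (cong₂ (λ i j → i + j - parity ∣ w ∣) at-p at-q) (sym (proj₂ (proj₂ er))))
        where
        3≤w : 3 ≤ w
        3≤w = linear 2 (λ t w → 2 :≤ t ⇒ t :+ 1 :≤ w ⇒ ⊢ 3 :≤ w) t w 2≤t t<w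
        er = entry-rec w 3≤w (≤-trans w≤ t≤)
        w-1≤t : w - 1 ≤ t
        w-1≤t = linear 2 (λ w t → w :≤ t :+ 1 ⇒ ⊢ w :- 1 :≤ t) w t w≤
        h-1 : h (w - 1) ≡ entry (w - 1)
        h-1 = ih (w - 1) (linear 1 (λ w → 3 :≤ w ⇒ ⊢ 1 :≤ w :- 1) w 3≤w) w-1≤t
        h-2 : h (w - 2) ≡ entry (w - 2)
        h-2 = ih (w - 2) (linear 1 (λ w → 3 :≤ w ⇒ ⊢ 1 :≤ w :- 2) w 3≤w) (linear 2 (λ w t → w :≤ t :+ 1 ⇒
            ⊢ w :- 2 :≤ t) w t w≤)
        at-p : h (w + 1 - 2 * h (w - 1)) ≡ entry (w + 1 - 2 * entry (w - 1))
        at-p = trans (cong (λ z → h (w + 1 - 2 * z)) h-1) (ih _ (proj₁ (proj₁ er)) (≤-trans (proj₂ (proj₁ er))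
            w-1≤t))
        at-q : h (w + 1 - 2 * h (w - 2)) ≡ entry (w + 1 - 2 * entry (w - 2))
        at-q = trans (cong (λ z → h (w + 1 - 2 * z)) h-2) (ih _ (proj₁ (proj₁ (proj₂ er))) (≤-trans (proj₂
            (proj₁ (proj₂ er))) w-1≤t))

    h≡entry : ∀ z → 1 ≤ z → z ≤ 172 → h z ≡ entry z
    h≡entry = h≡entry-upto 172 (+≤+ (ℕ.s≤s (ℕ.s≤s ℕ.z≤n))) ≤-refl

    a≡entry : ∀ t → 4 ≤ t → t ≤ 89 → a (t - 3) ≡ entry (2 * (t - 3))
    a≡entry t lo hi = h≡entry (2 * (t - 3)) (linear 1 (λ t → 4 :≤ t ⇒ ⊢ 1 :≤ 2 :* (t :- 3)) t lo)
        (linear 1 (λ t → t :≤ 89 ⇒ ⊢ 2 :* (t :- 3) :≤ 172) t hi)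

    b≡entry : ∀ t → 4 ≤ t → t ≤ 89 → b (t - 3) ≡ entry (2 * (t - 3) - 1)
    b≡entry t lo hi = h≡entry (2 * (t - 3) - 1) (linear 1 (λ t → 4 :≤ t ⇒ ⊢ 1 :≤ 2 :* (t :- 3) :- 1) t lo)
        (linear 1 (λ t → t :≤ 89 ⇒ ⊢ 2 :* (t :- 3) :- 1 :≤ 172) t hi)

    -- At k = 82 both sequences equal 43, and 43 + 43 = t + 1 gives the offset t = k + 3. The block
    -- is 83 ≤ t ≤ 89; its end is k = 86, which is why the table runs to 2·86 = 172. The starts l =
    -- m = 4 mean k = 1.
    first-generation : Generation (λ t → a (t - 3)) (λ t → b (t - 3)) 0 43 2 4 4 4 2
    first-generation = record
      { 0≤ε = ≤-refl ; ε≤1 = +≤+ ℕ.z≤n ; 2≤x = ≤-refl ; 2≤y = (linear 0 (⊢ 2 :≤ 4)) ; 0≤d = linear 0 (⊢ 0 :≤ 2)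
      ; large = (linear 0 (⊢ 2 :+ 4 :+ 3 :≤ 43)) ; l≤c = (linear 0 (⊢ 4 :+ 3 :≤ 43)) ; m≤c = linear 0 (
          ⊢ 4 :+ 3 :≤ 43)
      ; rec-u = λ t lo → trans (a-rec (t - 3) (linear 1 (λ t → 43 :≤ t ⇒ ⊢ 2 :≤ t :- 3)
          t lo)) (cong₂ (λ i j → b i + b j - 0)
          (linear 2 (λ t bt3 → ⊢ t :- 3 :+ 1 :- bt3 :≡ t :+ 1 :- bt3 :- 3) t (b (t - 3)))
          (trans (cong (λ z → t - 3 + 1 - a z) (linear 1 (λ t → ⊢ t :- 3 :- 1 :≡ t :- 1 :- 3) t))
              (linear 2 (λ t at13 → ⊢ t :- 3 :+ 1 :- at13 :≡ t :+ 1 :- at13 :- 3) t (a (t - 1 - 3)))))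
      ; rec-v = λ t lo → trans (b-rec (t - 3) (linear 1 (λ t → 43 :≤ t ⇒ ⊢ 2 :≤ t :- 3)
          t lo)) (cong₂ (λ i j → a i + a j - (1 - 0))
          (trans (cong (λ z → t - 3 - a z) (linear 1 (λ t → ⊢ t :- 3 :- 1 :≡ t :- 1 :- 3) t))
              (linear 2 (λ t at13 → ⊢ t :- 3 :- at13 :≡ t :- at13 :- 3) t (a (t - 1 - 3))))
          (trans (cong (λ z → t - 3 - b z) (linear 1 (λ t → ⊢ t :- 3 :- 1 :≡ t :- 1 :- 3) t))
              (linear 2 (λ t bt13 → ⊢ t :- 3 :- bt13 :≡ t :- bt13 :- 3) t (b (t - 1 - 3)))))
      ; block-u = λ t lo hi → trans (a≡entry t (linear 1 (λ t → 83 :≤ t ⇒ ⊢ 4 :≤ t)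
          t lo) hi) (proj₁ (base-block t lo hi))
      ; block-v = λ t lo hi → trans (b≡entry t (linear 1 (λ t → 83 :≤ t ⇒ ⊢ 4 :≤ t)
          t lo) hi) (proj₂ (base-block t lo hi))
      ; lock = λ t lo hi → trans (cong₂ _+_ (b≡entry (t + 1) (linear 1 (λ t → 41 :≤ t ⇒ ⊢ 4 :≤ t :+ 1)
          t lo) hi) (a≡entry t (linear 1 (λ t → 41 :≤ t ⇒ ⊢ 4 :≤ t) t lo) (linear 1 (λ t → t :+ 1 :≤ 89 ⇒
          ⊢ t :≤ 89) t hi))) (base-lock t lo hi)
      ; step-u = λ t lo hi → subst₂ (λ i j → i ≤ j × j ≤ i + 1) (sym (a≡entry t lo
          (linear 1 (λ t → t :+ 1 :≤ 89 ⇒ ⊢ t :≤ 89) t hi))) (sym (a≡entry (t + 1) (linear 1 (λ t → 4 :≤ t ⇒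
          ⊢ 4 :≤ t :+ 1) t lo) hi)) (proj₁ (base-step t lo hi))
      ; step-v = λ t lo hi → subst₂ (λ i j → i ≤ j × j ≤ i + 1) (sym (b≡entry t lo
          (linear 1 (λ t → t :+ 1 :≤ 89 ⇒ ⊢ t :≤ 89) t hi))) (sym (b≡entry (t + 1) (linear 1 (λ t → 4 :≤ t ⇒
          ⊢ 4 :≤ t :+ 1) t lo) hi)) (proj₂ (base-step t lo hi))
      ; spread = λ t lo _ hi → subst₂ (λ i j → t ≤ i + j + 2 × i + j ≤ t + 2) (sym (a≡entry t lo hi)) (sym
          (b≡entry t lo hi)) (base-spread t lo hi) }

    -- After an even number of generations the frame is (a, b) translated by δ; after an odd
    -- number it is (b, a) with a translated by one more.
    data Linked (u v : ℤ → ℤ) (l m δ : ℤ) : Set where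
      aligned : (∀ t → u t ≡ a (t - δ)) → (∀ t → v t ≡ b (t - δ)) → l ≡ δ + 1 → m ≡ δ + 1 → Linked u v l m δ
      swapped : (∀ t → u t ≡ b (t - δ)) → (∀ t → v t ≡ a (t - δ - 1)) → l ≡ δ + 1 → m ≡ δ + 2 → Linked u v l m δ

    record Frame (g : ℕ) : Set where
      field
        {u v} : ℤ → ℤ
        {ε c x y l m d} : ℤ
        {δ} : ℤ
        generation : Generation u v ε c x y l m d
        linked : Linked u v l m δ
        0≤δ : 0 ≤ δ
        δ≤ : δ ≤ + g + 3
        d≡ : d ≡ + g + 2
        c≤ : c ≤ 43 * + (2 ℕ.^ g)
        -- The summand 1 makes the bound inductive: doubling turns it into 2, and ε takes away at
        -- most 1.
        c≥ : 42 * + (2 ℕ.^ g) + 1 ≤ c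

    first-frame : Frame 0
    first-frame = record
      { generation = first-generation ; linked = aligned (λ _ → refl) (λ _ → refl) refl refl
      ; 0≤δ = (linear 0 (⊢ 0 :≤ 3)) ; δ≤ = ≤-refl ; d≡ = refl ; c≤ = ≤-refl ; c≥ = ≤-refl }

    2^suc : ∀ g → + (2 ℕ.^ suc g) ≡ 2 * + (2 ℕ.^ g)
    2^suc g = pos-* 2 (2 ℕ.^ g)

    next-linked : ∀ {u v l m δ} → 0 ≤ δ → Linked u v l m δ →
      Σ ℤ λ δ′ → Linked v (λ t → u (t - 1)) m (l + 1) δ′ × 0 ≤ δ′ × δ′ ≤ δ + 1
    next-linked {δ = δ} 0≤δ (aligned hu hv refl refl) = δ , swapped hv
      (λ t → trans (hu (t - 1)) (cong a (linear 2 (λ t δ → ⊢ t :- 1 :- δ :≡ t :- δ :- 1) t δ))) refl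
          (linear 1 (λ δ → ⊢ δ :+ 1 :+ 1 :≡ δ :+ 2) δ) , 0≤δ , i≤i+j δ 1
    next-linked {δ = δ} 0≤δ (swapped hu hv refl refl) = δ + 1 , aligned
      (λ t → trans (hv t) (cong a (linear 2 (λ t δ → ⊢ t :- δ :- 1 :≡ t :- (δ :+ 1)) t δ)))
      (λ t → trans (hu (t - 1)) (cong b (linear 2 (λ t δ → ⊢ t :- 1 :- δ :≡ t :- (δ :+ 1)) t δ)))
          (linear 1 (λ δ → ⊢ δ :+ 2 :≡ δ :+ 1 :+ 1) δ) refl
      , (linear 1 (λ δ → 0 :≤ δ ⇒ ⊢ 0 :≤ δ :+ 1) δ 0≤δ) , ≤-refl

    next-frame : ∀ {g} → Frame g → Frame (suc g)
    next-frame {g} F = record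
      { generation = NextGeneration.next generation
      ; linked = proj₁ (proj₂ nl) ; 0≤δ = proj₁ (proj₂ (proj₂ nl))
      ; δ≤ = linear 4 (λ δ′ δ g sucg → δ′ :≤ δ :+ 1 ⇒ δ :≤ g :+ 3 ⇒ sucg :≡ g :+ 1 ⇒ ⊢ δ′ :≤ sucg :+ 3)
          δ′ δ (+ g) (+ suc g) (proj₂ (proj₂ (proj₂ nl))) δ≤ suc≡
      ; d≡ = linear 3 (λ d g sucg → d :≡ g :+ 2 ⇒ sucg :≡ g :+ 1 ⇒ ⊢ d :+ 1 :≡ sucg :+ 2)
          d (+ g) (+ suc g) d≡ suc≡
      ; c≤ = linear 4 (λ x2sucg x2g c ε → x2sucg :≡ 2 :* x2g ⇒ c :≤ 43 :* x2g ⇒ 0 :≤ ε ⇒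
          ⊢ 2 :* c :- ε :≤ 43 :* x2sucg) (+ (2 ℕ.^ suc g)) (+ (2 ℕ.^ g)) c ε (2^suc g) c≤ 0≤ε
      ; c≥ = (linear 4 (λ x2sucg x2g c ε → x2sucg :≡ 2 :* x2g ⇒ 42 :* x2g :+ 1 :≤ c ⇒ ε :≤ 1 ⇒
          ⊢ 42 :* x2sucg :+ 1 :≤ 2 :* c :- ε) (+ (2 ℕ.^ suc g)) (+ (2 ℕ.^ g)) c ε (2^suc g) c≥ ε≤1) }
      where
      open Frame F
      open Generation generation using (0≤ε; ε≤1)
      nl = next-linked 0≤δ linked
      δ′ = proj₁ nl
      suc≡ : + suc g ≡ + g + 1
      suc≡ = cong +_ (ℕₚ.+-comm 1 g)

    frame : ∀ g → Frame g
    frame zero = first-frame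
    frame (suc g) = next-frame (frame g)

    -- Slowness and spread in a generation start at k = 1 and not at the beginning of the
    -- generation, so a single frame speaks of every k up to about 2c.
    module Readings (g : ℕ) where
      open Frame (frame g) public
      open Generation generation using (step-u; step-v; spread; block-u; block-v; 2≤x; 2≤y)

      Step : (ℤ → ℤ) → ℤ → Set
      Step s k = s k ≤ s (k + 1) × s (k + 1) ≤ s k + 1

      module _ (k : ℤ) (1≤k : 1 ≤ k) (in-range : k + + g + 6 ≤ 2 * c) where
        private
          top : ∀ e → e ≤ 2 → k + δ + e ≤ 2 * c - 1 + y
          top e e≤2 = linear 6 (λ e k g c δ y → e :≤ 2 ⇒ k :+ g :+ 6 :≤ 2 :* c ⇒ δ :≤ g :+ 3 ⇒ 2 :≤ y ⇒
              ⊢ k :+ δ :+ e :≤ 2 :* c :- 1 :+ y) e k (+ g) c δ y e≤2 in-range δ≤ 2≤y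

          from-start : ∀ {i} → i ≡ δ + 1 → i ≤ k + δ
          from-start i≡ = subst (_≤ k + δ) (sym i≡) (linear 2 (λ k δ → 1 :≤ k ⇒ ⊢ δ :+ 1 :≤ k :+ δ) k δ 1≤k)

          unshift : k + δ - δ ≡ k
          unshift = linear 2 (λ k δ → ⊢ k :+ δ :- δ :≡ k) k δ
          unshift₁ : k + δ + 1 - δ ≡ k + 1
          unshift₁ = linear 2 (λ k δ → ⊢ k :+ δ :+ 1 :- δ :≡ k :+ 1) k δ
          unshift₂ : k + δ + 1 - δ - 1 ≡ k
          unshift₂ = linear 2 (λ k δ → ⊢ k :+ δ :+ 1 :- δ :- 1 :≡ k) k δ
          unshift₃ : k + δ + 1 + 1 - δ - 1 ≡ k + 1
          unshift₃ = linear 2 (λ k δ → ⊢ k :+ δ :+ 1 :+ 1 :- δ :- 1 :≡ k :+ 1) k δ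

          transport : ∀ {w s : ℤ → ℤ} {i} → w i ≡ s k → w (i + 1) ≡ s (k + 1) → w i ≤ w (i + 1) × w (i + 1) ≤ w
              i + 1 → Step s k
          transport e e′ = subst₂ (λ p q → p ≤ q × q ≤ p + 1) e e′

        step-a : Step a k
        step-a with linked
        ... | aligned hu hv l≡ m≡ = transport {u} {a} (trans (hu _) (cong a unshift)) (trans (hu _) (cong a
            unshift₁))
          (step-u (k + δ) (from-start l≡) (top 1 (+≤+ (ℕ.s≤s ℕ.z≤n))))
        ... | swapped hu hv l≡ m≡ = transport {v} {a} (trans (hv _) (cong a unshift₂)) (trans (hv _) (cong a
            unshift₃))
          (step-v (k + δ + 1) (≤-trans (≤-reflexive m≡) (linear 2 (λ k δ → 1 :≤ k ⇒ ⊢ δ :+ 2 :≤ k :+ δ :+ 1)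
              k δ 1≤k))
            (linear 4 (λ k δ c y → k :+ δ :+ 2 :≤ 2 :* c :- 1 :+ y ⇒ ⊢ k :+ δ :+ 1 :+ 1 :≤ 2 :* c :- 1 :+ y)
                k δ c y (top 2 ≤-refl)))

        step-b : Step b k
        step-b with linked
        ... | aligned hu hv l≡ m≡ = transport {v} {b} (trans (hv _) (cong b unshift)) (trans (hv _) (cong b
            unshift₁))
          (step-v (k + δ) (from-start m≡) (top 1 (+≤+ (ℕ.s≤s ℕ.z≤n))))
        ... | swapped hu hv l≡ m≡ = transport {u} {b} (trans (hu _) (cong b unshift)) (trans (hu _) (cong b
            unshift₁))
          (step-u (k + δ) (from-start l≡) (top 1 (+≤+ (ℕ.s≤s ℕ.z≤n))))

        a+b≈k : k ≤ a k + b k + (+ g + 6) × a k + b k ≤ k + (+ g + 6)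
        a+b≈k with linked
        ... | aligned hu hv l≡ m≡ =
            (linear 8 (λ k δ ukδ vkδ d g ak bk → k :+ δ :≤ ukδ :+ vkδ :+ d ⇒ d :≡ g :+ 2 ⇒ ukδ :≡ ak ⇒ vkδ :≡ bk
                ⇒ 0 :≤ δ ⇒ ⊢ k :≤ ak :+ bk :+ (g :+ 6))
                k δ (u (k + δ)) (v (k + δ)) d (+ g) (a k) (b k) (proj₁ sp) d≡ u≡ v≡ 0≤δ)
          , (linear 7 (λ ukδ vkδ k δ ak bk g → ukδ :+ vkδ :≤ k :+ δ :+ 2 ⇒ ukδ :≡ ak ⇒ vkδ :≡ bk ⇒ δ :≤ g :+ 3 ⇒
              ⊢ ak :+ bk :≤ k :+ (g :+ 6)) (u (k + δ)) (v (k + δ)) k δ (a k) (b k) (+ g) (proj₂ sp) u≡ v≡ δ≤)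
          where
          sp = spread (k + δ) (from-start l≡) (from-start m≡) (subst (_≤ 2 * c - 1 + y) (+-identityʳ _) (top 0
              (+≤+ ℕ.z≤n)))
          u≡ = trans (hu (k + δ)) (cong a unshift)
          v≡ = trans (hv (k + δ)) (cong b unshift)
        -- The index t = k + δ + 1 pairs a k with b (k + 1), one slow step away from b k.
        ... | swapped hu hv l≡ m≡ =
            (linear 9 (λ k δ ukδ1 vkδ1 d g bk1 ak bk → k :+ δ :+ 1 :≤ ukδ1 :+ vkδ1 :+ d ⇒ d :≡ g :+ 2 ⇒ ukδ1 :≡
                bk1 ⇒ vkδ1 :≡ ak ⇒ 0 :≤ δ ⇒ bk1 :≤ bk :+ 1 ⇒ ⊢ k :≤ ak :+ bk :+ (g :+ 6))
                k δ (u (k + δ + 1)) (v (k + δ + 1)) d (+ g) (b (k + 1)) (a k) (b k) (proj₁ sp) d≡ u≡ v≡ 0≤δ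
                (proj₂ step-b))
          , (linear 8 (λ ukδ1 vkδ1 k δ bk1 ak g bk → ukδ1 :+ vkδ1 :≤ k :+ δ :+ 1 :+ 2 ⇒ ukδ1 :≡ bk1 ⇒ vkδ1 :≡ ak
              ⇒ δ :≤ g :+ 3 ⇒ bk :≤ bk1 ⇒ ⊢ ak :+ bk :≤ k :+ (g :+ 6))
              (u (k + δ + 1)) (v (k + δ + 1)) k δ (b (k + 1)) (a k) (+ g) (b k) (proj₂ sp) u≡ v≡ δ≤ (proj₁
              step-b))
          where
          sp = spread (k + δ + 1) (≤-trans (from-start l≡) (i≤i+j (k + δ) 1)) (≤-trans (≤-reflexive m≡)
              (linear 2 (λ k δ → 1 :≤ k ⇒ ⊢ δ :+ 2 :≤ k :+ δ :+ 1) k δ 1≤k)) (top 1 (+≤+ (ℕ.s≤s ℕ.z≤n)))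
          u≡ = trans (hu (k + δ + 1)) (cong b unshift₁)
          v≡ = trans (hv (k + δ + 1)) (cong a unshift₂)

      private
        lo : 2 * c - 1 - x ≤ 2 * c - 1
        lo = linear 2 (λ x c → 2 :≤ x ⇒ ⊢ 2 :* c :- 1 :- x :≤ 2 :* c :- 1) x c 2≤x
        hi : 2 * c - 1 ≤ 2 * c - 1 + y
        hi = linear 2 (λ y c → 2 :≤ y ⇒ ⊢ 2 :* c :- 1 :≤ 2 :* c :- 1 :+ y) y c 2≤y
        u-mid : u (2 * c - 1) ≡ c
        u-mid = trans (block-u (2 * c - 1) lo hi) (linear 1 (λ c → ⊢ 2 :* c :- 1 :+ 1 :- c :≡ c) c)
        v-mid : v (2 * c - 1) ≡ c
        v-mid = block-v (2 * c - 1) lo hi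

      -- The index 2c - 1 lies in the block, and there u and v both equal c. This point, where each
      -- sequence is half of t + 1, anchors the halving in `A-size`; the shift δ explains g + 5.
      a-mid : Σ ℤ λ k → a k ≡ c × 2 * c ≤ k + + g + 5
      a-mid with linked
      ... | aligned hu hv _ _ = 2 * c - 1 - δ , trans (sym (hu _)) u-mid , (linear 3 (λ δ g c → δ :≤ g :+ 3 ⇒
          ⊢ 2 :* c :≤ 2 :* c :- 1 :- δ :+ g :+ 5) δ (+ g) c δ≤)
      ... | swapped hu hv _ _ = 2 * c - 1 - δ - 1 , trans (sym (hv _)) v-mid ,
          (linear 3 (λ δ g c → δ :≤ g :+ 3 ⇒ ⊢ 2 :* c :≤ 2 :* c :- 1 :- δ :- 1 :+ g :+ 5) δ (+ g) c δ≤)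

      b-mid : Σ ℤ λ k → b k ≡ c × 2 * c ≤ k + + g + 5
      b-mid with linked
      ... | aligned hu hv _ _ = 2 * c - 1 - δ , trans (sym (hv _)) v-mid , (linear 3 (λ δ g c → δ :≤ g :+ 3 ⇒
          ⊢ 2 :* c :≤ 2 :* c :- 1 :- δ :+ g :+ 5) δ (+ g) c δ≤)
      ... | swapped hu hv _ _ = 2 * c - 1 - δ , trans (sym (hu _)) u-mid , (linear 3 (λ δ g c → δ :≤ g :+ 3 ⇒
          ⊢ 2 :* c :≤ 2 :* c :- 1 :- δ :+ g :+ 5) δ (+ g) c δ≤)

    n<2^n : ∀ n → + n + 1 ≤ + (2 ℕ.^ n)
    n<2^n zero = ≤-refl
    n<2^n (suc n) = linear 4 (λ n x2n x2sucn sucn → n :+ 1 :≤ x2n ⇒ x2sucn :≡ 2 :* x2n ⇒ sucn :≡ n :+ 1 ⇒ 0 :≤ n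
        ⇒ ⊢ sucn :+ 1 :≤ x2sucn) (+ n) (+ (2 ℕ.^ n)) (+ (2 ℕ.^ suc n)) (+ suc n) (n<2^n n) (2^suc n) suc≡ (0≤+
        n)
      where
      suc≡ : + suc n ≡ + n + 1
      suc≡ = cong +_ (ℕₚ.+-comm 1 n)

    in-range : ∀ g k → k ≤ 2 * + (2 ℕ.^ g) → k + + g + 6 ≤ 2 * Frame.c (frame g)
    in-range g k k≤ = linear 4 (λ k x2g g Framecframeg → k :≤ 2 :* x2g ⇒ g :+ 1 :≤ x2g ⇒ 0 :≤ g ⇒ 42 :* x2g :+ 1
        :≤ Framecframeg ⇒ ⊢ k :+ g :+ 6 :≤ 2 :* Framecframeg)
        k (+ (2 ℕ.^ g)) (+ g) (Frame.c (frame g)) k≤ (n<2^n g) (0≤+ g) (Frame.c≥ (frame g))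

    always-in-range : ∀ k → 1 ≤ k → k + + ∣ k ∣ + 6 ≤ 2 * Frame.c (frame ∣ k ∣)
    always-in-range k 1≤k = in-range ∣ k ∣ k
      (linear 3 (λ k k′ x2k → k :≡ k′ ⇒ k :+ 1 :≤ x2k ⇒ 1 :≤ k′ ⇒ ⊢ k′ :≤ 2 :* x2k)
          (+ ∣ k ∣) k (+ (2 ℕ.^ ∣ k ∣)) k≡ (n<2^n ∣ k ∣) 1≤k)
      where
      k≡ : + ∣ k ∣ ≡ k
      k≡ = 0≤i⇒+∣i∣≡i (≤-trans (+≤+ ℕ.z≤n) 1≤k)

    -- Global regularity of the two halved sequences

    A : Bool → ℤ → ℤ
    A true = a
    A false = b

    A1 : ∀ t → A t 1 ≡ 1
    A1 true = h≡entry 2 (+≤+ (ℕ.s≤s ℕ.z≤n)) (linear 0 (⊢ 2 :≤ 172))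
    A1 false = h≡entry 1 ≤-refl (linear 0 (⊢ 1 :≤ 172))

    -- The conclusion does not depend on the generation, so any frame that reaches k will do; g =
    -- |k| is crude, but 2^k > k makes it sufficient.
    A-step : ∀ t k → 1 ≤ k → A t k ≤ A t (k + 1) × A t (k + 1) ≤ A t k + 1
    A-step true k 1≤k = Readings.step-a ∣ k ∣ k 1≤k (always-in-range k 1≤k)
    A-step false k 1≤k = Readings.step-b ∣ k ∣ k 1≤k (always-in-range k 1≤k)

    A-mono : ∀ t i j → 1 ≤ i → i ≤ j → A t i ≤ A t j
    A-mono t i j 1≤i i≤j = monotone (A t) 1 j (λ k 1≤k _ → proj₁ (A-step t k 1≤k)) i j 1≤i i≤j ≤-refl

    A-lipschitz : ∀ t i j → 1 ≤ i → i ≤ j → A t j ≤ A t i + (j - i)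
    A-lipschitz t i j 1≤i i≤j = linear 4 (λ i Ati j Atj → i :- Ati :≤ j :- Atj ⇒ ⊢ Atj :≤ Ati :+ (j :- i))
        i (A t i) j (A t j) slack
      where
      slack : i - A t i ≤ j - A t j
      slack = monotone (λ k → k - A t k) 1 j
        (λ k 1≤k _ → (linear 3 (λ Atk1 Atk k → Atk1 :≤ Atk :+ 1 ⇒ ⊢ k :- Atk :≤ k :+ 1 :- Atk1)
            (A t (k + 1)) (A t k) k (proj₂ (A-step t k 1≤k)))) i j 1≤i i≤j ≤-refl

    A-close : ∀ t i j e → 1 ≤ i → 1 ≤ j → 0 ≤ e → i ≤ j + e → A t i ≤ A t j + e
    A-close t i j e 1≤i 1≤j 0≤e i≤ with ≤-or-> i j
    ... | inj₁ i≤j = linear 3 (λ Ati Atj e → Ati :≤ Atj ⇒ 0 :≤ e ⇒ ⊢ Ati :≤ Atj :+ e)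
        (A t i) (A t j) e (A-mono t i j 1≤i i≤j) 0≤e
    ... | inj₂ j<i = linear 5 (λ Ati Atj i j e → Ati :≤ Atj :+ (i :- j) ⇒ i :≤ j :+ e ⇒ ⊢ Ati :≤ Atj :+ e)
        (A t i) (A t j) i j e (A-lipschitz t j i 1≤j (≤-trans (i≤i+j j 1) j<i)) i≤

    1≤A : ∀ t k → 1 ≤ k → 1 ≤ A t k
    1≤A t k 1≤k = subst (_≤ A t k) (A1 t) (A-mono t 1 k ≤-refl 1≤k)

    A≤ : ∀ t k → 1 ≤ k → A t k ≤ k
    A≤ t k 1≤k = linear 3 (λ Atk At1 k → Atk :≤ At1 :+ (k :- 1) ⇒ At1 :≡ 1 ⇒ ⊢ Atk :≤ k)
        (A t k) (A t 1) k (A-lipschitz t 1 k ≤-refl 1≤k) (A1 t)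

    -- The anchor k₀ has value c and 2c ≤ k₀ + g + 5. So k exceeds k₀ by at most e + g + 5, and a
    -- slow sequence then exceeds c by no more.
    A-size : ∀ t g k e → 1 ≤ k → 0 ≤ e → k ≤ 2 * Frame.c (frame g) + e → A t k ≤ Frame.c (frame g) + (e + + g +
        5)
    A-size t g k e 1≤k 0≤e k≤ = linear 5 (λ Atk Atk₀ e g c → Atk :≤ Atk₀ :+ (e :+ g :+ 5) ⇒ Atk₀ :≡ c ⇒
        ⊢ Atk :≤ c :+ (e :+ g :+ 5)) (A t k) (A t k₀) e (+ g) c (A-close t k k₀ (e + + g + 5) 1≤k 1≤k₀
        (linear 2 (λ e g → 0 :≤ e ⇒ 0 :≤ g ⇒ ⊢ 0 :≤ e :+ g :+ 5) e (+ g) 0≤e (0≤+ g))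
        (linear 5 (λ k c e k₀ g → k :≤ 2 :* c :+ e ⇒ 2 :* c :≤ k₀ :+ g :+ 5 ⇒ ⊢ k :≤ k₀ :+ (e :+ g :+ 5))
        k c e k₀ (+ g) k≤ k₀≥)) k₀≡
      where
      open Readings g using (c; a-mid; b-mid; c≥)
      mid : ∀ t → Σ ℤ λ k → A t k ≡ c × 2 * c ≤ k + + g + 5
      mid true = a-mid
      mid false = b-mid
      k₀ = proj₁ (mid t)
      k₀≡ = proj₁ (proj₂ (mid t))
      k₀≥ = proj₂ (proj₂ (mid t))
      1≤k₀ : 1 ≤ k₀
      1≤k₀ = linear 4 (λ c k₀ g x2g → 2 :* c :≤ k₀ :+ g :+ 5 ⇒ 42 :* x2g :+ 1 :≤ c ⇒ g :+ 1 :≤ x2g ⇒ 0 :≤ g ⇒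
          ⊢ 1 :≤ k₀) c k₀ (+ g) (+ (2 ℕ.^ g)) k₀≥ c≥ (n<2^n g) (0≤+ g)

  -- Binomial sums

  binom : ℕ → ℕ → ℕ
  binom _ zero = 1
  binom zero (suc k) = 0
  binom (suc n) (suc k) = binom n k ℕ.+ binom n (suc k)

  binom-zero : ∀ n k → binom n (suc (n ℕ.+ k)) ≡ 0
  binom-zero zero k = refl
  binom-zero (suc n) k = cong₂ ℕ._+_ (binom-zero n k) (trans (cong (λ j → binom n (suc j)) (sym (ℕₚ.+-suc n k)))
      (binom-zero n (suc k)))

  binom-diagonal : ∀ n → binom n n ≡ 1
  binom-diagonal zero = refl
  binom-diagonal (suc n) = cong₂ ℕ._+_ (binom-diagonal n) (trans (cong (λ j → binom n (suc j)) (sym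
      (ℕₚ.+-identityʳ n))) (binom-zero n 0))

  sum≤ : ℕ → (ℕ → ℤ) → ℤ
  sum≤ zero s = s zero
  sum≤ (suc n) s = sum≤ n s + s (suc n)

  sum≤-cong : ∀ n {s s′} → (∀ i → s i ≡ s′ i) → sum≤ n s ≡ sum≤ n s′
  sum≤-cong zero h = h 0
  sum≤-cong (suc n) h = cong₂ _+_ (sum≤-cong n h) (h (suc n))

  sum≤-mono : ∀ n {s s′} → (∀ i → i ℕ.≤ n → s i ≤ s′ i) → sum≤ n s ≤ sum≤ n s′
  sum≤-mono zero h = h 0 ℕ.z≤n
  sum≤-mono (suc n) h = +-mono-≤ (sum≤-mono n (λ i i≤n → h i (ℕₚ.m≤n⇒m≤1+n i≤n))) (h (suc n) ℕₚ.≤-refl)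

  sum≤-+ : ∀ n s s′ → sum≤ n (λ i → s i + s′ i) ≡ sum≤ n s + sum≤ n s′
  sum≤-+ zero s s′ = refl
  sum≤-+ (suc n) s s′ = trans (cong (_+ (s (suc n) + s′ (suc n))) (sum≤-+ n s s′)) (interchange (sum≤ n s) (sum≤
      n s′) (s (suc n)) (s′ (suc n)))
    where
    interchange : ∀ a b c d → a + b + (c + d) ≡ a + c + (b + d)
    interchange = solve-∀

  sum≤-* : ∀ n k s → sum≤ n (λ i → k * s i) ≡ k * sum≤ n s
  sum≤-* zero k s = refl
  sum≤-* (suc n) k s = trans (cong (_+ k * s (suc n)) (sum≤-* n k s)) (sym (*-distribˡ-+ k _ _))

  sum≤-telescope : ∀ n (s : ℕ → ℤ) → sum≤ n (λ i → s i - s (suc i)) ≡ s 0 - s (suc n)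
  sum≤-telescope zero s = refl
  sum≤-telescope (suc n) s = trans (cong (_+ (s (suc n) - s (suc (suc n)))) (sum≤-telescope n s)) (cancel (s 0)
      (s (suc n)) (s (suc (suc n))))
    where
    cancel : ∀ a b c → a - b + (b - c) ≡ a - c
    cancel = solve-∀

  sum≤-const : ∀ n k → sum≤ n (λ _ → k) ≡ + suc n * k
  sum≤-const zero k = sym (*-identityˡ k)
  sum≤-const (suc n) k = trans (cong (_+ k) (sum≤-const n k)) (trans (add-one (+ suc n) k) (cong (_* k) (cong +_
      (ℕₚ.+-comm (suc n) 1))))
    where
    add-one : ∀ m k → m * k + k ≡ (m + 1) * k
    add-one = solve-∀

  binomial-sum : ℕ → (ℕ → ℤ) → ℤ
  binomial-sum r s = sum≤ r (λ i → + binom r i * s i)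

  binomial-sum-+ : ∀ r s s′ → binomial-sum r (λ i → s i + s′ i) ≡ binomial-sum r s + binomial-sum r s′
  binomial-sum-+ r s s′ = trans (sum≤-cong r (λ i → *-distribˡ-+ (+ binom r i) (s i) (s′ i))) (sum≤-+ r _ _)

  binomial-sum-mono : ∀ r {s s′} → (∀ i → i ℕ.≤ r → s i ≤ s′ i) → binomial-sum r s ≤ binomial-sum r s′
  binomial-sum-mono r h = sum≤-mono r (λ i i≤r → *-monoˡ-≤-nonNeg (+ binom r i) (h i i≤r))

  -- The partial sums differ by the boundary term C(r, n) s(n + 1). At n = r this is the missing
  -- last term, since C(r, r) = 1 = C(r + 1, r + 1).
  pascal : ∀ r s → binomial-sum r (λ i → s i + s (suc i)) ≡ binomial-sum (suc r) s
  pascal r s = trans (partial r) (cong (λ k → sum≤ r (λ i → + binom (suc r) i * s i) + + k * s (suc r))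
      (trans (binom-diagonal r) (sym (binom-diagonal (suc r)))))
    where
    partial : ∀ n → sum≤ n (λ i → + binom r i * (s i + s (suc i))) ≡ sum≤ n (λ i → + binom (suc r) i * s i) + +
        binom r n * s (suc n)
    partial zero = first (s 0) (s 1)
      where
      first : ∀ p q → 1 * (p + q) ≡ 1 * p + 1 * q
      first = solve-∀
    partial (suc n) = trans (cong (_+ + binom r (suc n) * (s (suc n) + s (suc (suc n)))) (partial n))
      (trans (regroup (sum≤ n (λ i → + binom (suc r) i * s i)) (+ binom r n) (+ binom r (suc n)) (s (suc n)) (s
          (suc (suc n))))
        (cong (λ k → sum≤ n (λ i → + binom (suc r) i * s i) + k * s (suc n) + + binom r (suc n) * s (suc (suc
            n))) (sym (pos-+ (binom r n) (binom r (suc n))))))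
      where
      regroup : ∀ t p q x y → t + p * x + q * (x + y) ≡ t + (p + q) * x + q * y
      regroup = solve-∀

  binomial-sum-const : ∀ r k → binomial-sum r (λ _ → k) ≡ + (2 ℕ.^ r) * k
  binomial-sum-const zero k = refl
  binomial-sum-const (suc r) k = trans (sym (pascal r (λ _ → k))) (trans (binomial-sum-const r (k + k))
    (trans (double (+ (2 ℕ.^ r)) k) (cong (_* k) (sym (pos-* 2 (2 ℕ.^ r))))))
    where
    double : ∀ p k → p * (k + k) ≡ 2 * p * k
    double = solve-∀

  binomial-sum-bound : ∀ r β s → (∀ i → binom r i ℕ.≤ β) → (∀ i → i ℕ.≤ r → 0 ≤ s i) → binomial-sum r s ≤ + β *
      sum≤ r s
  binomial-sum-bound r β s C≤β 0≤s = ≤-trans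
    (sum≤-mono r (λ i i≤r → *-monoʳ-≤-nonNeg (s i) {{nonNegative (0≤s i i≤r)}} (+≤+ (C≤β i))))
    (≤-reflexive (sum≤-* r (+ β) s))

  -- Size of the largest binomial coefficient

  absorb : ∀ n k → suc k ℕ.* binom (suc n) (suc k) ≡ suc n ℕ.* binom n k
  absorb zero zero = refl
  absorb zero (suc k) = ℕₚ.*-zeroʳ (suc (suc k))
  absorb (suc n) zero = trans (ℕₚ.*-distribˡ-+ 1 1 (binom (suc n) 1)) (cong suc (absorb n zero))
  absorb (suc n) (suc k) = trans (ℕₚ.*-distribˡ-+ (suc (suc k)) X (binom (suc n) (suc (suc k))))
    (trans (cong₂ ℕ._+_ (cong (X ℕ.+_) (absorb n k)) (absorb n (suc k))) (regroup n (binom n k) (binom n (suc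
        k))))
    where
    X = binom (suc n) (suc k)
    regroup : ∀ n x y → x ℕ.+ y ℕ.+ suc n ℕ.* x ℕ.+ suc n ℕ.* y ≡ suc (suc n) ℕ.* (x ℕ.+ y)
    regroup = ℕsolve-∀

  coabsorb : ∀ k j → suc j ℕ.* binom (suc (k ℕ.+ j)) k ≡ suc (k ℕ.+ j) ℕ.* binom (k ℕ.+ j) k
  coabsorb zero j = refl
  coabsorb (suc k) j = trans (ℕₚ.*-distribˡ-+ (suc j) x y) (trans (cong (ℕ._+ suc j ℕ.* y) (sym ky≡jx)) (collect
      k j y))
    where
    x = binom (suc (k ℕ.+ j)) k
    y = binom (suc (k ℕ.+ j)) (suc k)
    expand : ∀ k j x y → suc k ℕ.* x ℕ.+ suc j ℕ.* x ≡ suc (suc (k ℕ.+ j)) ℕ.* x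
    expand = ℕsolve-∀
    ky≡jx : suc k ℕ.* y ≡ suc j ℕ.* x
    ky≡jx = ℕₚ.+-cancelˡ-≡ (suc k ℕ.* x) _ _
      (trans (sym (ℕₚ.*-distribˡ-+ (suc k) x y)) (trans (absorb (suc (k ℕ.+ j)) k) (sym (expand k j x y))))
    collect : ∀ k j y → suc k ℕ.* y ℕ.+ suc j ℕ.* y ≡ suc (suc (k ℕ.+ j)) ℕ.* y
    collect = ℕsolve-∀

  -- For i ≤ m, `coabsorb` has the factor 2m + 1 - i ≥ m + 1 on the left; for i > m, `absorb` has
  -- the factor i ≥ m + 1. Bounding all entries of a row at once takes the place of unimodality.
  odd-binom-bound : ∀ m β → (∀ i → binom (m ℕ.+ m) i ℕ.≤ β) → ∀ i → suc m ℕ.* binom (suc (m ℕ.+ m)) i ℕ.≤ suc (m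
      ℕ.+ m) ℕ.* β
  odd-binom-bound m β C≤β i with ℕₚ.≤-total i m
  ... | inj₁ i≤m = begin
    suc m ℕ.* binom (suc (m ℕ.+ m)) i   ≤⟨ ℕₚ.*-monoˡ-≤ (binom (suc (m ℕ.+ m)) i) (ℕ.s≤s m≤j) ⟩
    suc j ℕ.* binom (suc (m ℕ.+ m)) i   ≡⟨ cong (λ n → suc j ℕ.* binom (suc n) i) (sym i+j≡) ⟩
    suc j ℕ.* binom (suc (i ℕ.+ j)) i   ≡⟨ coabsorb i j ⟩
    suc (i ℕ.+ j) ℕ.* binom (i ℕ.+ j) i ≡⟨ cong (λ n → suc n ℕ.* binom n i) i+j≡ ⟩
    suc (m ℕ.+ m) ℕ.* binom (m ℕ.+ m) i ≤⟨ ℕₚ.*-monoʳ-≤ (suc (m ℕ.+ m)) (C≤β i) ⟩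
    suc (m ℕ.+ m) ℕ.* β                 ∎
    where
    open ℕₚ.≤-Reasoning
    j = (m ℕ.+ m) ℕ.∸ i
    i+j≡ : i ℕ.+ j ≡ m ℕ.+ m
    i+j≡ = ℕₚ.m+[n∸m]≡n (ℕₚ.≤-trans i≤m (ℕₚ.m≤m+n m m))
    m≤j : m ℕ.≤ j
    m≤j = ℕₚ.+-cancelˡ-≤ i m j (ℕₚ.≤-trans (ℕₚ.+-monoˡ-≤ m i≤m) (ℕₚ.≤-reflexive (sym i+j≡)))
  odd-binom-bound zero β C≤β zero | inj₂ _ = ℕₚ.≤-trans (C≤β 0) (ℕₚ.≤-reflexive (sym (ℕₚ.*-identityˡ β)))
  odd-binom-bound m β C≤β (suc i) | inj₂ m≤i with ℕₚ.m≤n⇒m<n∨m≡n m≤i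
  ... | inj₂ refl = begin
    suc (suc i) ℕ.* binom (suc (suc i ℕ.+ suc i)) (suc i) ≡⟨ coabsorb (suc i) (suc i) ⟩
    suc (suc i ℕ.+ suc i) ℕ.* binom (suc i ℕ.+ suc i) (suc i) ≤⟨ ℕₚ.*-monoʳ-≤ (suc (suc i ℕ.+ suc i)) (C≤β (suc
        i)) ⟩
    suc (suc i ℕ.+ suc i) ℕ.* β ∎
    where open ℕₚ.≤-Reasoning
  ... | inj₁ m<i = begin
    suc m ℕ.* binom (suc (m ℕ.+ m)) (suc i) ≤⟨ ℕₚ.*-monoˡ-≤ (binom (suc (m ℕ.+ m)) (suc i)) m<i ⟩
    suc i ℕ.* binom (suc (m ℕ.+ m)) (suc i) ≡⟨ absorb (m ℕ.+ m) i ⟩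
    suc (m ℕ.+ m) ℕ.* binom (m ℕ.+ m) i     ≤⟨ ℕₚ.*-monoʳ-≤ (suc (m ℕ.+ m)) (C≤β i) ⟩
    suc (m ℕ.+ m) ℕ.* β                     ∎
    where open ℕₚ.≤-Reasoning

  even-binom-bound : ∀ m β → (∀ i → binom (m ℕ.+ m) i ℕ.≤ β) →
    ∀ i → suc m ℕ.* binom (suc m ℕ.+ suc m) i ℕ.≤ 2 ℕ.* (suc (m ℕ.+ m) ℕ.* β)
  even-binom-bound m β C≤β zero = ℕₚ.≤-trans (odd-binom-bound m β C≤β 0) (ℕₚ.m≤m+n _ _)
  even-binom-bound m β C≤β (suc i) = begin
    suc m ℕ.* (binom (m ℕ.+ suc m) i ℕ.+ binom (m ℕ.+ suc m) (suc i)) ≡⟨ cong (λ n → suc m ℕ.* (binom n i ℕ.+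
        binom n (suc i))) (ℕₚ.+-suc m m) ⟩
    suc m ℕ.* (binom (suc (m ℕ.+ m)) i ℕ.+ binom (suc (m ℕ.+ m)) (suc i)) ≡⟨ ℕₚ.*-distribˡ-+ (suc m) (binom (suc
        (m ℕ.+ m)) i) _ ⟩
    suc m ℕ.* binom (suc (m ℕ.+ m)) i ℕ.+ suc m ℕ.* binom (suc (m ℕ.+ m)) (suc i)
      ≤⟨ ℕₚ.+-mono-≤ (odd-binom-bound m β C≤β i) (odd-binom-bound m β C≤β (suc i)) ⟩
    suc (m ℕ.+ m) ℕ.* β ℕ.+ suc (m ℕ.+ m) ℕ.* β ≡⟨ cong (suc (m ℕ.+ m) ℕ.* β ℕ.+_) (sym (ℕₚ.+-identityʳ _)) ⟩
    2 ℕ.* (suc (m ℕ.+ m) ℕ.* β) ∎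
    where open ℕₚ.≤-Reasoning

  -- With β in the role of C(2m, m), the second part is C(2m, m) ≤ 4^m / √(2m + 1), squared to stay
  -- within ℕ.
  BinomBound : ℕ → ℕ → Set
  BinomBound m β = (∀ i → binom (m ℕ.+ m) i ℕ.≤ β) × suc (m ℕ.+ m) ℕ.* (β ℕ.* β) ℕ.≤ 16 ℕ.^ m

  -- The factor 2(2m + 1)/(m + 1) is the ratio of consecutive central coefficients. The invariant
  -- survives because (2m + 1)(2m + 3) ≤ 4(m + 1)².
  next-binom-bound : ∀ m β → BinomBound m β → BinomBound (suc m) ((2 ℕ.* (suc (m ℕ.+ m) ℕ.* β)) / suc m)
  next-binom-bound m β (C≤β , β²≤) = C≤β′ , ℕₚ.*-cancelˡ-≤ (suc m ℕ.* suc m) (begin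
    suc m ℕ.* suc m ℕ.* (suc (suc m ℕ.+ suc m) ℕ.* (β′ ℕ.* β′)) ≡⟨ shuffle m β′ ⟩
    (3 ℕ.+ (m ℕ.+ m)) ℕ.* ((β′ ℕ.* suc m) ℕ.* (β′ ℕ.* suc m)) ≤⟨ ℕₚ.*-monoʳ-≤ (3 ℕ.+ (m ℕ.+ m)) (ℕₚ.*-mono-≤ β′≤
        β′≤) ⟩
    (3 ℕ.+ (m ℕ.+ m)) ℕ.* (2 ℕ.* (suc (m ℕ.+ m) ℕ.* β) ℕ.* (2 ℕ.* (suc (m ℕ.+ m) ℕ.* β))) ≡⟨ shuffle′ m β ⟩
    4 ℕ.* ((3 ℕ.+ (m ℕ.+ m)) ℕ.* suc (m ℕ.+ m)) ℕ.* (suc (m ℕ.+ m) ℕ.* (β ℕ.* β))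
      ≤⟨ ℕₚ.*-mono-≤ (ℕₚ.*-monoʳ-≤ 4 square-gap) β²≤ ⟩
    4 ℕ.* (4 ℕ.* (suc m ℕ.* suc m)) ℕ.* 16 ℕ.^ m ≡⟨ shuffle″ m (16 ℕ.^ m) ⟩
    suc m ℕ.* suc m ℕ.* 16 ℕ.^ suc m ∎)
    where
    open ℕₚ.≤-Reasoning
    β′ = (2 ℕ.* (suc (m ℕ.+ m) ℕ.* β)) / suc m
    β′≤ : β′ ℕ.* suc m ℕ.≤ 2 ℕ.* (suc (m ℕ.+ m) ℕ.* β)
    β′≤ = m/n*n≤m (2 ℕ.* (suc (m ℕ.+ m) ℕ.* β)) (suc m)
    C≤β′ : ∀ i → binom (suc m ℕ.+ suc m) i ℕ.≤ β′
    C≤β′ i = begin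
      binom (suc m ℕ.+ suc m) i                    ≡⟨ sym (m*n/n≡m _ (suc m)) ⟩
      (binom (suc m ℕ.+ suc m) i ℕ.* suc m) / suc m ≡⟨ cong (_/ suc m) (ℕₚ.*-comm (binom (suc m ℕ.+ suc m) i)
          (suc m)) ⟩
      (suc m ℕ.* binom (suc m ℕ.+ suc m) i) / suc m ≤⟨ /-monoˡ-≤ (suc m) (even-binom-bound m β C≤β i) ⟩
      β′ ∎
    square-gap : (3 ℕ.+ (m ℕ.+ m)) ℕ.* suc (m ℕ.+ m) ℕ.≤ 4 ℕ.* (suc m ℕ.* suc m)
    square-gap = ℕₚ.≤-trans (ℕₚ.n≤1+n _) (ℕₚ.≤-reflexive (gap m))
      where
      gap : ∀ m → suc ((3 ℕ.+ (m ℕ.+ m)) ℕ.* suc (m ℕ.+ m)) ≡ 4 ℕ.* (suc m ℕ.* suc m)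
      gap = ℕsolve-∀
    shuffle : ∀ m β → suc m ℕ.* suc m ℕ.* (suc (suc m ℕ.+ suc m) ℕ.* (β ℕ.* β)) ≡ (3 ℕ.+ (m ℕ.+ m)) ℕ.* ((β ℕ.*
        suc m) ℕ.* (β ℕ.* suc m))
    shuffle = ℕsolve-∀
    shuffle′ : ∀ m β → (3 ℕ.+ (m ℕ.+ m)) ℕ.* (2 ℕ.* (suc (m ℕ.+ m) ℕ.* β) ℕ.* (2 ℕ.* (suc (m ℕ.+ m) ℕ.* β))) ≡ 4
        ℕ.* ((3 ℕ.+ (m ℕ.+ m)) ℕ.* suc (m ℕ.+ m)) ℕ.* (suc (m ℕ.+ m) ℕ.* (β ℕ.* β))
    shuffle′ = ℕsolve-∀
    shuffle″ : ∀ m p → 4 ℕ.* (4 ℕ.* (suc m ℕ.* suc m)) ℕ.* p ≡ suc m ℕ.* suc m ℕ.* (16 ℕ.* p)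
    shuffle″ = ℕsolve-∀

  binom-bound : ∀ m → ∃ (BinomBound m)
  binom-bound zero = 1 , small , ℕ.s≤s ℕ.z≤n
    where
    small : ∀ i → binom 0 i ℕ.≤ 1
    small zero = ℕₚ.≤-refl
    small (suc i) = ℕ.z≤n
  binom-bound (suc m) = let β , h = binom-bound m in _ , next-binom-bound m β h

  -- Descent through the generations

  Close : ℤ → ℤ → ℤ → Set
  Close e x y = x ≤ y + e × y ≤ x + e

  one-more : ∀ n k → + n * k + k ≡ + suc n * k
  one-more n k = trans (add-one (+ n) k) (cong (_* k) (cong +_ (ℕₚ.+-comm n 1)))
    where
    add-one : ∀ m k → m * k + k ≡ (m + 1) * k
    add-one = solve-∀

  module Pascal (f : ℕ → ℤ) (isQ : IsQtilde f) where
    open Halves f isQ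
    open Frames f isQ

    A-near : ∀ t i j e → 1 ≤ i → 1 ≤ j → 0 ≤ e → Close e i j → Close e (A t i) (A t j)
    A-near t i j e 1≤i 1≤j 0≤e (p , q) = A-close t i j e 1≤i 1≤j 0≤e p , A-close t j i e 1≤j 1≤i 0≤e q

    c : ℕ → ℤ
    c g = Frame.c (frame g)

    module _ (g : ℕ) where
      L R : ℤ
      L = + g + 6
      R = 2 * L + 5

      0≤L : 0 ≤ L
      0≤L = linear 1 (λ g → 0 :≤ g ⇒ ⊢ 0 :≤ g :+ 6) (+ g) (0≤+ g)

      A-sum : ∀ t k → 1 ≤ k → k ≤ 2 * + (2 ℕ.^ g) → Close L (A t k + A (not t) k) k
      A-sum true k 1≤k k≤ = let lo , hi = Readings.a+b≈k g k 1≤k (in-range g k k≤) in hi , lo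
      A-sum false k 1≤k k≤ = let lo , hi = Readings.a+b≈k g k 1≤k (in-range g k k≤) in
        subst (_≤ k + L) (+-comm (a k) (b k)) hi , subst (λ z → k ≤ z + L) (+-comm (a k) (b k)) lo

      -- By `A-sum` and slowness, each argument of the recursion is within L + 2 of A t k or A (not
      -- t) k, and the values move by no more. Together with the constant 0 or 1 subtracted in the
      -- recursion this gives R = 2(L + 2) + 1. The recursion starts at k = 2, so k = 1 is done from
      -- the values.
      A-rec : ∀ t k → 1 ≤ k → k ≤ 2 * + (2 ℕ.^ g) → Close R (A t k) (A (not t) (A t k) + A (not t) (A (not t)
          k))
      A-rec t k 1≤k k≤ with ≤-or-> k 1
      A-rec t k 1≤k k≤ | inj₁ k≤1 with ≤-antisym k≤1 1≤k
      ... | refl = subst₂ (λ i j → Close R i (A (not t) i + A (not t) j)) (sym (A1 t)) (sym (A1 (not t)))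
        ( (linear 2 (λ Anott1 L → Anott1 :≡ 1 ⇒ 0 :≤ L ⇒ ⊢ 1 :≤ Anott1 :+ Anott1 :+ (2 :* L :+ 5))
            (A (not t) 1) L (A1 (not t)) 0≤L)
        , (linear 2 (λ Anott1 L → Anott1 :≡ 1 ⇒ 0 :≤ L ⇒ ⊢ Anott1 :+ Anott1 :≤ 1 :+ (2 :* L :+ 5))
            (A (not t) 1) L (A1 (not t)) 0≤L) )
      A-rec true k 1≤k k≤ | inj₂ 2≤k =
          (linear 6 (λ ak bi bj bak L bbk → ak :≡ bi :+ bj :- 0 ⇒ bi :≤ bak :+ (L :+ 2) ⇒ bj :≤ bbk :+ (L :+ 2)
              ⇒ ⊢ ak :≤ bak :+ bbk :+ (2 :* L :+ 5))
              (a k) (b i) (b j) (b (a k)) L (b (b k)) (a-rec k 2≤k) (proj₁ i~) (proj₁ j~))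
        , (linear 6 (λ ak bi bj bak L bbk → ak :≡ bi :+ bj :- 0 ⇒ bak :≤ bi :+ (L :+ 2) ⇒ bbk :≤ bj :+ (L :+ 2)
            ⇒ ⊢ bak :+ bbk :≤ ak :+ (2 :* L :+ 5))
            (a k) (b i) (b j) (b (a k)) L (b (b k)) (a-rec k 2≤k) (proj₂ i~) (proj₂ j~))
        where
        i = k + 1 - b k
        j = k + 1 - a (k - 1)
        0≤e : 0 ≤ L + 2
        0≤e = linear 1 (λ L → 0 :≤ L ⇒ ⊢ 0 :≤ L :+ 2) L 0≤L
        1≤k-1 : 1 ≤ k - 1
        1≤k-1 = linear 1 (λ k → 2 :≤ k ⇒ ⊢ 1 :≤ k :- 1) k 2≤k
        back : k - 1 + 1 ≡ k
        back = linear 1 (λ k → ⊢ k :- 1 :+ 1 :≡ k) k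
        lo = proj₁ (A-step true (k - 1) 1≤k-1)
        hi = proj₂ (A-step true (k - 1) 1≤k-1)
        sm = A-sum true k 1≤k k≤
        i~ : Close (L + 2) (b i) (b (a k))
        i~ = A-near false i (a k) (L + 2) (linear 2 (λ bk k → bk :≤ k ⇒ ⊢ 1 :≤ k :+ 1 :- bk)
            (b k) k (A≤ false k 1≤k)) (1≤A true k 1≤k) 0≤e
          ( (linear 4 (λ k ak bk L → k :≤ ak :+ bk :+ L ⇒ ⊢ k :+ 1 :- bk :≤ ak :+ (L :+ 2))
              k (a k) (b k) L (proj₂ sm)) , (linear 4 (λ ak bk k L → ak :+ bk :≤ k :+ L ⇒
              ⊢ ak :≤ k :+ 1 :- bk :+ (L :+ 2)) (a k) (b k) k L (proj₁ sm)) )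
        j~ : Close (L + 2) (b j) (b (b k))
        j~ = A-near false j (b k) (L + 2) (linear 2 (λ ak1 k → ak1 :≤ k :- 1 ⇒ ⊢ 1 :≤ k :+ 1 :- ak1)
            (a (k - 1)) k (A≤ true (k - 1) 1≤k-1)) (1≤A false k 1≤k) 0≤e
          ( (linear 6 (λ k ak bk L ak11 ak1 → k :≤ ak :+ bk :+ L ⇒ ak11 :≤ ak1 :+ 1 ⇒ ak11 :≡ ak ⇒
              ⊢ k :+ 1 :- ak1 :≤ bk :+ (L :+ 2))
              k (a k) (b k) L (a (k - 1 + 1)) (a (k - 1)) (proj₂ sm) hi (cong a back))
          , (linear 6 (λ ak bk k L ak1 ak11 → ak :+ bk :≤ k :+ L ⇒ ak1 :≤ ak11 ⇒ ak11 :≡ ak ⇒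
              ⊢ bk :≤ k :+ 1 :- ak1 :+ (L :+ 2))
              (a k) (b k) k L (a (k - 1)) (a (k - 1 + 1)) (proj₁ sm) lo (cong a back)) )
      A-rec false k 1≤k k≤ | inj₂ 2≤k =
          (linear 6 (λ bk ai aj abk L aak → bk :≡ ai :+ aj :- (1 :- 0) ⇒ ai :≤ abk :+ (L :+ 2) ⇒ aj :≤ aak :+ (L
              :+ 2) ⇒ ⊢ bk :≤ abk :+ aak :+ (2 :* L :+ 5))
              (b k) (a i) (a j) (a (b k)) L (a (a k)) (b-rec k 2≤k) (proj₁ i~) (proj₁ j~))
        , (linear 6 (λ bk ai aj abk L aak → bk :≡ ai :+ aj :- (1 :- 0) ⇒ abk :≤ ai :+ (L :+ 2) ⇒ aak :≤ aj :+ (L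
            :+ 2) ⇒ ⊢ abk :+ aak :≤ bk :+ (2 :* L :+ 5))
            (b k) (a i) (a j) (a (b k)) L (a (a k)) (b-rec k 2≤k) (proj₂ i~) (proj₂ j~))
        where
        i = k - a (k - 1)
        j = k - b (k - 1)
        0≤e : 0 ≤ L + 2
        0≤e = linear 1 (λ L → 0 :≤ L ⇒ ⊢ 0 :≤ L :+ 2) L 0≤L
        1≤k-1 : 1 ≤ k - 1
        1≤k-1 = linear 1 (λ k → 2 :≤ k ⇒ ⊢ 1 :≤ k :- 1) k 2≤k
        back : k - 1 + 1 ≡ k
        back = linear 1 (λ k → ⊢ k :- 1 :+ 1 :≡ k) k
        sa = A-step true (k - 1) 1≤k-1
        sb = A-step false (k - 1) 1≤k-1
        sm = A-sum true k 1≤k k≤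
        i~ : Close (L + 2) (a i) (a (b k))
        i~ = A-near true i (b k) (L + 2) (linear 2 (λ ak1 k → ak1 :≤ k :- 1 ⇒ ⊢ 1 :≤ k :- ak1)
            (a (k - 1)) k (A≤ true (k - 1) 1≤k-1)) (1≤A false k 1≤k) 0≤e
          ( (linear 6 (λ k ak bk L ak11 ak1 → k :≤ ak :+ bk :+ L ⇒ ak11 :≤ ak1 :+ 1 ⇒ ak11 :≡ ak ⇒
              ⊢ k :- ak1 :≤ bk :+ (L :+ 2))
              k (a k) (b k) L (a (k - 1 + 1)) (a (k - 1)) (proj₂ sm) (proj₂ sa) (cong a back))
          , (linear 6 (λ ak bk k L ak1 ak11 → ak :+ bk :≤ k :+ L ⇒ ak1 :≤ ak11 ⇒ ak11 :≡ ak ⇒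
              ⊢ bk :≤ k :- ak1 :+ (L :+ 2))
              (a k) (b k) k L (a (k - 1)) (a (k - 1 + 1)) (proj₁ sm) (proj₁ sa) (cong a back)) )
        j~ : Close (L + 2) (a j) (a (a k))
        j~ = A-near true j (a k) (L + 2) (linear 2 (λ bk1 k → bk1 :≤ k :- 1 ⇒ ⊢ 1 :≤ k :- bk1)
            (b (k - 1)) k (A≤ false (k - 1) 1≤k-1)) (1≤A true k 1≤k) 0≤e
          ( (linear 6 (λ k ak bk L bk11 bk1 → k :≤ ak :+ bk :+ L ⇒ bk11 :≤ bk1 :+ 1 ⇒ bk11 :≡ bk ⇒
              ⊢ k :- bk1 :≤ ak :+ (L :+ 2))
              k (a k) (b k) L (b (k - 1 + 1)) (b (k - 1)) (proj₂ sm) (proj₂ sb) (cong b back))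
          , (linear 6 (λ ak bk k L bk1 bk11 → ak :+ bk :≤ k :+ L ⇒ bk1 :≤ bk11 ⇒ bk11 :≡ bk ⇒
              ⊢ ak :≤ k :- bk1 :+ (L :+ 2))
              (a k) (b k) k L (b (k - 1)) (b (k - 1 + 1)) (proj₁ sm) (proj₁ sb) (cong b back)) )

    -- The approximate Pascal triangle of indices

    module Descent (G : ℕ) (m : ℤ) (1≤m : 1 ≤ m) (m≤ : m ≤ 2 * + (2 ℕ.^ G)) (t : Bool) where
      ℓ ϱ : ℤ
      ℓ = L G
      ϱ = R G
      0≤ℓ : 0 ≤ ℓ
      0≤ℓ = 0≤L G
      ϱ≡ : ϱ ≡ 2 * ℓ + 5
      ϱ≡ = refl

      side : ℕ → Bool
      side zero = t
      side (suc r) = not (side r)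

      U V : ℕ → ℤ → ℤ
      U r = A (side r)
      V r = A (not (side r))

      -- Among the paths with i steps V, the one that takes all U steps first represents its class.
      -- For i > r the value is Φ r r.
      Φ : ℕ → ℕ → ℤ
      Φ zero _ = m
      Φ (suc r) zero = U r (Φ r zero)
      Φ (suc r) (suc i) = V r (Φ r i)

      1≤Φ : ∀ r i → 1 ≤ Φ r i
      1≤Φ zero i = 1≤m
      1≤Φ (suc r) zero = 1≤A (side r) _ (1≤Φ r 0)
      1≤Φ (suc r) (suc i) = 1≤A (not (side r)) _ (1≤Φ r i)

      Φ≤m : ∀ r i → Φ r i ≤ m
      Φ≤m zero i = ≤-refl
      Φ≤m (suc r) zero = ≤-trans (A≤ (side r) _ (1≤Φ r 0)) (Φ≤m r 0)
      Φ≤m (suc r) (suc i) = ≤-trans (A≤ (not (side r)) _ (1≤Φ r i)) (Φ≤m r i)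

      Φ≤ : ∀ r i → Φ r i ≤ 2 * + (2 ℕ.^ G)
      Φ≤ r i = ≤-trans (Φ≤m r i) m≤

      err : ℕ → ℤ
      err zero = 0
      err (suc r) = err r + (ℓ + ϱ)

      0≤err : ∀ r → 0 ≤ err r
      0≤err zero = ≤-refl
      0≤err (suc r) = linear 3 (λ errr ℓ ϱ → 0 :≤ errr ⇒ 0 :≤ ℓ ⇒ ϱ :≡ 2 :* ℓ :+ 5 ⇒ ⊢ 0 :≤ errr :+ (ℓ :+ ϱ))
          (err r) ℓ ϱ (0≤err r) 0≤ℓ ϱ≡

      -- This is why paths merge: up to errors, V after U equals U after V. With z = U r y, the
      -- recursion for z reads z ≈ U (suc r) z + U (suc r) (V r y), while the sum rule reads z ≈ U
      -- (suc r) z + V (suc r) z; subtracting leaves the claim. `follow` says that z may be replaced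
      -- by Φ (suc r) i.
      near : ∀ r i → i ℕ.< r → Close (err r) (V r (Φ r i)) (U r (Φ r (suc i)))
      follow : ∀ r i → i ℕ.≤ r → Close (err r) (Φ (suc r) i) (U r (Φ r i))

      follow r zero _ = trivial , trivial
        where
        trivial : U r (Φ r 0) ≤ U r (Φ r 0) + err r
        trivial = linear 2 (λ errr UrΦr0 → 0 :≤ errr ⇒ ⊢ UrΦr0 :≤ UrΦr0 :+ errr) (err r) (U r (Φ r 0)) (0≤err r)
      follow r (suc i) i<r = near r i i<r

      near (suc r) i (ℕ.s≤s i≤r) =
          (linear 8 (λ VsucrΦsucri Vsucrz errr Usucrz z ℓ UsucrVry ϱ → VsucrΦsucri :≤ Vsucrz :+ errr ⇒ Usucrz :+
              Vsucrz :≤ z :+ ℓ ⇒ z :≤ Usucrz :+ UsucrVry :+ ϱ ⇒ ⊢ VsucrΦsucri :≤ UsucrVry :+ (errr :+ (ℓ :+ ϱ)))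
              (V (suc r) (Φ (suc r) i)) (V (suc r) z) (err r) (U (suc r) z) z ℓ (U (suc r) (V r y)) ϱ (proj₁
              moved) (proj₁ sm) (proj₁ rc))
        , (linear 8 (λ Vsucrz VsucrΦsucri errr z Usucrz ℓ UsucrVry ϱ → Vsucrz :≤ VsucrΦsucri :+ errr ⇒ z :≤
            Usucrz :+ Vsucrz :+ ℓ ⇒ Usucrz :+ UsucrVry :≤ z :+ ϱ ⇒
            ⊢ UsucrVry :≤ VsucrΦsucri :+ (errr :+ (ℓ :+ ϱ)))
            (V (suc r) z) (V (suc r) (Φ (suc r) i)) (err r) z (U (suc r) z) ℓ (U (suc r) (V r y)) ϱ (proj₂
            moved) (proj₂ sm) (proj₂ rc))
        where
        y = Φ r i
        z = U r y
        1≤z : 1 ≤ z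
        1≤z = 1≤A (side r) y (1≤Φ r i)
        moved = A-near (not (side (suc r))) (Φ (suc r) i) z (err r) (1≤Φ (suc r) i) 1≤z (0≤err r) (follow r i
            i≤r)
        sm = A-sum G (side (suc r)) z 1≤z (≤-trans (A≤ (side r) y (1≤Φ r i)) (Φ≤ r i))
        rc = A-rec G (side r) y (1≤Φ r i) (Φ≤ r i)

      split : ∀ r i → i ℕ.≤ r → Close (err r + ℓ) (Φ r i) (Φ (suc r) i + Φ (suc r) (suc i))
      split r i i≤r =
          (linear 6 (λ Ury Φsucri errr y Vry ℓ → Ury :≤ Φsucri :+ errr ⇒ y :≤ Ury :+ Vry :+ ℓ ⇒
              ⊢ y :≤ Φsucri :+ Vry :+ (errr :+ ℓ))
              (U r y) (Φ (suc r) i) (err r) y (V r y) ℓ (proj₂ fo) (proj₂ sm))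
        , (linear 6 (λ Φsucri Ury errr Vry y ℓ → Φsucri :≤ Ury :+ errr ⇒ Ury :+ Vry :≤ y :+ ℓ ⇒
            ⊢ Φsucri :+ Vry :≤ y :+ (errr :+ ℓ))
            (Φ (suc r) i) (U r y) (err r) (V r y) y ℓ (proj₁ fo) (proj₁ sm))
        where
        y = Φ r i
        fo = follow r i i≤r
        sm = A-sum G (side r) y (1≤Φ r i) (Φ≤ r i)

      gap : ℕ → ℕ → ℤ
      gap r i = Φ r i - Φ r (suc i)

      split-gap : ∀ r i → i ℕ.< r → gap r i ≤ gap (suc r) i + gap (suc r) (suc i) + 2 * (err r + ℓ)
      split-gap r i i<r = linear 7 (λ Φri Φsucri Φsucrsuci errr ℓ Φsucrsucsuci Φrsuci → Φri :≤ Φsucri :+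
          Φsucrsuci :+ (errr :+ ℓ) ⇒ Φsucrsuci :+ Φsucrsucsuci :≤ Φrsuci :+ (errr :+ ℓ) ⇒
          ⊢ Φri :- Φrsuci :≤ Φsucri :- Φsucrsuci :+ (Φsucrsuci :- Φsucrsucsuci) :+ 2 :* (errr :+ ℓ))
          (Φ r i) (Φ (suc r) i) (Φ (suc r) (suc i)) (err r) ℓ (Φ (suc r) (suc (suc i))) (Φ r (suc i)) (proj₁
          (split r i (ℕₚ.<⇒≤ i<r))) (proj₂ (split r (suc i) i<r))

      -- The Φ r i decrease in i only up to the merging errors; `dip` bounds the possible rise
      -- between neighbours.
      dip : ℕ → ℤ
      dip zero = 0
      dip (suc r) = dip r + err r

      0≤dip : ∀ r → 0 ≤ dip r
      0≤dip zero = ≤-refl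
      0≤dip (suc r) = 0≤-+ (0≤dip r) (0≤err r)

      -- Slow monotone maps preserve the order and its defect. Only the left edge compares a V value
      -- with a U value, and there `near` first trades V (Φ r 0) for U (Φ r 1), at the price err r.
      decreasing : Φ 1 1 ≤ Φ 1 0 → ∀ r i → i ℕ.< r → Φ r (suc i) ≤ Φ r i + dip r
      decreasing top (suc zero) zero _ = ≤-trans top (≤-reflexive (sym (+-identityʳ _)))
      decreasing top (suc zero) (suc i) (ℕ.s≤s ())
      decreasing top (suc r@(suc r′)) zero _ =
          linear 5 (λ VrΦr0 UrΦr1 errr UrΦr0 dipr → VrΦr0 :≤ UrΦr1 :+ errr ⇒ UrΦr1 :≤ UrΦr0 :+ dipr ⇒
          ⊢ VrΦr0 :≤ UrΦr0 :+ (dipr :+ errr))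
          (V r (Φ r 0)) (U r (Φ r 1)) (err r) (U r (Φ r 0)) (dip r) (proj₁ (near r 0 (ℕ.s≤s ℕ.z≤n))) (A-close
          (side r) (Φ r 1) (Φ r 0) (dip r) (1≤Φ r 1) (1≤Φ r 0) (0≤dip r) (decreasing top r 0 (ℕ.s≤s ℕ.z≤n)))
      decreasing top (suc r@(suc r′)) (suc i) (ℕ.s≤s i<r) =
          linear 4 (λ VrΦrsuci VrΦri dipr errr → VrΦrsuci :≤ VrΦri :+ dipr ⇒ 0 :≤ errr ⇒
          ⊢ VrΦrsuci :≤ VrΦri :+ (dipr :+ errr))
          (V r (Φ r (suc i))) (V r (Φ r i)) (dip r) (err r) (A-close (not (side r)) (Φ r (suc i)) (Φ r i) (dip
          r) (1≤Φ r (suc i)) (1≤Φ r i) (0≤dip r) (decreasing top r i i<r)) (0≤err r)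

      excess : ℕ → ℤ
      excess zero = 0
      excess (suc r) = excess r + (+ G + 5)

      0≤excess : ∀ r → 0 ≤ excess r
      0≤excess zero = ≤-refl
      0≤excess (suc r) = linear 2 (λ excessr G → 0 :≤ excessr ⇒ 0 :≤ G ⇒ ⊢ 0 :≤ excessr :+ (G :+ 5))
          (excess r) (+ G) (0≤excess r) (0≤+ G)

      c-suc : ∀ g → c (suc g) ≤ 2 * c g
      c-suc g = linear 2 (λ Frameεframeg cg → 0 :≤ Frameεframeg ⇒ ⊢ 2 :* cg :- Frameεframeg :≤ 2 :* cg)
          (Frame.ε (frame g)) (c g) (Generation.0≤ε (Frame.generation (frame g)))

      -- One level of the descent is one generation down: by `A-size` an index near 2c (suc g) goes
      -- to about c (suc g) ≤ 2 * c g, up to a new excess of at most G + 5.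
      size : ∀ r g i → r ℕ.+ g ≡ G → Φ r i ≤ 2 * c g + excess r
      size zero g i refl = linear 3 (λ m x2g cg → m :≤ 2 :* x2g ⇒ 42 :* x2g :+ 1 :≤ cg ⇒ 0 :≤ x2g ⇒
          ⊢ m :≤ 2 :* cg :+ 0) m (+ (2 ℕ.^ g)) (c g) m≤ (Frame.c≥ (frame g)) (0≤+ (2 ℕ.^ g))
      size (suc r) g i eq = shrink i
        where
        eq′ : r ℕ.+ suc g ≡ G
        eq′ = trans (ℕₚ.+-suc r g) eq
        g≤G : + suc g ≤ + G
        g≤G = +≤+ (ℕₚ.≤-trans (ℕₚ.m≤n+m (suc g) r) (ℕₚ.≤-reflexive eq′))
        bound : ∀ s j → A s (Φ r j) ≤ 2 * c g + (excess r + (+ G + 5))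
        bound s j = linear 6 (λ AsΦrj csucg excessr sucg G cg → AsΦrj :≤ csucg :+ (excessr :+ sucg :+ 5) ⇒ sucg
            :≤ G ⇒ csucg :≤ 2 :* cg ⇒ ⊢ AsΦrj :≤ 2 :* cg :+ (excessr :+ (G :+ 5)))
            (A s (Φ r j)) (c (suc g)) (excess r) (+ suc g) (+ G) (c g) (A-size s (suc g) (Φ r j) (excess r) (1≤Φ
            r j) (0≤excess r) (size r (suc g) j eq′)) g≤G (c-suc g)
        shrink : ∀ i → Φ (suc r) i ≤ 2 * c g + (excess r + (+ G + 5))
        shrink zero = bound (side r) zero
        shrink (suc i) = bound (not (side r)) i

      loss : ℕ → ℤ
      loss zero = 0
      loss (suc r) = loss r + + (2 ℕ.^ r) * (2 * (err (suc r) + ℓ))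

      expand : ∀ r → gap 1 0 ≤ binomial-sum r (gap (suc r)) + loss r
      expand zero = ≤-reflexive (sym (trans (+-identityʳ _) (*-identityˡ (gap 1 0))))
      expand (suc r) = linear 5 (λ gap10 binomialsumrgapsucr lossr binomialsumsucrgapsucsucr x2rk → gap10 :≤
          binomialsumrgapsucr :+ lossr ⇒ binomialsumrgapsucr :≤ binomialsumsucrgapsucsucr :+ x2rk ⇒
          ⊢ gap10 :≤ binomialsumsucrgapsucsucr :+ (lossr :+ x2rk))
          (gap 1 0) (binomial-sum r (gap (suc r))) (loss r) (binomial-sum (suc r) (gap (suc (suc r)))) (+ (2 ℕ.^
          r) * k) (expand r) finer
        where
        k = 2 * (err (suc r) + ℓ)
        next = gap (suc (suc r))
        finer : binomial-sum r (gap (suc r)) ≤ binomial-sum (suc r) next + + (2 ℕ.^ r) * k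
        finer = ≤-trans (binomial-sum-mono r (λ i i≤r → split-gap (suc r) i (ℕ.s≤s i≤r)))
          (≤-reflexive (trans (binomial-sum-+ r (λ i → next i + next (suc i)) (λ _ → k))
            (cong₂ _+_ (pascal r next) (binomial-sum-const r k))))

      -- Raising every gap by `dip` makes the terms nonnegative, so each coefficient may be replaced
      -- by β and the remaining plain sum telescopes to the size of one index.
      gap-bound : ∀ r g β → suc r ℕ.+ g ≡ G → (∀ i → binom r i ℕ.≤ β) →
        gap 1 0 ≤ + β * (2 * c g + excess (suc r) + + suc r * dip (suc r)) + loss r
      gap-bound r g β eq C≤β with ≤-or-> (Φ 1 1) (Φ 1 0)
      -- Here the difference to be bounded is negative and the right side is not.
      ... | inj₂ up = linear 4 (λ Φ10 Φ11 βtotal lossr → Φ10 :+ 1 :≤ Φ11 ⇒ 0 :≤ βtotal ⇒ 0 :≤ lossr ⇒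
          ⊢ Φ10 :- Φ11 :≤ βtotal :+ lossr) (Φ 1 0) (Φ 1 1) (+ β * total) (loss r) up (0≤-* β 0≤total) (0≤loss r)
        where
        total = 2 * c g + excess (suc r) + + suc r * dip (suc r)
        0≤total : 0 ≤ total
        0≤total = linear 4 (λ x2g cg excesssucr sucrdipsucr → 42 :* x2g :+ 1 :≤ cg ⇒ 0 :≤ x2g ⇒ 0 :≤ excesssucr
            ⇒ 0 :≤ sucrdipsucr ⇒ ⊢ 0 :≤ 2 :* cg :+ excesssucr :+ sucrdipsucr)
            (+ (2 ℕ.^ g)) (c g) (excess (suc r)) (+ suc r * dip (suc r)) (Frame.c≥ (frame g)) (0≤+ (2 ℕ.^ g))
            (0≤excess (suc r)) (0≤-* (suc r) (0≤dip (suc r)))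
        0≤loss : ∀ r → 0 ≤ loss r
        0≤loss zero = ≤-refl
        0≤loss (suc r) = 0≤-+ (0≤loss r) (0≤-* (2 ℕ.^ r) (linear 2 (λ errsucr ℓ → 0 :≤ errsucr ⇒ 0 :≤ ℓ ⇒
            ⊢ 0 :≤ 2 :* (errsucr :+ ℓ)) (err (suc r)) ℓ (0≤err (suc r)) 0≤ℓ))
      ... | inj₁ down = linear 6 (λ gap10 binomialsumrgapsucr lossr binomialsumrraised βsumrraised βtotal →
          gap10 :≤ binomialsumrgapsucr :+ lossr ⇒ binomialsumrgapsucr :≤ binomialsumrraised ⇒ binomialsumrraised
          :≤ βsumrraised ⇒ βsumrraised :≤ βtotal ⇒ ⊢ gap10 :≤ βtotal :+ lossr)
          (gap 1 0) (binomial-sum r (gap (suc r))) (loss r) (binomial-sum r raised) (+ β * sum≤ r raised) (+ β *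
          total) (expand r) raise spread (*-monoˡ-≤-nonNeg (+ β) sum≤total)
        where
        total = 2 * c g + excess (suc r) + + suc r * dip (suc r)
        raised : ℕ → ℤ
        raised i = gap (suc r) i + dip (suc r)
        raise : binomial-sum r (gap (suc r)) ≤ binomial-sum r raised
        raise = binomial-sum-mono r (λ i _ → (linear 2 (λ dipsucr gapsucri → 0 :≤ dipsucr ⇒
            ⊢ gapsucri :≤ gapsucri :+ dipsucr) (dip (suc r)) (gap (suc r) i) (0≤dip (suc r))))
        spread : binomial-sum r raised ≤ + β * sum≤ r raised
        spread = binomial-sum-bound r β raised C≤β (λ i i≤r →
            (linear 3 (λ Φsucrsuci Φsucri dipsucr → Φsucrsuci :≤ Φsucri :+ dipsucr ⇒
            ⊢ 0 :≤ Φsucri :- Φsucrsuci :+ dipsucr)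
            (Φ (suc r) (suc i)) (Φ (suc r) i) (dip (suc r)) (decreasing down (suc r) i (ℕ.s≤s i≤r))))
        sum≡ : sum≤ r raised ≡ Φ (suc r) 0 - Φ (suc r) (suc r) + + suc r * dip (suc r)
        sum≡ = trans (sum≤-+ r (gap (suc r)) (λ _ → dip (suc r))) (cong₂ _+_ (sum≤-telescope r (Φ (suc r)))
            (sum≤-const r (dip (suc r))))
        sum≤total : sum≤ r raised ≤ total
        sum≤total = linear 6 (λ sumrraised Φsucr0 Φsucrsucr sucrdipsucr cg excesssucr → sumrraised :≡ Φsucr0 :-
            Φsucrsucr :+ sucrdipsucr ⇒ 1 :≤ Φsucrsucr ⇒ Φsucr0 :≤ 2 :* cg :+ excesssucr ⇒
            ⊢ sumrraised :≤ 2 :* cg :+ excesssucr :+ sucrdipsucr)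
            (sum≤ r raised) (Φ (suc r) 0) (Φ (suc r) (suc r)) (+ suc r * dip (suc r)) (c g) (excess (suc r))
            sum≡ (1≤Φ (suc r) (suc r)) (size (suc r) g 0 eq)

      err≡ : ∀ n → err n ≡ + n * (ℓ + ϱ)
      err≡ zero = refl
      err≡ (suc n) = trans (cong (_+ (ℓ + ϱ)) (err≡ n)) (one-more n (ℓ + ϱ))

      excess≡ : ∀ n → excess n ≡ + n * (+ G + 5)
      excess≡ zero = refl
      excess≡ (suc n) = trans (cong (_+ (+ G + 5)) (excess≡ n)) (one-more n (+ G + 5))

      err-step : ∀ n → err n ≤ err (suc n)
      err-step n = linear 3 (λ ℓ ϱ errn → 0 :≤ ℓ ⇒ ϱ :≡ 2 :* ℓ :+ 5 ⇒ ⊢ errn :≤ errn :+ (ℓ :+ ϱ))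
          ℓ ϱ (err n) 0≤ℓ ϱ≡

      dip≤ : ∀ n → dip n ≤ + n * err n
      dip≤ zero = ≤-refl
      dip≤ (suc n) = ≤-trans (+-monoˡ-≤ (err n) (dip≤ n)) (≤-trans (≤-reflexive (one-more n (err n)))
        (*-monoˡ-≤-nonNeg (+ suc n) (err-step n)))

      -- The weights 2^r double from level to level, so the sum of all losses is dominated by twice
      -- the last term.
      loss≤ : ∀ r → loss r ≤ + (2 ℕ.^ r) * (2 * (err r + ℓ))
      loss≤ zero = 0≤-* 1 (linear 1 (λ ℓ → 0 :≤ ℓ ⇒ ⊢ 0 :≤ 2 :* (0 :+ ℓ)) ℓ 0≤ℓ)
      loss≤ (suc r) = linear 4 (λ lossr x2rx x2ry x2sucry → lossr :≤ x2rx ⇒ x2rx :≤ x2ry ⇒ x2sucry :≡ x2ry :+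
          x2ry ⇒ ⊢ lossr :+ x2ry :≤ x2sucry)
          (loss r) (+ (2 ℕ.^ r) * x) (+ (2 ℕ.^ r) * y) (+ (2 ℕ.^ suc r) * y) (loss≤ r) (*-monoˡ-≤-nonNeg (+ (2
          ℕ.^ r)) x≤y) doubled
        where
        x = 2 * (err r + ℓ)
        y = 2 * (err (suc r) + ℓ)
        x≤y : x ≤ y
        x≤y = linear 3 (λ errr errsucr ℓ → errr :≤ errsucr ⇒ ⊢ 2 :* (errr :+ ℓ) :≤ 2 :* (errsucr :+ ℓ))
            (err r) (err (suc r)) ℓ (err-step r)
        twice : ∀ p y → 2 * p * y ≡ p * y + p * y
        twice = solve-∀
        doubled : + (2 ℕ.^ suc r) * y ≡ + (2 ℕ.^ r) * y + + (2 ℕ.^ r) * y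
        doubled = trans (cong (_* y) (2^suc r)) (twice (+ (2 ℕ.^ r)) y)

  -- The estimate

  *-mono-≤-nonNeg : ∀ {i j k l} → 0 ≤ i → i ≤ j → 0 ≤ k → k ≤ l → i * k ≤ j * l
  *-mono-≤-nonNeg {i} {j} {k} {l} 0≤i i≤j 0≤k k≤l = ≤-trans
    (*-monoʳ-≤-nonNeg k {{nonNegative 0≤k}} i≤j) (*-monoˡ-≤-nonNeg j {{nonNegative (≤-trans 0≤i i≤j)}} k≤l)

  2^-+ : ∀ m n → + (2 ℕ.^ (m ℕ.+ n)) ≡ + (2 ℕ.^ m) * + (2 ℕ.^ n)
  2^-+ m n = trans (cong +_ (ℕₚ.^-distribˡ-+-* 2 m n)) (pos-* (2 ℕ.^ m) (2 ℕ.^ n))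

  -- Choice of the depth and the error budget

  module Numerics (f : ℕ → ℤ) (isQ : IsQtilde f) (G μ : ℕ) (1≤G : 1 ℕ.≤ G)
    (8μ≤G : 8 ℕ.* μ ℕ.≤ G) (G≤ : G ℕ.≤ 7 ℕ.+ 8 ℕ.* μ) (β : ℕ) (bb : BinomBound μ β) where
    open Halves f isQ
    open Frames f isQ
    open Pascal f isQ

    M P M₂ M₄ : ℤ
    M = + (2 ℕ.^ μ)
    P = + (2 ℕ.^ G)
    M₂ = M * M
    M₄ = M₂ * M₂

    r g : ℕ
    r = μ ℕ.+ μ
    g = G ℕ.∸ suc r

    -- The descent uses r + 1 = 2μ + 1 levels. For μ = 0 this is still one level, which 1 ≤ G pays
    -- for; otherwise 8μ does.
    r<G : suc r ℕ.≤ G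
    r<G = case μ 8μ≤G
      where
      case : ∀ μ → 8 ℕ.* μ ℕ.≤ G → suc (μ ℕ.+ μ) ℕ.≤ G
      case zero _ = 1≤G
      case (suc μ) h = ℕₚ.≤-trans (ℕₚ.≤-trans (ℕₚ.m≤m+n _ (5 ℕ.+ 6 ℕ.* μ)) (ℕₚ.≤-reflexive (count μ))) h
        where
        count : ∀ μ → suc (suc μ ℕ.+ suc μ) ℕ.+ (5 ℕ.+ 6 ℕ.* μ) ≡ 8 ℕ.* suc μ
        count = ℕsolve-∀

    r+g≡G : suc r ℕ.+ g ≡ G
    r+g≡G = ℕₚ.m+[n∸m]≡n r<G

    μ<M : + μ + 1 ≤ M
    μ<M = n<2^n μ

    0≤μ : 0 ≤ + μ
    0≤μ = 0≤+ μ

    1≤M : 1 ≤ M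
    1≤M = linear 2 (λ μ M → 0 :≤ μ ⇒ μ :+ 1 :≤ M ⇒ ⊢ 1 :≤ M) (+ μ) M 0≤μ μ<M

    0≤M : 0 ≤ M
    0≤M = 0≤+ _

    G≤ℤ : + G ≤ 7 + 8 * + μ
    G≤ℤ = ≤-trans (+≤+ G≤) (≤-reflexive (trans (pos-+ 7 (8 ℕ.* μ)) (cong (λ z → 7 + z) (pos-* 8 μ))))

    n≤2M : + suc r ≤ 2 * M
    n≤2M = linear 3 (λ sucr μ M → sucr :≡ μ :+ μ :+ 1 ⇒ μ :+ 1 :≤ M ⇒ ⊢ sucr :≤ 2 :* M)
        (+ suc r) (+ μ) M suc≡ μ<M
      where
      suc≡ : + suc r ≡ + μ + + μ + 1
      suc≡ = cong +_ (ℕₚ.+-comm 1 r)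

    P≡ : P ≡ 2 * (M₂ * + (2 ℕ.^ g))
    P≡ = trans (cong (λ n → + (2 ℕ.^ n)) (sym r+g≡G)) (trans (2^-+ (suc r) g)
      (trans (cong (_* + (2 ℕ.^ g)) (trans (2^suc r) (cong (2 *_) (2^-+ μ μ)))) (*-assoc 2 M₂ (+ (2 ℕ.^ g)))))

    M₂≡ : + (2 ℕ.^ r) ≡ M₂
    M₂≡ = 2^-+ μ μ

    0≤M₂ : 0 ≤ M₂
    0≤M₂ = 0≤-* (2 ℕ.^ μ) 0≤M

    M≤M₂ : M ≤ M₂
    M≤M₂ = subst (_≤ M₂) (*-identityʳ M) (*-monoˡ-≤-nonNeg M 1≤M)

    M₂≤M₄ : M₂ ≤ M₄
    M₂≤M₄ = subst (_≤ M₄) (*-identityʳ M₂) (*-monoˡ-≤-nonNeg M₂ {{nonNegative 0≤M₂}} (≤-trans 1≤M M≤M₂))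

    -- The whole budget: the errors reach M₄, they get multiplied by M₂ = 2^r, and 6μ ≤ 8μ ≤ G.
    M₆≤P : M₂ * M₄ ≤ P
    M₆≤P = subst (_≤ P) six (+≤+ (ℕₚ.^-monoʳ-≤ 2 (ℕₚ.≤-trans (ℕₚ.≤-trans (ℕₚ.m≤m+n (r ℕ.+ (r ℕ.+ r)) (μ ℕ.+ μ))
        (ℕₚ.≤-reflexive (count μ))) 8μ≤G)))
      where
      count : ∀ μ → (μ ℕ.+ μ) ℕ.+ ((μ ℕ.+ μ) ℕ.+ (μ ℕ.+ μ)) ℕ.+ (μ ℕ.+ μ) ≡ 8 ℕ.* μ
      count = ℕsolve-∀
      six : + (2 ℕ.^ ((μ ℕ.+ μ) ℕ.+ ((μ ℕ.+ μ) ℕ.+ (μ ℕ.+ μ)))) ≡ M₂ * M₄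
      six = trans (2^-+ r (r ℕ.+ r)) (cong₂ _*_ M₂≡ (trans (2^-+ r r) (cong₂ _*_ M₂≡ M₂≡)))

    1≤β : 1 ≤ + β
    1≤β = +≤+ (proj₁ bb 0)

    P≤βP : P ≤ + β * P
    P≤βP = subst (_≤ + β * P) (*-identityˡ P) (*-monoʳ-≤-nonNeg P 1≤β)

    module _ (k : ℤ) (1≤k : 1 ≤ k) (k≤ : k ≤ 2 * + (2 ℕ.^ G)) where

      module _ (t : Bool) where
        open Descent G k 1≤k k≤ t

        -- From G + 6 ≤ 13 + 8μ ≤ 13(μ + 1) and μ + 1 ≤ 2^μ. Trading each logarithm for a factor M
        -- makes all error terms monomials in M.
        ℓ≤ : ℓ ≤ 13 * M
        ℓ≤ = linear 3 (λ G μ M → G :≤ 7 :+ 8 :* μ ⇒ μ :+ 1 :≤ M ⇒ 0 :≤ μ ⇒ ⊢ G :+ 6 :≤ 13 :* M)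
            (+ G) (+ μ) M G≤ℤ μ<M 0≤μ

        ℓ+ϱ≤ : ℓ + ϱ ≤ 44 * M
        ℓ+ϱ≤ = linear 5 (λ ϱ ℓ G μ M → ϱ :≡ 2 :* ℓ :+ 5 ⇒ ℓ :≡ G :+ 6 ⇒ G :≤ 7 :+ 8 :* μ ⇒ μ :+ 1 :≤ M ⇒ 0 :≤ μ
            ⇒ ⊢ ℓ :+ ϱ :≤ 44 :* M) ϱ ℓ (+ G) (+ μ) M ϱ≡ ℓ≡ G≤ℤ μ<M 0≤μ
          where
          ℓ≡ : ℓ ≡ + G + 6
          ℓ≡ = refl

        0≤ℓ+ϱ : 0 ≤ ℓ + ϱ
        0≤ℓ+ϱ = linear 2 (λ ℓ ϱ → 0 :≤ ℓ ⇒ ϱ :≡ 2 :* ℓ :+ 5 ⇒ ⊢ 0 :≤ ℓ :+ ϱ) ℓ ϱ 0≤ℓ ϱ≡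

        err≤ : err (suc r) ≤ 88 * M₂
        err≤ = ≤-trans (≤-reflexive (err≡ (suc r))) (≤-trans (*-mono-≤-nonNeg (0≤+ _) n≤2M 0≤ℓ+ϱ ℓ+ϱ≤)
            (≤-reflexive (flatten M)))
          where
          flatten : ∀ M → 2 * M * (44 * M) ≡ 88 * (M * M)
          flatten = solve-∀

        n*dip≤ : + suc r * dip (suc r) ≤ 352 * M₄
        n*dip≤ = ≤-trans (*-mono-≤-nonNeg (0≤+ _) n≤2M (0≤dip (suc r)) (≤-trans (dip≤ (suc r)) (*-mono-≤-nonNeg
            (0≤+ _) n≤2M (0≤err (suc r)) err≤)))
          (≤-reflexive (flatten M))
          where
          flatten : ∀ M → 2 * M * (2 * M * (88 * (M * M))) ≡ 352 * (M * M * (M * M))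
          flatten = solve-∀

        excess≤ : excess (suc r) ≤ 24 * M₂
        excess≤ = ≤-trans (≤-reflexive (excess≡ (suc r))) (≤-trans (*-mono-≤-nonNeg (0≤+ _) n≤2M
          (linear 1 (λ G → 0 :≤ G ⇒ ⊢ 0 :≤ G :+ 5) (+ G) (0≤+ G))
          (linear 3 (λ G μ M → G :≤ 7 :+ 8 :* μ ⇒ μ :+ 1 :≤ M ⇒ 0 :≤ μ ⇒ ⊢ G :+ 5 :≤ 12 :* M)
              (+ G) (+ μ) M G≤ℤ μ<M 0≤μ)) (≤-reflexive (flatten M)))
          where
          flatten : ∀ M → 2 * M * (12 * M) ≡ 24 * (M * M)
          flatten = solve-∀

        loss-bound : loss r ≤ 202 * M₄
        loss-bound = ≤-trans (loss≤ r) (≤-trans (≤-reflexive (cong (_* (2 * (err r + ℓ))) M₂≡))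
          (≤-trans (*-monoˡ-≤-nonNeg M₂ {{nonNegative 0≤M₂}} inner) (≤-reflexive (flatten M₂))))
          where
          inner : 2 * (err r + ℓ) ≤ 202 * M₂
          inner = linear 5 (λ errr errsucr M₂ ℓ M → errr :≤ errsucr ⇒ errsucr :≤ 88 :* M₂ ⇒ ℓ :≤ 13 :* M ⇒ M :≤
              M₂ ⇒ ⊢ 2 :* (errr :+ ℓ) :≤ 202 :* M₂) (err r) (err (suc r)) M₂ ℓ M (err-step r) err≤ ℓ≤ M≤M₂
          flatten : ∀ N → N * (202 * N) ≡ 202 * (N * N)
          flatten = solve-∀

        -- Since P = 2 M₂ 2^g, the main term 86 · 2^g contributes 43P. The remaining coefficients
        -- are 376 = 352 + 24 inside the bracket and 202 for the loss, each on M₂ M₄ ≤ P, and 43 +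
        -- 376 + 202 = 621. The loss carries no β, but β ≥ 1.
        gap-small : M₂ * (A t k - A (not t) k) ≤ 621 * (+ β * P)
        gap-small = ≤-trans (*-monoˡ-≤-nonNeg M₂ {{nonNegative 0≤M₂}} (gap-bound r g β r+g≡G (proj₁ bb)))
          (≤-trans (≤-reflexive (distribute M₂ (+ β) total (loss r)))
            (linear 5 (λ βM₂total β419P M₂loss P βP → βM₂total :≤ β419P ⇒ M₂loss :≤ 202 :* P ⇒ P :≤ βP ⇒ β419P
                :≡ 419 :* (βP) ⇒ ⊢ βM₂total :+ M₂loss :≤ 621 :* (βP))
                (+ β * (M₂ * total)) (+ β * (419 * P)) M₂*loss P (+ β * P) (*-monoˡ-≤-nonNeg (+ β) M₂*total≤)
                M₂*loss≤ P≤βP (flatten (+ β) P)))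
          where
          total = 2 * c g + excess (suc r) + + suc r * dip (suc r)
          M₂*loss = M₂ * loss r
          distribute : ∀ m b x y → m * (b * x + y) ≡ b * (m * x) + m * y
          distribute = solve-∀
          flatten : ∀ b p → b * (419 * p) ≡ 419 * (b * p)
          flatten = solve-∀
          scale : ∀ m x → m * (202 * x) ≡ 202 * (m * x)
          scale = solve-∀
          M₂*loss≤ : M₂*loss ≤ 202 * P
          M₂*loss≤ = ≤-trans (*-monoˡ-≤-nonNeg M₂ {{nonNegative 0≤M₂}} loss-bound)
            (≤-trans (≤-reflexive (scale M₂ M₄)) (*-monoˡ-≤-nonNeg 202 M₆≤P))
          total≤ : total ≤ 86 * + (2 ℕ.^ g) + 376 * M₄
          total≤ = linear 6 (λ cg x2g excesssucr M₂ sucrdipsucr M₄ → cg :≤ 43 :* x2g ⇒ excesssucr :≤ 24 :* M₂ ⇒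
              sucrdipsucr :≤ 352 :* M₄ ⇒ M₂ :≤ M₄ ⇒
              ⊢ 2 :* cg :+ excesssucr :+ sucrdipsucr :≤ 86 :* x2g :+ 376 :* M₄)
              (c g) (+ (2 ℕ.^ g)) (excess (suc r)) M₂ (+ suc r * dip (suc r)) M₄ (Frame.c≤ (frame g)) excess≤
              n*dip≤ M₂≤M₄
          expand-total : ∀ m p q → m * (86 * p + 376 * q) ≡ 43 * (2 * (m * p)) + 376 * (m * q)
          expand-total = solve-∀
          M₂*total≤ : M₂ * total ≤ 419 * P
          M₂*total≤ = ≤-trans (*-monoˡ-≤-nonNeg M₂ {{nonNegative 0≤M₂}} total≤)
            (≤-trans (≤-reflexive (trans (expand-total M₂ (+ (2 ℕ.^ g)) M₄) (cong (λ z → 43 * z + 376 * (M₂ *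
                M₄)) (sym P≡))))
              (linear 2 (λ M₆ P → M₆ :≤ P ⇒ ⊢ 43 :* P :+ 376 :* M₆ :≤ 419 :* P) M₆ P M₆≤P))
            where
            M₆ = M₂ * M₄

      -- Here w = 2 f(n) − n, with (t , e) = (true , 2) for n = 2k and (false , 1) for n = 2k − 1.
      near-half : ∀ w e → 0 ≤ e → e ≤ 2 → (Σ Bool λ t → w ≡ 2 * (A t k - A (not t) k) + 2 * (A t k + A (not t) k
          - k) - e) →
        M₂ * + ∣ w ∣ ≤ 1272 * (+ β * P)
      near-half w e 0≤e e≤2 (t , w≡) = absolute w up down
        where
        x y s : ℤ
        x = A t k
        y = A (not t) k
        s = x + y - k
        sm = A-sum G t k 1≤k k≤
        L≤ : L G ≤ 13 * M
        L≤ = linear 3 (λ G μ M → G :≤ 7 :+ 8 :* μ ⇒ μ :+ 1 :≤ M ⇒ 0 :≤ μ ⇒ ⊢ G :+ 6 :≤ 13 :* M)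
            (+ G) (+ μ) M G≤ℤ μ<M 0≤μ
        absolute : ∀ w {b} → M₂ * w ≤ b → M₂ * (- w) ≤ b → M₂ * + ∣ w ∣ ≤ b
        absolute (+ _) p _ = p
        absolute -[1+ _ ] _ q = q
        -- Here 28 = 2·13 + 2: twice the defect of the sum rule, and e ≤ 2 ≤ 2M.
        rest : M₂ * (28 * M) ≤ 28 * P
        rest = ≤-trans (≤-reflexive (flat M₂ M)) (*-monoˡ-≤-nonNeg 28 (≤-trans (*-monoˡ-≤-nonNeg M₂
            {{nonNegative 0≤M₂}} (≤-trans M≤M₂ M₂≤M₄)) M₆≤P))
          where
          flat : ∀ m x → m * (28 * x) ≡ 28 * (m * x)
          flat = solve-∀
        -- Twice 621 plus the 28 of `rest` is 1270, which stays below 1272.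
        scaled : ∀ z v → z ≤ 2 * v + 28 * M → M₂ * v ≤ 621 * (+ β * P) → M₂ * z ≤ 1272 * (+ β * P)
        scaled z v z≤ v≤ = ≤-trans (*-monoˡ-≤-nonNeg M₂ {{nonNegative 0≤M₂}} z≤) (≤-trans (≤-reflexive (distr M₂
            v (28 * M)))
          (linear 4 (λ M₂v βP M₂M P → M₂v :≤ 621 :* (βP) ⇒ M₂M :≤ 28 :* P ⇒ P :≤ βP ⇒ 0 :≤ βP ⇒
              ⊢ 2 :* M₂v :+ M₂M :≤ 1272 :* (βP)) M₂v (+ β * P) M₂M P v≤ rest P≤βP (0≤-* β (0≤+ (2 ℕ.^ G)))))
          where
          M₂v = M₂ * v
          M₂M = M₂ * (28 * M)
          distr : ∀ m v q → m * (2 * v + q) ≡ 2 * (m * v) + m * q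
          distr = solve-∀
        up : M₂ * w ≤ 1272 * (+ β * P)
        up = scaled w (x - y) (linear 7 (λ w x y k e LG M → w :≡ 2 :* (x :- y) :+ 2 :* (x :+ y :- k) :- e ⇒ 0 :≤
            e ⇒ x :+ y :≤ k :+ LG ⇒ LG :≤ 13 :* M ⇒ 0 :≤ M ⇒ ⊢ w :≤ 2 :* (x :- y) :+ 28 :* M)
            w x y k e (L G) M w≡ 0≤e (proj₁ sm) L≤ 0≤M) (gap-small t)
        flip : A (not t) k - A (not (not t)) k ≡ y - x
        flip = cong (λ z → A (not t) k - A z k) (notnot t)
          where
          notnot : ∀ t → not (not t) ≡ t
          notnot true = refl
          notnot false = refl
        down : M₂ * (- w) ≤ 1272 * (+ β * P)
        down = scaled (- w) (y - x) minus (subst (λ z → M₂ * z ≤ 621 * (+ β * P)) flip (gap-small (not t)))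
          where
          minus : - w ≤ 2 * (y - x) + 28 * M
          minus = ≤-trans (≤-reflexive (sym (+-identityˡ (- w))))
            (linear 7 (λ w x y k e LG M → w :≡ 2 :* (x :- y) :+ 2 :* (x :+ y :- k) :- e ⇒ e :≤ 2 ⇒ k :≤ x :+ y
                :+ LG ⇒ LG :≤ 13 :* M ⇒ 1 :≤ M ⇒ ⊢ 0 :- w :≤ 2 :* (y :- x) :+ 28 :* M)
                w x y k e (L G) M w≡ e≤2 (proj₂ sm) L≤ 1≤M)

  -- Binary logarithm, parity, and the estimate for a single n

  2^⌊log₂⌋≤ : ∀ n → 1 ℕ.≤ n → 2 ℕ.^ ⌊log₂ n ⌋ ℕ.≤ n
  2^⌊log₂⌋≤ = <-rec (λ n → 1 ℕ.≤ n → 2 ℕ.^ ⌊log₂ n ⌋ ℕ.≤ n) go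
    where
    go : ∀ n → (∀ {m} → m ℕ.< n → 1 ℕ.≤ m → 2 ℕ.^ ⌊log₂ m ⌋ ℕ.≤ m) → 1 ℕ.≤ n → 2 ℕ.^ ⌊log₂ n ⌋ ℕ.≤ n
    go 1 _ _ = ℕₚ.≤-refl
    go n@(suc (suc k)) ih _ = begin
      2 ℕ.^ ⌊log₂ n ⌋           ≡⟨ cong (2 ℕ.^_) (sym (ℕₚ.m+[n∸m]≡n 1≤log)) ⟩
      2 ℕ.* 2 ℕ.^ (⌊log₂ n ⌋ ℕ.∸ 1) ≡⟨ cong (λ e → 2 ℕ.* 2 ℕ.^ e) (sym (⌊log₂⌊n/2⌋⌋≡⌊log₂n⌋∸1 n)) ⟩
      2 ℕ.* 2 ℕ.^ ⌊log₂ half ⌋  ≤⟨ ℕₚ.*-monoʳ-≤ 2 (ih (ℕₚ.⌊n/2⌋<n (suc k)) (ℕ.s≤s ℕ.z≤n)) ⟩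
      2 ℕ.* half                ≡⟨ cong (half ℕ.+_) (ℕₚ.+-identityʳ half) ⟩
      half ℕ.+ half             ≤⟨ ℕₚ.+-monoʳ-≤ half (ℕₚ.⌊n/2⌋≤⌈n/2⌉ n) ⟩
      half ℕ.+ ℕ.⌈ n /2⌉        ≡⟨ ℕₚ.⌊n/2⌋+⌈n/2⌉≡n n ⟩
      n                         ∎
      where
      open ℕₚ.≤-Reasoning
      half = ℕ.⌊ n /2⌋
      1≤log : 1 ℕ.≤ ⌊log₂ n ⌋
      1≤log = ⌊log₂⌋-mono-≤ {2} {n} (ℕ.s≤s (ℕ.s≤s ℕ.z≤n))

  <2^1+⌊log₂⌋ : ∀ n → n ℕ.< 2 ℕ.^ suc ⌊log₂ n ⌋
  <2^1+⌊log₂⌋ n with n ℕₚ.<? 2 ℕ.^ suc ⌊log₂ n ⌋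
  ... | yes h = h
  ... | no ¬h = ⊥-elim (ℕₚ.<-irrefl refl (ℕₚ.≤-trans
    (ℕₚ.≤-reflexive (sym (⌊log₂[2^n]⌋≡n (suc ⌊log₂ n ⌋)))) (⌊log₂⌋-mono-≤ (ℕₚ.≮⇒≥ ¬h))))

  even-or-odd : ∀ n → Σ ℤ λ k → + n ≡ 2 * k ⊎ + n ≡ 2 * k - 1
  even-or-odd zero = 0 , inj₁ refl
  even-or-odd (suc n) with even-or-odd n
  ... | k , inj₁ e = k + 1 , inj₂ (trans (cong +_ (ℕₚ.+-comm 1 n)) (linear 2 (λ n k → n :≡ 2 :* k ⇒
      ⊢ n :+ 1 :≡ 2 :* (k :+ 1) :- 1) (+ n) k e))
  ... | k , inj₂ e = k , inj₁ (trans (cong +_ (ℕₚ.+-comm 1 n)) (linear 2 (λ n k → n :≡ 2 :* k :- 1 ⇒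
      ⊢ n :+ 1 :≡ 2 :* k) (+ n) k e))

  record Estimate (f : ℕ → ℤ) (n K : ℕ) : Set where
    field
      μ β : ℕ
      binomBound : BinomBound μ β
      log≤ : ⌊log₂ n ⌋ ℕ.≤ 7 ℕ.+ 8 ℕ.* μ
      deviation : + (2 ℕ.^ μ) * + (2 ℕ.^ μ) * + ∣ + 2 * f n - + n ∣ ≤ + K * (+ β * + (2 ℕ.^ ⌊log₂ n ⌋))

  estimate : (f : ℕ → ℤ) → IsQtilde f → ∀ n → 2 ℕ.≤ n → Estimate f n 1272
  estimate f isQ n 2≤n = record { μ = G / 8 ; β = proj₁ (binom-bound (G / 8)) ; binomBound = proj₂ (binom-bound
      (G / 8))
    ; log≤ = G≤ ; deviation = D-bound (G / 8) 8μ≤G G≤ (proj₁ (binom-bound (G / 8))) (proj₂ (binom-bound (G /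
        8))) }
    where
    open Halves f isQ
    open Frames f isQ
    G = ⌊log₂ n ⌋
    8μ≤G : 8 ℕ.* (G / 8) ℕ.≤ G
    8μ≤G = ℕₚ.≤-trans (ℕₚ.≤-reflexive (ℕₚ.*-comm 8 (G / 8))) (m/n*n≤m G 8)
    G≤ : G ℕ.≤ 7 ℕ.+ 8 ℕ.* (G / 8)
    G≤ = ℕₚ.≤-trans (ℕₚ.≤-reflexive (m≡m%n+[m/n]*n G 8))
      (ℕₚ.+-mono-≤ (ℕₚ.≤-pred (m%n<n G 8)) (ℕₚ.≤-reflexive (ℕₚ.*-comm (G / 8) 8)))
    n<2P : + n + 1 ≤ 2 * + (2 ℕ.^ G)
    n<2P = ≤-trans (≤-reflexive (cong +_ (ℕₚ.+-comm n 1))) (≤-trans (+≤+ (<2^1+⌊log₂⌋ n)) (≤-reflexive (2^suc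
        G)))
    2≤nℤ : 2 ≤ + n
    2≤nℤ = +≤+ 2≤n
    fn≡ : f n ≡ 2 * h (+ n) - 1
    fn≡ = f≡2h-1 (+ n) (+≤+ (ℕₚ.≤-trans (ℕ.s≤s ℕ.z≤n) 2≤n))
    D-bound : ∀ μ → 8 ℕ.* μ ℕ.≤ G → G ℕ.≤ 7 ℕ.+ 8 ℕ.* μ → ∀ β → BinomBound μ β →
      + (2 ℕ.^ μ) * + (2 ℕ.^ μ) * + ∣ + 2 * f n - + n ∣ ≤ + 1272 * (+ β * + (2 ℕ.^ G))
    D-bound μ 8μ≤G G≤ β bb with even-or-odd n
    ... | k , inj₁ e = near-half k (linear 2 (λ n k → n :≡ 2 :* k ⇒ 2 :≤ n ⇒ ⊢ 1 :≤ k) (+ n) k e 2≤nℤ)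
        (linear 3 (λ n k x2G → n :≡ 2 :* k ⇒ n :+ 1 :≤ 2 :* x2G ⇒ 2 :≤ n ⇒ ⊢ k :≤ 2 :* x2G)
        (+ n) k (+ (2 ℕ.^ G)) e n<2P 2≤nℤ)
      (+ 2 * f n - + n) 2 (+≤+ ℕ.z≤n) ≤-refl
      (true , (linear 6 (λ n k fn hn ak bk → n :≡ 2 :* k ⇒ fn :≡ 2 :* hn :- 1 ⇒ hn :≡ ak ⇒
          ⊢ 2 :* fn :- n :≡ 2 :* (ak :- bk) :+ 2 :* (ak :+ bk :- k) :- 2)
          (+ n) k (f n) (h (+ n)) (a k) (b k) e fn≡ (cong h e)))
      where open Numerics f isQ G μ (⌊log₂⌋-mono-≤ {2} {n} 2≤n) 8μ≤G G≤ β bb using (near-half)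
    ... | k , inj₂ e = near-half k (linear 2 (λ n k → n :≡ 2 :* k :- 1 ⇒ 2 :≤ n ⇒ ⊢ 1 :≤ k) (+ n) k e 2≤nℤ)
        (linear 3 (λ n k x2G → n :≡ 2 :* k :- 1 ⇒ n :+ 1 :≤ 2 :* x2G ⇒ 2 :≤ n ⇒ ⊢ k :≤ 2 :* x2G)
        (+ n) k (+ (2 ℕ.^ G)) e n<2P 2≤nℤ)
      (+ 2 * f n - + n) 1 (+≤+ ℕ.z≤n) (+≤+ (ℕ.s≤s ℕ.z≤n))
      (false , (linear 6 (λ n k fn hn bk ak → n :≡ 2 :* k :- 1 ⇒ fn :≡ 2 :* hn :- 1 ⇒ hn :≡ bk ⇒
          ⊢ 2 :* fn :- n :≡ 2 :* (bk :- ak) :+ 2 :* (bk :+ ak :- k) :- 1)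
          (+ n) k (f n) (h (+ n)) (b k) (a k) e fn≡ (cong h e)))
      where open Numerics f isQ G μ (⌊log₂⌋-mono-≤ {2} {n} 2≤n) 8μ≤G G≤ β bb using (near-half)

  -- Squaring the deviation and multiplying by G gives (Kβp)² G. Here G ≤ 8(2μ + 1) is where the
  -- depth, proportional to the logarithm, pays off: (2μ + 1)β² ≤ 16^μ = q⁴ then cancels the scaling
  -- on the left, leaving 8K²p² with p ≤ n.
  square-bound : ∀ q D G K β p μ n → 16 ℕ.^ μ ≡ q ℕ.* q ℕ.* (q ℕ.* q) → q ℕ.* q ℕ.* D ℕ.≤ K ℕ.* (β ℕ.* p) →
    G ℕ.≤ 7 ℕ.+ 8 ℕ.* μ → suc (μ ℕ.+ μ) ℕ.* (β ℕ.* β) ℕ.≤ 16 ℕ.^ μ → p ℕ.≤ n → D ℕ.^ 2 ℕ.* G ℕ.≤ 8 ℕ.* (K ℕ.* K)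
        ℕ.* n ℕ.^ 2
  square-bound q D G K β p μ n 16^μ≡ D≤ G≤ β²≤ p≤n = ℕₚ.*-cancelˡ-≤ (16 ℕ.^ μ) {{ℕₚ.m^n≢0 16 μ}} (begin
      16 ℕ.^ μ ℕ.* (D ℕ.^ 2 ℕ.* G)                ≡⟨ cong (ℕ._* (D ℕ.^ 2 ℕ.* G)) 16^μ≡ ⟩
      q ℕ.* q ℕ.* (q ℕ.* q) ℕ.* (D ℕ.^ 2 ℕ.* G)   ≡⟨ shuffle q D G ⟩
      (q ℕ.* q ℕ.* D) ℕ.* (q ℕ.* q ℕ.* D) ℕ.* G   ≤⟨ ℕₚ.*-mono-≤ (ℕₚ.*-mono-≤ D≤ D≤) G≤8[2μ+1] ⟩
      (K ℕ.* (β ℕ.* p)) ℕ.* (K ℕ.* (β ℕ.* p)) ℕ.* (8 ℕ.* suc (μ ℕ.+ μ)) ≡⟨ shuffle′ K β p (suc (μ ℕ.+ μ)) ⟩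
      (suc (μ ℕ.+ μ) ℕ.* (β ℕ.* β)) ℕ.* (8 ℕ.* (K ℕ.* K) ℕ.* (p ℕ.* p))
        ≤⟨ ℕₚ.*-mono-≤ β²≤ (ℕₚ.*-monoʳ-≤ (8 ℕ.* (K ℕ.* K)) (ℕₚ.*-mono-≤ p≤n p≤n)) ⟩
      16 ℕ.^ μ ℕ.* (8 ℕ.* (K ℕ.* K) ℕ.* (n ℕ.* n)) ≡⟨ cong (λ z → 16 ℕ.^ μ ℕ.* (8 ℕ.* (K ℕ.* K) ℕ.* (n ℕ.* z)))
          (sym (ℕₚ.*-identityʳ n)) ⟩
      16 ℕ.^ μ ℕ.* (8 ℕ.* (K ℕ.* K) ℕ.* n ℕ.^ 2)   ∎)
    where
    open ℕₚ.≤-Reasoning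
    G≤8[2μ+1] : G ℕ.≤ 8 ℕ.* suc (μ ℕ.+ μ)
    G≤8[2μ+1] = ℕₚ.≤-trans G≤ (ℕₚ.≤-trans (ℕₚ.m≤m+n _ (1 ℕ.+ 8 ℕ.* μ)) (ℕₚ.≤-reflexive (count μ)))
      where
      count : ∀ μ → 7 ℕ.+ 8 ℕ.* μ ℕ.+ (1 ℕ.+ 8 ℕ.* μ) ≡ 8 ℕ.* suc (μ ℕ.+ μ)
      count = ℕsolve-∀
    shuffle : ∀ q D G → q ℕ.* q ℕ.* (q ℕ.* q) ℕ.* (D ℕ.* (D ℕ.* 1) ℕ.* G) ≡ (q ℕ.* q ℕ.* D) ℕ.* (q ℕ.* q ℕ.* D)
        ℕ.* G
    shuffle = ℕsolve-∀
    shuffle′ : ∀ K β p s → (K ℕ.* (β ℕ.* p)) ℕ.* (K ℕ.* (β ℕ.* p)) ℕ.* (8 ℕ.* s) ≡ (s ℕ.* (β ℕ.* β)) ℕ.* (8 ℕ.*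
        (K ℕ.* K) ℕ.* (p ℕ.* p))
    shuffle′ = ℕsolve-∀

  16^≡ : ∀ μ → 16 ℕ.^ μ ≡ 2 ℕ.^ μ ℕ.* 2 ℕ.^ μ ℕ.* (2 ℕ.^ μ ℕ.* 2 ℕ.^ μ)
  16^≡ μ = trans (ℕₚ.^-*-assoc 2 4 μ) (trans (cong (2 ℕ.^_) (quadruple μ))
    (trans (ℕₚ.^-distribˡ-+-* 2 (μ ℕ.+ μ) (μ ℕ.+ μ)) (cong₂ ℕ._*_ (ℕₚ.^-distribˡ-+-* 2 μ μ) (ℕₚ.^-distribˡ-+-* 2
        μ μ))))
    where
    quadruple : ∀ μ → 4 ℕ.* μ ≡ (μ ℕ.+ μ) ℕ.+ (μ ℕ.+ μ)
    quadruple = ℕsolve-∀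

  to-ℕ : ∀ q D K β p → + q * + q * + D ≤ + K * (+ β * + p) → q ℕ.* q ℕ.* D ℕ.≤ K ℕ.* (β ℕ.* p)
  to-ℕ q D K β p h = drop‿+≤+ (subst₂ _≤_
    (trans (cong (_* + D) (sym (pos-* q q))) (sym (pos-* (q ℕ.* q) D)))
    (trans (cong (+ K *_) (sym (pos-* β p))) (sym (pos-* K (β ℕ.* p)))) h)

  conclude : ∀ (f : ℕ → ℤ) K → (∀ n → 2 ℕ.≤ n → Estimate f n K) →
    ∃₂ λ (C N : ℕ) → ∀ n → N ℕ.≤ n → (∣ (+ 2) * f n - + n ∣ ℕ.^ 2) ℕ.* ⌊log₂ n ⌋ ℕ.≤ C ℕ.* (n ℕ.^ 2)
  conclude f K est = 8 ℕ.* (K ℕ.* K) , 2 , bound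
    where
    bound : ∀ n → 2 ℕ.≤ n → (∣ (+ 2) * f n - + n ∣ ℕ.^ 2) ℕ.* ⌊log₂ n ⌋ ℕ.≤ 8 ℕ.* (K ℕ.* K) ℕ.* (n ℕ.^ 2)
    bound n 2≤n = square-bound (2 ℕ.^ μ) ∣ + 2 * f n - + n ∣ ⌊log₂ n ⌋ K β (2 ℕ.^ ⌊log₂ n ⌋) μ n (16^≡ μ)
      (to-ℕ (2 ℕ.^ μ) ∣ + 2 * f n - + n ∣ K β (2 ℕ.^ ⌊log₂ n ⌋) deviation) log≤ (proj₂ binomBound)
      (2^⌊log₂⌋≤ n (ℕₚ.≤-trans (ℕ.s≤s ℕ.z≤n) 2≤n))
      where open Estimate (est n 2≤n)

open import Data.Nat using (ℕ; _≤_; _*_; _^_)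
open import Data.Nat.Logarithm using (⌊log₂_⌋)
import Data.Integer as ℤ
open import Data.Product using (∃; ∃₂; _,_)

theorem1p1 : (f : ℕ → ℤ.ℤ) → IsQtilde f →
    ∃₂ λ (C N : ℕ) → ∀ n → N ≤ n →
    (ℤ.∣ (ℤ.+ 2) ℤ.* f n ℤ.- ℤ.+ n ∣ ^ 2) * ⌊log₂ n ⌋ ≤ C * (n ^ 2)
theorem1p1 f isQ = Proof.conclude f 1272 (Proof.estimate f isQ)
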